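{- Let $H$ be a finite simple graph that contains a connected induced subgraph $C$ having neither a cut vertex nor an adjacent two-vertex cut. Suppose $H$ has a nonedge $e_0$ such that $H+e_0$ is $C$-free. Then $H$ has a finite deletion host.
   Context: All graphs are simple, undirected and finite. A nonedge is an unordered pair of distinct nonadjacent vertices; $H+e_0$ is $H$ with the edge $e_0$ added. "$C$-free" means containing no induced subgraph isomorphic to $C$. A vertex cut of a connected graph is a set of vertices whose removal leaves at least two nonempty components; a cut vertex is a vertex forming a one-element vertex cut; an adjacent two-vertex cut is a vertex cut consisting of the two endpoints of an edge. A finite deletion host for $H$ is a finite graph $G$ such that $E(G)\neq\varnothing$, $G$ is $H$-free (no induced subgraph isomorphic to $H$), and for every $e\in E(G)$ the graph $G-e$ (edge deleted, vertices kept) contains an induced subgraph isomorphic to $H$. -}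

module Defs where

open import Data.Nat using (ℕ)
open import Data.Fin using (Fin; zero; suc; _≟_)
open import Data.Fin.Subset using (Subset; inside; outside; ∣_∣; ∁; ⁅_⁆; _∪_)
open import Data.Product using (Σ; ∃-syntax; _×_; _,_)
open import Data.Sum using (_⊎_; inj₁; inj₂)
open import Data.Vec using ([]; _∷_)
open import Function.Bundles using (_↔_; _⇔_; module Inverse)
open import Level using (0ℓ)
open import Relation.Binary using (Rel; Symmetric; Irreflexive; Decidable)
open import Relation.Binary.Construct.Closure.ReflexiveTransitive using (Star)
open import Relation.Binary.PropositionalEquality using (_≡_; _≢_; refl; sym; trans)
open import Relation.Nullary using (¬_)
open import Relation.Nullary.Decidable using (_×-dec_; _⊎-dec_; ¬?)

-- Vertex sets are Fin n, so finiteness is built in; decidability of adjacency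
-- is part of what "finite graph" means constructively.
record Graph (n : ℕ) : Set₁ where
  field
    _~_      : Rel (Fin n) 0ℓ
    ~-sym    : Symmetric _~_
    ~-irrefl : Irreflexive _≡_ _~_
    _~?_     : Decidable _~_

record _≅_ {m n : ℕ} (G : Graph m) (H : Graph n) : Set where
  open Graph G renaming (_~_ to _~ᴳ_)
  open Graph H renaming (_~_ to _~ᴴ_)
  field
    vertices : Fin m ↔ Fin n
    adjacent : ∀ x y → x ~ᴳ y ⇔ Inverse.to vertices x ~ᴴ Inverse.to vertices y

-- The increasing enumeration of the members of S.
member : ∀ {n} (S : Subset n) → Fin ∣ S ∣ → Fin n
member (inside  ∷ S) zero    = zero
member (inside  ∷ S) (suc i) = suc (member S i)
member (outside ∷ S) i       = suc (member S i)

-- The subgraph induced on S, its vertices relabelled through member.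
_[_] : ∀ {n} → Graph n → (S : Subset n) → Graph ∣ S ∣
G [ S ] = record
  { _~_      = λ x y → member S x ~ member S y
  ; ~-sym    = ~-sym
  ; ~-irrefl = λ { refl → ~-irrefl refl }
  ; _~?_     = λ x y → member S x ~? member S y
  }
  where open Graph G

ContainsInduced : ∀ {m n} → Graph m → Graph n → Set
ContainsInduced {n = n} C G = Σ (Subset n) λ S → C ≅ (G [ S ])

_-Free : ∀ {m n} → Graph m → Graph n → Set
(C -Free) G = ¬ ContainsInduced C G

Reachable : ∀ {n} → Graph n → Rel (Fin n) 0ℓ
Reachable G = Star (Graph._~_ G)

-- The graph with no vertices does not count as connected.
Connected : ∀ {n} → Graph n → Set
Connected {n} G = Fin n × (∀ x y → Reachable G x y)

-- Components are the classes of Reachable, so there are at least two of them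
-- exactly when some two vertices are not reachable from one another.
VertexCut : ∀ {n} → Graph n → Subset n → Set
VertexCut G X = ∃[ x ] ∃[ y ] ¬ Reachable (G [ ∁ X ]) x y

CutVertex : ∀ {n} → Graph n → Fin n → Set
CutVertex G v = VertexCut G ⁅ v ⁆

AdjacentTwoVertexCut : ∀ {n} → Graph n → Fin n → Fin n → Set
AdjacentTwoVertexCut G u v = u ~ v × VertexCut G (⁅ u ⁆ ∪ ⁅ v ⁆)
  where open Graph G

NonEdge : ∀ {n} → Graph n → Fin n → Fin n → Set
NonEdge G u v = u ≢ v × ¬ (u ~ v)
  where open Graph G

-- {x , y} and {u , v} are the same unordered pair.
SamePair : ∀ {n} → Fin n → Fin n → Rel (Fin n) 0ℓ
SamePair u v x y = (x ≡ u × y ≡ v) ⊎ (x ≡ v × y ≡ u)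

samePair-sym : ∀ {n} (u v : Fin n) → Symmetric (SamePair u v)
samePair-sym u v (inj₁ (p , q)) = inj₂ (q , p)
samePair-sym u v (inj₂ (p , q)) = inj₁ (q , p)

samePair? : ∀ {n} (u v : Fin n) → Decidable (SamePair u v)
samePair? u v x y = (x ≟ u ×-dec y ≟ v) ⊎-dec (x ≟ v ×-dec y ≟ u)

addEdge : ∀ {n} → Graph n → (u v : Fin n) → u ≢ v → Graph n
addEdge G u v u≢v = record
  { _~_      = λ x y → x ~ y ⊎ SamePair u v x y
  ; ~-sym    = λ { (inj₁ a) → inj₁ (~-sym a) ; (inj₂ s) → inj₂ (samePair-sym u v s) }
  ; ~-irrefl = λ { x≡y  (inj₁ a)              → ~-irrefl x≡y a
                 ; refl (inj₂ (inj₁ (p , q))) → u≢v (trans (sym p) q)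
                 ; refl (inj₂ (inj₂ (p , q))) → u≢v (trans (sym q) p) }
  ; _~?_     = λ x y → (x ~? y) ⊎-dec samePair? u v x y
  }
  where open Graph G

deleteEdge : ∀ {n} → Graph n → (u v : Fin n) → Graph n
deleteEdge G u v = record
  { _~_      = λ x y → x ~ y × ¬ SamePair u v x y
  ; ~-sym    = λ { (a , ¬s) → ~-sym a , λ s → ¬s (samePair-sym u v s) }
  ; ~-irrefl = λ { x≡y (a , _) → ~-irrefl x≡y a }
  ; _~?_     = λ x y → (x ~? y) ×-dec ¬? (samePair? u v x y)
  }
  where open Graph G

record IsDeletionHost {n N : ℕ} (H : Graph n) (G : Graph N) : Set where
  open Graph G
  field
    hasEdge   : ∃[ u ] ∃[ v ] u ~ v
    free      : (H -Free) G
    deletions : ∀ u v → u ~ v → ContainsInduced H (deleteEdge G u v)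

HasDeletionHost : ∀ {n} → Graph n → Set₁
HasDeletionHost H = ∃[ N ] Σ (Graph N) λ G → IsDeletionHost H G

{-# OPTIONS --safe #-}

-- Let F = H + e₀, a C-free graph. Suppose that G is a union of copies of F such that every edge of G
-- plays the role of e₀ in one of them; then G - e contains H for each edge e. Suppose moreover that
-- every small part of G is glued from copies of F along edges in a tree-like way; then an induced copy
-- of C in G, having neither a cut vertex nor an adjacent two-vertex cut, lies in a single copy of F.
-- So G is C-free, hence H-free.
--
-- To construct G, label the vertices of F by Fin ℓ, in several ways called types, and let a letter for
-- each pair a of labels act on a finite set K by a permutation z_a with z_a^t = 1. A copy of F is an
-- element g of K with a type s. If the pair a is an edge in the types s and s′, the copies (g , s) and
-- (g z_a^(s′-s) , s′) share that edge, and the vertices with label i are the classes of copies that are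
-- connected through pairs containing i. Tree-likeness amounts to this: if a product w₁ ⋯ wₙ of words
-- fixes an element of K, where n ≥ 3 is bounded and the letters of w_k touch the label i_k, then for
-- some k with 1 < k < n the word w_k is a product of powers of the letters i_{k-1}i_k and i_k i_{k+1}.
--
-- The set K is built in two stages. The words touching one label are taken modulo the relations that
-- hold in all actions on few points, which gives a finite set P. If no w_k is of the forbidden form,
-- w₁ ⋯ wₙ moves a point of a chain of n copies of P, with labels i₁, …, iₙ, where consecutive copies
-- are glued along an orbit of the letter i_k i_{k+1}. The words touching a label j still satisfy the
-- relations of P in such a chain, because their orbits lie in a piece labelled j or are small. The
-- action on K is the product of the actions on all chains of bounded length.

module Submission where

open import Data.Nat as ℕ using (ℕ; zero; suc; _+_; _*_; _∸_; _≤_; _<_; s≤s; z≤n; _%_; _/_; _≤′_; ≤′-refl; ≤′-step)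
import Data.Nat.Properties as ℕₚ
open import Data.Nat.DivMod using (m%n<n; %-distribˡ-+; m%n%n≡m%n; [m+n]%n≡m%n; m≡m%n+[m/n]*n; m<n⇒m%n≡m)
open import Data.Fin as Fin using (Fin; zero; suc; toℕ; fromℕ<)
import Data.Fin.Properties as Finₚ
open import Data.Product using (Σ; ∃; ∃-syntax; _×_; _,_; proj₁; proj₂; swap)
open import Data.Sum using (_⊎_; inj₁; inj₂; [_,_]′)
open import Data.Vec as Vec using (Vec; []; _∷_; lookup; tabulate; here; there)
import Data.Vec.Properties as Vecₚ
open import Data.List as List using (List; []; _∷_; _++_; replicate; foldl; length; upTo; cartesianProductWith; allFin; cartesianProduct)
import Data.List.Properties as Listₚ
open import Data.List.Relation.Unary.All as All using (All; []; _∷_)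
open import Data.List.Relation.Unary.Any using (here; there)
open import Data.List.Membership.Propositional using (_∈_; _∉_)
open import Relation.Nullary using (¬_; Dec; yes; no; does)
open import Relation.Nullary.Decidable using (map′; ¬?; _×-dec_; _⊎-dec_; dec-true; dec-false)
open import Relation.Nullary.Negation using (contradiction)
open import Relation.Binary using (DecidableEquality)
open import Relation.Binary.PropositionalEquality using (_≡_; _≢_; refl; sym; trans; cong; cong₂; subst; module ≡-Reasoning; subst₂)
open import Function using (_∘_; id)
open import Data.Sum.Properties using (inj₁-injective; inj₂-injective)
open import Data.List.Membership.Propositional.Properties using (∈-map⁺; ∈-map⁻; ∈-++⁺ˡ; ∈-++⁺ʳ; ∈-++⁻; ∈-upTo⁺; ∈-cartesianProductWith⁺; ∈-cartesianProductWith⁻; ∈-allFin; ∈-cartesianProduct⁺)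
import Data.List.Membership.DecPropositional as DecMembership
open import Data.Empty using (⊥; ⊥-elim)
open import Data.Unit using (⊤; tt)
open import Data.List.Relation.Unary.Linked using (Linked; []; [-]; _∷_)
open import Data.Bool as Bool using (Bool; true; false; not; if_then_else_)
import Data.Bool.Properties as Boolₚ
open import Data.Maybe as Maybe using (Maybe; just; nothing)
open import Data.Maybe.Properties using (just-injective)
open import Data.Product.Properties using (≡-dec)
import Data.List.Relation.Unary.All.Properties as Allₚ
open import Relation.Binary.Construct.Closure.ReflexiveTransitive as Star using (Star; ε; _◅_; _◅◅_)
open import Defs
open import Data.Fin.Subset as Subset using (Subset; inside; outside; ∣_∣; ∁; ⁅_⁆; _∪_)
import Data.Fin.Subset.Properties as Subsetₚ
open import Data.List.Relation.Unary.Linked.Properties using (AllPairs⇒Linked)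
open import Data.List.Relation.Unary.AllPairs using ([]; _∷_)
open import Data.List.Relation.Unary.Unique.Propositional using (Unique)
open import Function.Bundles using (mk⇔; mk↔ₛ′; module Inverse; module Equivalence)
open import Data.Fin.Permutation.Components using (transpose; transpose-inverse)

-- Finite types, iteration and words

-- A one-sided notion: the enumeration may repeat elements, and all that is needed of it
-- is that every element occurs.
record Finite (A : Set) : Set where
  field
    size    : ℕ
    to      : A → Fin size
    from    : Fin size → A
    from-to : ∀ x → from (to x) ≡ x

  to-injective : ∀ {x y} → to x ≡ to y → x ≡ y
  to-injective {x} {y} eq = trans (sym (from-to x)) (trans (cong from eq) (from-to y))

  _≟_ : DecidableEquality A
  x ≟ y = map′ to-injective (cong to) (to x Fin.≟ to y)

  any? : {P : A → Set} → (∀ x → Dec (P x)) → Dec (∃ P)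
  any? {P} P? = map′ (λ (k , p) → from k , p) (λ (x , p) → to x , subst P (sym (from-to x)) p)
                     (Finₚ.any? (P? ∘ from))

  all? : {P : A → Set} → (∀ x → Dec (P x)) → Dec (∀ x → P x)
  all? {P} P? = map′ (λ h x → subst P (from-to x) (h (to x))) (λ h k → h (from k))
                     (Finₚ.all? (P? ∘ from))

fin-finite : ∀ n → Finite (Fin n)
fin-finite n = record { size = n ; to = id ; from = id ; from-to = λ _ → refl }

infixr 2 _×-finite_
infixr 1 _⊎-finite_

_×-finite_ : ∀ {A B} → Finite A → Finite B → Finite (A × B)
FA ×-finite FB = record
  { size    = A.size * B.size
  ; to      = λ (x , y) → Fin.combine (A.to x) (B.to y)
  ; from    = λ k → let (i , j) = Fin.remQuot B.size k in A.from i , B.from j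
  ; from-to = λ (x , y) → trans
      (cong (λ (i , j) → A.from i , B.from j) (Finₚ.remQuot-combine (A.to x) (B.to y)))
      (cong₂ _,_ (A.from-to x) (B.from-to y))
  }
  where module A = Finite FA
        module B = Finite FB

_⊎-finite_ : ∀ {A B} → Finite A → Finite B → Finite (A ⊎ B)
_⊎-finite_ {A} {B} FA FB = record
  { size    = A.size + B.size
  ; to      = λ x → Fin.join A.size B.size (enc x)
  ; from    = λ k → dec (Fin.splitAt A.size k)
  ; from-to = λ x → trans (cong dec (Finₚ.splitAt-join A.size B.size (enc x))) (dec-enc x)
  }
  where
  module A = Finite FA
  module B = Finite FB
  enc : A ⊎ B → Fin A.size ⊎ Fin B.size
  enc (inj₁ x) = inj₁ (A.to x)
  enc (inj₂ y) = inj₂ (B.to y)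
  dec : Fin A.size ⊎ Fin B.size → A ⊎ B
  dec (inj₁ i) = inj₁ (A.from i)
  dec (inj₂ j) = inj₂ (B.from j)
  dec-enc : ∀ x → dec (enc x) ≡ x
  dec-enc (inj₁ x) = cong inj₁ (A.from-to x)
  dec-enc (inj₂ y) = cong inj₂ (B.from-to y)

retract-finite : ∀ {A B : Set} (f : A → B) (g : B → A) → (∀ x → g (f x) ≡ x) → Finite B → Finite A
retract-finite f g gf FB = record
  { size    = B.size
  ; to      = B.to ∘ f
  ; from    = g ∘ B.from
  ; from-to = λ x → trans (cong g (B.from-to (f x))) (gf x)
  }
  where module B = Finite FB

vec-finite : ∀ {A} → Finite A → ∀ n → Finite (Vec A n)
vec-finite FA zero    = record { size = 1 ; to = λ _ → zero ; from = λ _ → [] ; from-to = λ { [] → refl } }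
vec-finite FA (suc n) = retract-finite (λ { (x ∷ xs) → x , xs }) (λ (x , xs) → x ∷ xs) (λ { (x ∷ xs) → refl })
                          (FA ×-finite vec-finite FA n)

vec-ext : ∀ {A : Set} {n} {u v : Vec A n} → (∀ i → lookup u i ≡ lookup v i) → u ≡ v
vec-ext {u = u} {v} h =
  trans (sym (Vecₚ.tabulate∘lookup u)) (trans (Vecₚ.tabulate-cong h) (Vecₚ.tabulate∘lookup v))

iter : {A : Set} → (A → A) → ℕ → A → A
iter f zero    x = x
iter f (suc r) x = iter f r (f x)

iter-+ : ∀ {A : Set} (f : A → A) r q x → iter f (r + q) x ≡ iter f q (iter f r x)
iter-+ f zero    q x = refl
iter-+ f (suc r) q x = iter-+ f r q (f x)

iter-suc : ∀ {A : Set} (f : A → A) r x → iter f r (f x) ≡ f (iter f r x)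
iter-suc f zero    x = refl
iter-suc f (suc r) x = iter-suc f r (f x)

iter-fixed : ∀ {A : Set} (f : A → A) r {x} → f x ≡ x → iter f r x ≡ x
iter-fixed f zero    fx = refl
iter-fixed f (suc r) fx = trans (cong (iter f r) fx) (iter-fixed f r fx)

iter-hom : ∀ {A B : Set} (h : A → B) (f : A → A) (g : B → B) → (∀ x → h (f x) ≡ g (h x)) →
           ∀ r x → h (iter f r x) ≡ iter g r (h x)
iter-hom h f g hf zero    x = refl
iter-hom h f g hf (suc r) x = trans (iter-hom h f g hf r (f x)) (cong (iter g r) (hf x))

iter-hom-on : ∀ {A B : Set} (Q : A → Set) (h : A → B) (f : A → A) (g : B → B) → (∀ {x} → Q x → Q (f x)) →
              (∀ {x} → Q x → h (f x) ≡ g (h x)) → ∀ r {x} → Q x → h (iter f r x) ≡ iter g r (h x)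
iter-hom-on Q h f g qf hf zero    q = refl
iter-hom-on Q h f g qf hf (suc r) q =
  trans (iter-hom-on Q h f g qf hf r (qf q)) (cong (iter g r) (hf q))

iter-preserves : ∀ {A : Set} (Q : A → Set) (f : A → A) → (∀ {x} → Q x → Q (f x)) → ∀ r {x} → Q x → Q (iter f r x)
iter-preserves Q f qf zero    q = q
iter-preserves Q f qf (suc r) q = iter-preserves Q f qf r (qf q)

act : {X Y : Set} → (X → Y → Y) → Y → List X → Y
act step = foldl (λ y a → step a y)

act-++ : ∀ {X Y : Set} (step : X → Y → Y) y u v → act step y (u ++ v) ≡ act step (act step y u) v
act-++ step y u v = Listₚ.foldl-++ (λ y a → step a y) y u v

act-replicate : ∀ {X Y : Set} (step : X → Y → Y) r a y → act step y (replicate r a) ≡ iter (step a) r y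
act-replicate step zero    a y = refl
act-replicate step (suc r) a y = act-replicate step r a (step a y)

-- The map `h` has to commute with the steps only for letters in `J` and points in `Q`. Later it is
-- often the inclusion of a piece in a chain, which is equivariant only for the letters touching one
-- label.
act-hom : ∀ {X Y Z : Set} {J : X → Set} (s : X → Y → Y) (s′ : X → Z → Z) (Q : Y → Set) (h : Y → Z) →
          (∀ {a y} → J a → Q y → Q (s a y)) → (∀ {a y} → J a → Q y → s′ a (h y) ≡ h (s a y)) →
          ∀ {w} → All J w → ∀ {y} → Q y → act s′ (h y) w ≡ h (act s y w)
act-hom s s′ Q h pr eq []       q = refl
act-hom s s′ Q h pr eq {a ∷ w} (j ∷ js) q =
  trans (cong (λ z → act s′ z w) (eq j q)) (act-hom s s′ Q h pr eq js (pr j q))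

act-preserves : ∀ {X Y : Set} {J : X → Set} (s : X → Y → Y) (Q : Y → Set) →
                (∀ {a y} → J a → Q y → Q (s a y)) → ∀ {w} → All J w → ∀ {y} → Q y → Q (act s y w)
act-preserves s Q pr []       q = q
act-preserves s Q pr (j ∷ js) q = act-preserves s Q pr js (pr j q)

act-fixed : ∀ {X Y : Set} (s : X → Y → Y) {y} → (∀ a → s a y ≡ y) → ∀ w → act s y w ≡ y
act-fixed s fx []      = refl
act-fixed s fx (a ∷ w) = trans (cong (λ z → act s z w) (fx a)) (act-fixed s fx w)

-- Exponents modulo `t`

module Modular (t′ : ℕ) where

  t : ℕ
  t = suc t′

  Periodic : {A : Set} → (A → A) → Set
  Periodic f = ∀ x → iter f t x ≡ x

  -- Bounds the lists in `small-orbit` for a chain of `suc k` pieces: each further piece adds a grid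
  -- around its entry and one around its exit, of `t * t` points each.
  bound : ℕ → ℕ
  bound zero    = t * t
  bound (suc k) = t * t + (t * t + bound k)

  infix 4 _≡ₜ_
  record _≡ₜ_ (r q : ℕ) : Set where
    constructor mod
    field rem : r % t ≡ q % t
  open _≡ₜ_ public

  ≡ₜ-reflexive : ∀ {r q} → r ≡ q → r ≡ₜ q
  ≡ₜ-reflexive refl = mod refl

  ≡ₜ-sym : ∀ {r q} → r ≡ₜ q → q ≡ₜ r
  ≡ₜ-sym (mod e) = mod (sym e)

  infixr 4 _⟫_
  _⟫_ : ∀ {r q p} → r ≡ₜ q → q ≡ₜ p → r ≡ₜ p
  mod e ⟫ mod e′ = mod (trans e e′)

  +-cong : ∀ {r r′ q q′} → r ≡ₜ r′ → q ≡ₜ q′ → r + q ≡ₜ r′ + q′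
  +-cong {r} {r′} {q} {q′} (mod e₁) (mod e₂) =
    mod (trans (%-distribˡ-+ r q t) (trans (cong₂ (λ a b → (a + b) % t) e₁ e₂) (sym (%-distribˡ-+ r′ q′ t))))

  +t : ∀ r → r + t ≡ₜ r
  +t r = mod ([m+n]%n≡m%n r t)

  %-≡ₜ : ∀ r → r % t ≡ₜ r
  %-≡ₜ r = mod (m%n%n≡m%n r t)

  +-cancelˡ : ∀ c {r q} → c ≤ t → c + r ≡ₜ c + q → r ≡ₜ q
  +-cancelˡ c {r} {q} c≤t eq = ≡ₜ-sym (drop r) ⟫ +-cong (mod {t ∸ c} {t ∸ c} refl) eq ⟫ drop q
    where
    drop : ∀ r → (t ∸ c) + (c + r) ≡ₜ r
    drop r = ≡ₜ-reflexive (trans (sym (ℕₚ.+-assoc (t ∸ c) c r))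
                          (trans (cong (_+ r) (ℕₚ.m∸n+n≡m c≤t)) (ℕₚ.+-comm t r))) ⟫ +t r

  module _ {A : Set} {f : A → A} (per : Periodic f) where

    iter-* : ∀ k x → iter f (k * t) x ≡ x
    iter-* zero    x = refl
    iter-* (suc k) x = trans (iter-+ f t (k * t) x) (trans (iter-* k _) (per x))

    iter-% : ∀ r x → iter f (r % t) x ≡ iter f r x
    iter-% r x = trans (sym (iter-* (r / t) _))
      (trans (sym (iter-+ f (r % t) (r / t * t) x)) (cong (λ r → iter f r x) (sym (m≡m%n+[m/n]*n r t))))

    iter-≡ₜ : ∀ {r q} → r ≡ₜ q → ∀ x → iter f r x ≡ iter f q x
    iter-≡ₜ {r} {q} (mod eq) x = trans (sym (iter-% r x)) (trans (cong (λ r → iter f r x) eq) (iter-% q x))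

    -- As `t = suc t′`, the power `t′` inverts a map of period `t`; words can thus do with positive
    -- powers of the letters.
    unstep : ∀ x → iter f t′ (f x) ≡ x
    unstep = per

    restep : ∀ x → f (iter f t′ x) ≡ x
    restep x = trans (sym (iter-suc f t′ x)) (per x)

  next : Fin t → Fin t
  next c = fromℕ< (m%n<n (suc (toℕ c)) t)

  toℕ-next : ∀ c → toℕ (next c) ≡ suc (toℕ c) % t
  toℕ-next c = Finₚ.toℕ-fromℕ< _

  toℕ-≡ₜ : ∀ {c d : Fin t} → toℕ c ≡ₜ toℕ d → c ≡ d
  toℕ-≡ₜ {c} {d} (mod eq) = Finₚ.toℕ-injective
    (trans (sym (m<n⇒m%n≡m (Finₚ.toℕ<n c))) (trans eq (m<n⇒m%n≡m (Finₚ.toℕ<n d))))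

  toℕ-iter-next : ∀ r c → toℕ (iter next r c) ≡ₜ toℕ c + r
  toℕ-iter-next zero    c = ≡ₜ-reflexive (sym (ℕₚ.+-identityʳ (toℕ c)))
  toℕ-iter-next (suc r) c = toℕ-iter-next r (next c)
    ⟫ +-cong (≡ₜ-reflexive (toℕ-next c) ⟫ %-≡ₜ (suc (toℕ c))) (mod {r} {r} refl)
    ⟫ ≡ₜ-reflexive (sym (ℕₚ.+-suc (toℕ c) r))

  next-periodic : Periodic next
  next-periodic c = toℕ-≡ₜ (toℕ-iter-next t c ⟫ +t (toℕ c))

  next-faithful : ∀ r q c → iter next r c ≡ iter next q c → r ≡ₜ q
  next-faithful r q c eq = +-cancelˡ (toℕ c) (ℕₚ.<⇒≤ (Finₚ.toℕ<n c))
    (≡ₜ-sym (toℕ-iter-next r c) ⟫ ≡ₜ-reflexive (cong toℕ eq) ⟫ toℕ-iter-next q c)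

  -- Exponents up to congruence, represented by Fin t when one has to search through them.
  residue : ℕ → Fin t
  residue r = fromℕ< (m%n<n r t)

  toℕ-residue : ∀ r → toℕ (residue r) ≡ₜ r
  toℕ-residue r = ≡ₜ-reflexive (Finₚ.toℕ-fromℕ< _) ⟫ %-≡ₜ r

-- Words touching one label

-- The orbit of `one` is a finite group generated by letters of order exactly `t`: by `translate`, a
-- relation that holds at `one` holds everywhere. By `small-action`, its relations between words
-- over `J` hold on every list of at most `M` points that is closed under `J`.
record Pieces (x t′ M : ℕ) : Set₁ where
  open Modular t′
  field
    P                : Set
    P-finite         : Finite P
    stepP            : Fin x → P → P
    one              : P
    stepP-periodic   : ∀ a → Periodic (stepP a)
    stepP-faithful   : ∀ a r q p → iter (stepP a) r p ≡ iter (stepP a) q p → r ≡ₜ q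
    translate        : ∀ {w w′} → act stepP one w ≡ act stepP one w′ → ∀ p → act stepP p w ≡ act stepP p w′
    small-action     : ∀ {Y : Set} (_≟_ : DecidableEquality Y) (step : Fin x → Y → Y) → (∀ a → Periodic (step a)) →
                       ∀ {J : Fin x → Set} → (∀ a → Dec (J a)) → (Λ : List Y) → length Λ ≤ M →
                       (∀ {a y} → J a → y ∈ Λ → step a y ∈ Λ) →
                       ∀ {w w′} → All J w → All J w′ → act stepP one w ≡ act stepP one w′ →
                       ∀ {y} → y ∈ Λ → act step y w ≡ act step y w′

module Piece (x t′ M′ : ℕ) where

  open Modular t′

  M : ℕ
  M = suc M′

  periodic? : (f : Fin M → Fin M) → Dec (Periodic f)
  periodic? f = Finₚ.all? (λ m → iter f t m Fin.≟ m)

  -- Maps that fail to have period `t` are replaced by the identity, so that every vector may serve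
  -- as a table and the index set is easy to enumerate.
  normalise : (Fin M → Fin M) → Fin M → Fin M
  normalise f with periodic? f
  ... | yes _ = f
  ... | no _  = id

  normalise-periodic : ∀ f → Periodic (normalise f)
  normalise-periodic f with periodic? f
  ... | yes p = p
  ... | no _  = λ m → iter-fixed id t refl

  normalise-≗ : ∀ f → Periodic f → ∀ m → normalise f m ≡ f m
  normalise-≗ f p m with periodic? f
  ... | yes _ = refl
  ... | no ¬p = contradiction p ¬p

  Table : Set
  Table = Vec (Vec (Fin M) M) x

  apply : Table → Fin x → Fin M → Fin M
  apply τ a = normalise (lookup (lookup τ a))

  index-finite : Finite (Table × Fin M)
  index-finite = vec-finite (vec-finite (fin-finite M) M) x ×-finite fin-finite M

  open Finite index-finite using (size; to; from; from-to)

  -- A word is recorded by its exponent sums and by its effect on every point of every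
  -- action of the letters on Fin M by maps of period t.
  P : Set
  P = Vec (Fin t) x × Vec (Fin M) size

  P-finite : Finite P
  P-finite = vec-finite (fin-finite t) x ×-finite vec-finite (fin-finite M) size

  stepP : Fin x → P → P
  stepP a (c , v) = Vec.updateAt c a next , tabulate (λ k → apply (proj₁ (from k)) a (lookup v k))

  one : P
  one = Vec.replicate x zero , tabulate (λ k → proj₂ (from k))

  count : Fin x → P → Fin t
  count a (c , _) = lookup c a

  coord : Fin size → P → Fin M
  coord k (_ , v) = lookup v k

  table : Fin size → Table
  table k = proj₁ (from k)

  coord-step : ∀ k a p → coord k (stepP a p) ≡ apply (table k) a (coord k p)
  coord-step k a (c , v) = Vecₚ.lookup∘tabulate _ k

  coord-one : ∀ k → coord k one ≡ proj₂ (from k)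
  coord-one k = Vecₚ.lookup∘tabulate _ k

  coord-act : ∀ k p w → coord k (act stepP p w) ≡ act (apply (table k)) (coord k p) w
  coord-act k p []      = refl
  coord-act k p (a ∷ w) = trans (coord-act k (stepP a p) w)
    (cong (λ m → act (apply (table k)) m w) (coord-step k a p))

  occ₁ : ∀ {A : Set} → Dec A → ℕ → ℕ
  occ₁ (yes _) n = suc n
  occ₁ (no _)  n = n

  occ : Fin x → List (Fin x) → ℕ
  occ b []      = 0
  occ b (a ∷ w) = occ₁ (b Fin.≟ a) (occ b w)

  count-act : ∀ b p w → count b (act stepP p w) ≡ iter next (occ b w) (count b p)
  count-act b p []      = refl
  count-act b p (a ∷ w) = trans (count-act b (stepP a p) w) (first (b Fin.≟ a))
    where
    first : ∀ d → iter next (occ b w) (count b (stepP a p)) ≡ iter next (occ₁ {b ≡ a} d (occ b w)) (count b p)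
    first (yes refl) = cong (iter next (occ b w)) (Vecₚ.lookup∘updateAt b (proj₁ p))
    first (no b≢a)   = cong (iter next (occ b w)) (Vecₚ.lookup∘updateAt′ b a b≢a (proj₁ p))

  P-ext : ∀ {p q} → (∀ a → count a p ≡ count a q) → (∀ k → coord k p ≡ coord k q) → p ≡ q
  P-ext h g = cong₂ _,_ (vec-ext h) (vec-ext g)

  -- The coordinate of `one` indexed by `(τ , m)` is `m` itself; after a word it shows where the
  -- word sends `m` under `τ`.
  act-apply-translate : ∀ {w w′} → act stepP one w ≡ act stepP one w′ →
                        ∀ τ m → act (apply τ) m w ≡ act (apply τ) m w′
  act-apply-translate {w} {w′} eq τ m = trans (sym (value w)) (trans (cong (coord k) eq) (value w′))
    where
    k = to (τ , m)
    value : ∀ w → coord k (act stepP one w) ≡ act (apply τ) m w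
    value w = trans (coord-act k one w) (trans (cong (λ m → act (apply (table k)) m w) (coord-one k))
                (cong (λ ι → act (apply (proj₁ ι)) (proj₂ ι) w) (from-to (τ , m))))

  occ-translate : ∀ {w w′} → act stepP one w ≡ act stepP one w′ → ∀ b → occ b w ≡ₜ occ b w′
  occ-translate {w} {w′} eq b = next-faithful (occ b w) (occ b w′) (count b one)
    (trans (sym (count-act b one w)) (trans (cong (count b) eq) (count-act b one w′)))

  translate : ∀ {w w′} → act stepP one w ≡ act stepP one w′ → ∀ p → act stepP p w ≡ act stepP p w′
  translate {w} {w′} eq p = P-ext
    (λ b → trans (count-act b p w)
      (trans (iter-≡ₜ next-periodic (occ-translate {w} {w′} eq b) _) (sym (count-act b p w′))))
    (λ k → trans (coord-act k p w)
      (trans (act-apply-translate {w} {w′} eq (table k) (coord k p)) (sym (coord-act k p w′))))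

  stepP-periodic : ∀ a → Periodic (stepP a)
  stepP-periodic a p = P-ext
    (λ b → trans (iter-hom (count b) (stepP a) (stepC b) (stepC-hom b) t p) (stepC-periodic b (count b p)))
    (λ k → trans (iter-hom (coord k) (stepP a) (apply (table k) a) (coord-step k a) t p)
                 (normalise-periodic (lookup (lookup (table k) a)) (coord k p)))
    where
    stepC : Fin x → Fin t → Fin t
    stepC b c with b Fin.≟ a
    ... | yes _ = next c
    ... | no _  = c
    stepC-hom : ∀ b q → count b (stepP a q) ≡ stepC b (count b q)
    stepC-hom b q with b Fin.≟ a
    ... | yes refl = Vecₚ.lookup∘updateAt b (proj₁ q)
    ... | no b≢a   = Vecₚ.lookup∘updateAt′ b a b≢a (proj₁ q)
    stepC-periodic : ∀ b → Periodic (stepC b)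
    stepC-periodic b c with b Fin.≟ a
    ... | yes _ = next-periodic c
    ... | no _  = iter-fixed id t refl

  -- The exponent sum of `a` counts the steps modulo `t`; this is the purpose of the first component
  -- of `P`.
  stepP-faithful : ∀ a r q p → iter (stepP a) r p ≡ iter (stepP a) q p → r ≡ₜ q
  stepP-faithful a r q p eq = next-faithful r q (count a p)
    (trans (sym (hom r)) (trans (cong (count a) eq) (hom q)))
    where
    hom : ∀ r → count a (iter (stepP a) r p) ≡ iter next r (count a p)
    hom r = iter-hom (count a) (stepP a) next (λ q → Vecₚ.lookup∘updateAt a (proj₁ q)) r p

  module _ {Y : Set} (_≟_ : DecidableEquality Y) (step : Fin x → Y → Y) (per : ∀ a → Periodic (step a))
           {J : Fin x → Set} (J? : ∀ a → Dec (J a)) (Λ : List Y) (short : length Λ ≤ M)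
           (closed : ∀ {a y} → J a → y ∈ Λ → step a y ∈ Λ) where

    private
      module Embedded (d : Y) (d∈Λ : d ∈ Λ) where

        nth : List Y → ℕ → Y
        -- The point `d` fills the positions beyond the end of `Λ`; since `d ∈ Λ`, every `pt k` lies
        -- in `Λ`.
        nth []       _       = d
        nth (y ∷ ys) zero    = y
        nth (y ∷ ys) (suc k) = nth ys k

        pt : Fin M → Y
        pt k = nth Λ (toℕ k)

        nth-∈ : ∀ ys k → nth ys k ∈ ys ⊎ nth ys k ≡ d
        nth-∈ []       k       = inj₂ refl
        nth-∈ (y ∷ ys) zero    = inj₁ (here refl)
        nth-∈ (y ∷ ys) (suc k) with nth-∈ ys k
        ... | inj₁ p = inj₁ (there p)
        ... | inj₂ p = inj₂ p

        pt-∈ : ∀ k → pt k ∈ Λ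
        pt-∈ k with nth-∈ Λ (toℕ k)
        ... | inj₁ p = p
        ... | inj₂ p = subst (_∈ Λ) (sym p) d∈Λ

        ∈-nth : ∀ {y ys} → y ∈ ys → ∃[ k ] k < length ys × nth ys k ≡ y
        ∈-nth (here refl) = 0 , s≤s z≤n , refl
        ∈-nth (there p) with ∈-nth p
        ... | k , k< , eq = suc k , s≤s k< , eq

        search : ∀ y → Dec (∃ λ k → pt k ≡ y)
        search y = Finₚ.any? (λ k → pt k ≟ y)

        ix : Y → Fin M
        ix y with search y
        ... | yes (k , _) = k
        ... | no _        = zero

        pt-ix : ∀ {y} → y ∈ Λ → pt (ix y) ≡ y
        pt-ix {y} y∈Λ with search y
        ... | yes (k , eq) = eq
        ... | no ∄k with ∈-nth y∈Λ
        ...   | k , k< , eq = contradiction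
                (fromℕ< (ℕₚ.<-≤-trans k< short) , trans (cong (nth Λ) (Finₚ.toℕ-fromℕ< _)) eq) ∄k

        -- Several numbers may name the same point of `Λ`. Only the one chosen by `ix` is moved, and
        -- only by letters in `J`; fixing all the rest keeps the map periodic.
        move : Fin x → Fin M → Fin M
        move a k with J? a | ix (pt k) Fin.≟ k
        ... | yes _ | yes _ = ix (step a (pt k))
        ... | yes _ | no _  = k
        ... | no _  | _     = k

        move-ix : ∀ {a y} → J a → y ∈ Λ → move a (ix y) ≡ ix (step a y)
        move-ix {a} {y} j y∈Λ with J? a | ix (pt (ix y)) Fin.≟ ix y
        ... | yes _ | yes _  = cong (λ z → ix (step a z)) (pt-ix y∈Λ)
        ... | yes _ | no ¬eq = contradiction (cong ix (pt-ix y∈Λ)) ¬eq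
        ... | no ¬j | _      = contradiction j ¬j

        move-fixed : ∀ {a k} → ¬ (J a × ix (pt k) ≡ k) → move a k ≡ k
        move-fixed {a} {k} ¬jk with J? a | ix (pt k) Fin.≟ k
        ... | yes j | yes eq = contradiction (j , eq) ¬jk
        ... | yes _ | no _   = refl
        ... | no _  | _      = refl

        move-iter : ∀ {a} → J a → ∀ r {y} → y ∈ Λ → iter (move a) r (ix y) ≡ ix (iter (step a) r y)
        move-iter     j zero    y∈Λ = refl
        move-iter {a} j (suc r) y∈Λ = trans (cong (iter (move a) r) (move-ix j y∈Λ)) (move-iter j r (closed j y∈Λ))

        move-periodic : ∀ a → Periodic (move a)
        move-periodic a k = cases (J? a) (ix (pt k) Fin.≟ k)
          where
          cases : Dec (J a) → Dec (ix (pt k) ≡ k) → iter (move a) t k ≡ k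
          cases (yes j) (yes eq) = subst (λ k′ → iter (move a) t k′ ≡ k′) eq
            (trans (move-iter j t (pt-∈ k)) (cong ix (per a (pt k))))
          cases (no ¬j) _        = iter-fixed (move a) t (move-fixed (λ (j , _) → ¬j j))
          cases (yes _) (no ¬eq) = iter-fixed (move a) t (move-fixed (λ (_ , eq) → ¬eq eq))

        τ : Table
        τ = tabulate (λ a → tabulate (move a))

        entry : ∀ a k → lookup (lookup τ a) k ≡ move a k
        entry a k = trans (cong (λ v → lookup v k) (Vecₚ.lookup∘tabulate (λ a → tabulate (move a)) a))
                          (Vecₚ.lookup∘tabulate (move a) k)

        apply-τ : ∀ a k → apply τ a k ≡ move a k
        apply-τ a k = trans (normalise-≗ _ (λ m → trans (iter-hom id _ (move a) (entry a) t m) (move-periodic a m)) k)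
                            (entry a k)

        act-ix : ∀ {w} → All J w → ∀ {y} → y ∈ Λ → act (apply τ) (ix y) w ≡ ix (act step y w)
        act-ix js = act-hom step (apply τ) (_∈ Λ) ix (λ j → closed j)
          (λ {a} j y∈Λ → trans (apply-τ a _) (move-ix j y∈Λ)) js

    small-action : ∀ {w w′} → All J w → All J w′ → act stepP one w ≡ act stepP one w′ →
                   ∀ {y} → y ∈ Λ → act step y w ≡ act step y w′
    small-action {w} {w′} js js′ eq {y} y∈Λ = begin
      act step y w              ≡⟨ sym (pt-ix (stays js)) ⟩
      pt (ix (act step y w))    ≡⟨ cong pt (sym (act-ix js y∈Λ)) ⟩
      pt (act (apply τ) (ix y) w)  ≡⟨ cong pt (act-apply-translate {w} {w′} eq τ (ix y)) ⟩
      pt (act (apply τ) (ix y) w′) ≡⟨ cong pt (act-ix js′ y∈Λ) ⟩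
      pt (ix (act step y w′))   ≡⟨ pt-ix (stays js′) ⟩
      act step y w′             ∎
      where
      open ≡-Reasoning
      open Embedded y y∈Λ
      stays : ∀ {w} → All J w → act step y w ∈ Λ
      stays js = act-preserves step (_∈ Λ) closed js y∈Λ

pieces : ∀ x t′ M′ → Pieces x t′ (suc M′)
pieces x t′ M′ = record
  { P              = P
  ; P-finite       = P-finite
  ; stepP          = stepP
  ; one            = one
  ; stepP-periodic = stepP-periodic
  ; stepP-faithful = stepP-faithful
  ; translate      = λ {w} {w′} → translate {w} {w′}
  ; small-action   = λ ≟ step per J? Λ short closed {w} {w′} → small-action ≟ step per J? Λ short closed {w} {w′}
  }
  where open Piece x t′ M′

-- Chains of pieces

length-cartesianProductWith : ∀ {A B C : Set} (f : A → B → C) xs ys →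
                              length (cartesianProductWith f xs ys) ≡ length xs * length ys
length-cartesianProductWith f []       ys = refl
length-cartesianProductWith f (x ∷ xs) ys = trans (Listₚ.length-++ (List.map (f x) ys))
  (cong₂ _+_ (Listₚ.length-map (f x) ys) (length-cartesianProductWith f xs ys))

module Chains (ℓ x t′ M : ℕ) (S : Pieces x t′ M)
  (Touches : Fin x → Fin ℓ → Set) (touches? : ∀ a i → Dec (Touches a i))
  (e : Fin ℓ → Fin ℓ → Fin x) (e-touchesˡ : ∀ i j → Touches (e i j) i) (e-touchesʳ : ∀ i j → Touches (e i j) j)
  (e-unique : ∀ {a i j} → i ≢ j → Touches a i → Touches a j → a ≡ e i j)
  where

  open Modular t′ public
  open Pieces S public

  Word : Fin ℓ → List (Fin x) → Set
  Word j = All (λ a → Touches a j)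

  abstract

    -- The union of the `b`-cycles that meet the `a`-cycle of `p`. If the latter is a glued orbit
    -- and `b` is the only letter of a piece that touches `j`, words touching `j` move the glued
    -- points within this set as long as they stay in the piece.
    grid : Fin x → Fin x → P → List P
    grid a b p = cartesianProductWith (λ r q → iter (stepP b) q (iter (stepP a) r p)) (upTo t) (upTo t)

    length-grid : ∀ a b p → length (grid a b p) ≡ t * t
    length-grid a b p = trans (length-cartesianProductWith _ (upTo t) (upTo t))
      (cong₂ _*_ (Listₚ.length-upTo t) (Listₚ.length-upTo t))

    ∈-grid : ∀ a b p r q → iter (stepP b) q (iter (stepP a) r p) ∈ grid a b p
    ∈-grid a b p r q = subst (_∈ grid a b p)
      (trans (iter-≡ₜ (stepP-periodic b) (%-≡ₜ q) _)
             (cong (iter (stepP b) q) (iter-≡ₜ (stepP-periodic a) (%-≡ₜ r) p)))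
      (∈-cartesianProductWith⁺ _ (∈-upTo⁺ (m%n<n r t)) (∈-upTo⁺ (m%n<n q t)))

    grid-∈ : ∀ {a b p z} → z ∈ grid a b p → ∃[ r ] ∃[ q ] z ≡ iter (stepP b) q (iter (stepP a) r p)
    grid-∈ z∈ with ∈-cartesianProductWith⁻ _ (upTo t) (upTo t) z∈
    ... | r , q , _ , _ , eq = r , q , eq

    grid-closed : ∀ {a b p z} → z ∈ grid a b p → stepP b z ∈ grid a b p
    grid-closed {a} {b} {p} z∈ with grid-∈ z∈
    ... | r , q , refl = subst (_∈ grid a b p) (iter-suc (stepP b) q _) (∈-grid a b p r (suc q))

    cycle : Fin x → P → List P
    cycle b p = List.map (λ r → iter (stepP b) r p) (upTo t)

    length-cycle : ∀ b p → length (cycle b p) ≡ t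
    length-cycle b p = trans (Listₚ.length-map _ (upTo t)) (Listₚ.length-upTo t)

    ∈-cycle : ∀ b p r → iter (stepP b) r p ∈ cycle b p
    ∈-cycle b p r = subst (_∈ cycle b p) (iter-≡ₜ (stepP-periodic b) (%-≡ₜ r) p) (∈-map⁺ _ (∈-upTo⁺ (m%n<n r t)))

    cycle-∈ : ∀ {b p z} → z ∈ cycle b p → ∃[ r ] z ≡ iter (stepP b) r p
    cycle-∈ {b} {p} z∈ with ∈-map⁻ (λ r → iter (stepP b) r p) {xs = upTo t} z∈
    ... | r , _ , eq = r , eq

    cycle-closed : ∀ {b p z} → z ∈ cycle b p → stepP b z ∈ cycle b p
    cycle-closed {b} {p} z∈ with cycle-∈ z∈
    ... | r , refl = subst (_∈ cycle b p) (iter-suc (stepP b) r p) (∈-cycle b p (suc r))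

  Admissible : {C : Set} → (Fin x → C → C) → C → Set
  Admissible step y = ∀ j {w w′} → Word j w → Word j w′ → act stepP one w ≡ act stepP one w′ →
                      act step y w ≡ act step y w′

  -- A chain of pieces, seen from its first piece: κ embeds that piece, on which the letters
  -- touching the label hd act as on P, and Exit is the part of it glued to the next piece.
  -- Another piece can be attached along the orbit of κ one under a letter a with Free a.
  record Chain {C : Set} (FC : Finite C) (B : ℕ) : Set₁ where
    field
      hd          : Fin ℓ
      step        : Fin x → C → C
      periodic    : ∀ a → Periodic (step a)
      κ           : P → C
      κ-injective : ∀ {p q} → κ p ≡ κ q → p ≡ q
      κ-step      : ∀ {a} → Touches a hd → ∀ p → step a (κ p) ≡ κ (stepP a p)
      admissible  : ∀ y → Admissible step y
      Exit        : P → Set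
      Exit?       : ∀ p → Dec (Exit p)

    Free : Fin x → Set
    Free a = ∀ r → ¬ Exit (iter (stepP a) r one)

    Free? : ∀ a → Dec (Free a)
    Free? a = map′ (λ h r → subst (¬_ ∘ Exit) (iter-≡ₜ (stepP-periodic a) (toℕ-residue r) one) (h (residue r)))
                   (λ h r → h (toℕ r))
                   (Finₚ.all? (λ r → ¬? (Exit? (iter (stepP a) (toℕ r) one))))

    field
      -- On an orbit where a piece may be attached, letters that do not touch `hd` are still idle,
      -- so they can be made to act as in the new piece.
      entry-fixed : ∀ {a} → Free a → ∀ {b} → ¬ Touches b hd → ∀ r →
                    step b (κ (iter (stepP a) r one)) ≡ κ (iter (stepP a) r one)
      small-orbit : ∀ {a} → Free a → ∀ {j} → j ≢ hd →
                    ∃ λ (Λ : List C) → length Λ ≤ B × (∀ r → κ (iter (stepP a) r one) ∈ Λ) ×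
                    (∀ {b y} → Touches b j → y ∈ Λ → step b y ∈ Λ)

  stepOn : Fin ℓ → Fin x → P → P
  stepOn i b p with touches? b i
  ... | yes _ = stepP b p
  ... | no _  = p

  stepOn-yes : ∀ {i b} → Touches b i → ∀ p → stepOn i b p ≡ stepP b p
  stepOn-yes {i} {b} b∋i p with touches? b i
  ... | yes _  = refl
  ... | no b∌i = contradiction b∋i b∌i

  stepOn-no : ∀ {i b} → ¬ Touches b i → ∀ p → stepOn i b p ≡ p
  stepOn-no {i} {b} b∌i p with touches? b i
  ... | yes b∋i = contradiction b∋i b∌i
  ... | no _    = refl

  stepOn-periodic : ∀ i b → Periodic (stepOn i b)
  stepOn-periodic i b p with touches? b i
  ... | yes _ = stepP-periodic b p
  ... | no _  = iter-fixed id t refl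

  t≤t*t : t ≤ t * t
  t≤t*t = ℕₚ.m≤m*n t t

  module _ (tt≤M : t * t ≤ M) where

    -- For `j = i` this is `translate`. For another `j`, the only letter touching `j` that moves
    -- anything is `e j i`, so the orbit is a cycle of at most `t` points and `small-action`
    -- applies.
    stepOn-admissible : ∀ i p → Admissible (stepOn i) p
    stepOn-admissible i p j {w} {w′} js js′ eq with j Fin.≟ i
    ... | yes refl = trans (as-P js) (trans (translate {w} {w′} eq p) (sym (as-P js′)))
      where
      as-P : ∀ {w} → Word i w → act (stepOn i) p w ≡ act stepP p w
      as-P js = act-hom stepP (stepOn i) (λ _ → ⊤) id _ (λ b∋i _ → stepOn-yes b∋i _) js tt
    ... | no j≢i = small-action (Finite._≟_ P-finite) (stepOn i) (stepOn-periodic i) (λ b → touches? b j)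
        (cycle (e j i) p) (subst (_≤ M) (sym (length-cycle (e j i) p)) (ℕₚ.≤-trans t≤t*t tt≤M)) closed js js′ eq
        (∈-cycle (e j i) p 0)
      where
      closed : ∀ {b z} → Touches b j → z ∈ cycle (e j i) p → stepOn i b z ∈ cycle (e j i) p
      closed {b} {z} b∋j z∈ with touches? b i
      ... | no _    = z∈
      ... | yes b∋i with refl ← e-unique j≢i b∋j b∋i = cycle-closed z∈

    singleton : Fin ℓ → Chain P-finite (t * t)
    singleton i = record
      { hd          = i
      ; step        = stepOn i
      ; periodic    = stepOn-periodic i
      ; κ           = id
      ; κ-injective = id
      ; κ-step      = stepOn-yes
      ; admissible  = stepOn-admissible i
      ; Exit        = λ _ → ⊥
      ; Exit?       = λ _ → no id
      ; entry-fixed = λ _ b∌i r → stepOn-no b∌i _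
      ; small-orbit = λ {a} _ {j} j≢i → grid a (e j i) one , ℕₚ.≤-reflexive (length-grid a (e j i) one)
                      , (λ r → ∈-grid a (e j i) one r 0) , λ b∋j z∈ → closed j≢i b∋j z∈
      }
      where
      closed : ∀ {a j b z} → j ≢ i → Touches b j → z ∈ grid a (e j i) one → stepOn i b z ∈ grid a (e j i) one
      closed {a} {j} {b} j≢i b∋j z∈ with touches? b i
      ... | no _    = z∈
      ... | yes b∋i with refl ← e-unique j≢i b∋j b∋i = grid-closed {a} z∈

    module Attach {C : Set} {FC : Finite C} {B : ℕ} (ch : Chain FC B) (i : Fin ℓ) where

      open Chain ch

      -- The disjoint union, for the case that no gluing is possible. Every code then yields a
      -- chain, and `agree-down` recovers the action on `ch` from it.
      module Off where

        step′ : Fin x → P ⊎ C → P ⊎ C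
        step′ b (inj₁ p) = inj₁ (stepOn i b p)
        step′ b (inj₂ y) = inj₂ (step b y)

        attach : Chain (P-finite ⊎-finite FC) (t * t + (t * t + B))
        attach = record
          { hd          = i
          ; step        = step′
          ; periodic    = λ { a (inj₁ p) → trans (sym (iter-hom inj₁ _ (step′ a) (λ _ → refl) t p)) (cong inj₁ (stepOn-periodic i a p))
                            ; a (inj₂ y) → trans (sym (iter-hom inj₂ _ (step′ a) (λ _ → refl) t y)) (cong inj₂ (periodic a y)) }
          ; κ           = inj₁
          ; κ-injective = inj₁-injective
          ; κ-step      = λ b∋i p → cong inj₁ (stepOn-yes b∋i p)
          ; admissible  = λ { (inj₁ p) j {w} {w′} js js′ eq → trans (on₁ js) (trans (cong inj₁ (stepOn-admissible i p j js js′ eq)) (sym (on₁ js′)))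
                            ; (inj₂ y) j {w} {w′} js js′ eq → trans (on₂ js) (trans (cong inj₂ (admissible y j js js′ eq)) (sym (on₂ js′))) }
          ; Exit        = λ _ → ⊥
          ; Exit?       = λ _ → no id
          ; entry-fixed = λ _ b∌i r → cong inj₁ (stepOn-no b∌i _)
          ; small-orbit = λ {a} _ {j} j≢i → List.map inj₁ (grid a (e j i) one)
                          , ℕₚ.≤-trans (ℕₚ.≤-reflexive (trans (Listₚ.length-map inj₁ (grid a (e j i) one)) (length-grid a (e j i) one))) (ℕₚ.m≤m+n (t * t) _)
                          , (λ r → ∈-map⁺ inj₁ (∈-grid a (e j i) one r 0)) , λ b∋j z∈ → closed j≢i b∋j z∈
          }
          where
          on₁ : ∀ {J : Fin x → Set} {w p} → All J w → act step′ (inj₁ p) w ≡ inj₁ (act (stepOn i) p w)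
          on₁ js = act-hom (stepOn i) step′ (λ _ → ⊤) inj₁ _ (λ _ _ → refl) js tt
          on₂ : ∀ {J : Fin x → Set} {w y} → All J w → act step′ (inj₂ y) w ≡ inj₂ (act step y w)
          on₂ js = act-hom step step′ (λ _ → ⊤) inj₂ _ (λ _ _ → refl) js tt
          closed : ∀ {a j b z} → j ≢ i → Touches b j → z ∈ List.map inj₁ (grid a (e j i) one) →
                   step′ b z ∈ List.map inj₁ (grid a (e j i) one)
          closed {a} {j} {b} j≢i b∋j z∈ with ∈-map⁻ inj₁ z∈
          ... | z , z∈ , refl with touches? b i
          ...   | no _    = ∈-map⁺ inj₁ z∈
          ...   | yes b∋i with refl ← e-unique j≢i b∋j b∋i = ∈-map⁺ inj₁ (grid-closed {a} z∈)

      module On (i≢hd : i ≢ hd) (p₀ : P) (free : Free (e i hd)) (B≤M : t * t + B ≤ M) where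

        a : Fin x
        a = e i hd

        a-unique : ∀ {b} → Touches b i → Touches b hd → b ≡ a
        a-unique = e-unique i≢hd

        -- The point `δ r` of the new piece is identified with the point `κ (η r)` of `ch`. The
        -- letter `a` acts freely modulo `t` on both orbits, so the identification is well defined
        -- and injective.
        η δ : ℕ → P
        η r = iter (stepP a) r one
        δ r = iter (stepP a) r p₀

        δ-cong : ∀ {r q} → η r ≡ η q → δ r ≡ δ q
        δ-cong {r} {q} eq = iter-≡ₜ (stepP-periodic a) (stepP-faithful a r q one eq) p₀

        η-cong : ∀ {r q} → δ r ≡ δ q → η r ≡ η q
        η-cong {r} {q} eq = iter-≡ₜ (stepP-periodic a) (stepP-faithful a r q p₀ eq) one

        Exit′ : P → Set
        Exit′ q = ∃ λ r → q ≡ δ r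

        exit? : ∀ q → Dec (Exit′ q)
        exit? q = map′ (λ (r , eq) → toℕ r , eq)
          (λ (r , eq) → residue r , trans eq (sym (iter-≡ₜ (stepP-periodic a) (toℕ-residue r) p₀)))
          (Finₚ.any? (λ r → Finite._≟_ P-finite q (δ (toℕ r))))

        Entry : C → Set
        Entry y = ∃ λ r → y ≡ κ (η r)

        entry? : ∀ y → Dec (Entry y)
        entry? y = map′ (λ (r , eq) → toℕ r , eq)
          (λ (r , eq) → residue r , trans eq (cong κ (sym (iter-≡ₜ (stepP-periodic a) (toℕ-residue r) one))))
          (Finₚ.any? (λ r → Finite._≟_ FC y (κ (η (toℕ r)))))

        exit-back : ∀ q → Exit′ (stepP a q) → Exit′ q
        exit-back q (r , eq) = r + t′ ,
          trans (sym (unstep (stepP-periodic a) q)) (trans (cong (iter (stepP a) t′) eq) (sym (iter-+ (stepP a) r t′ p₀)))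

        exit-back* : ∀ r q → Exit′ (iter (stepP a) r q) → Exit′ q
        exit-back* zero    q ex = ex
        exit-back* (suc r) q ex = exit-back q (exit-back* r (stepP a q) ex)

        ν : P → P ⊎ C
        ν q with exit? q
        ... | yes (r , _) = inj₂ (κ (η r))
        ... | no _        = inj₁ q

        ν-exit : ∀ r → ν (δ r) ≡ inj₂ (κ (η r))
        ν-exit r with exit? (δ r)
        ... | yes (r′ , eq) = cong (inj₂ ∘ κ) (η-cong {r′} {r} (sym eq))
        ... | no ¬ex        = contradiction (r , refl) ¬ex

        ν-free : ∀ {q} → ¬ Exit′ q → ν q ≡ inj₁ q
        ν-free {q} ¬ex with exit? q
        ... | yes ex = contradiction ex ¬ex
        ... | no _   = refl

        -- The points inj₁ q with Exit′ q are unused: their place is taken by entry points of ch.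
        step₁ : ∀ b q → Dec (Exit′ q) → Dec (Touches b i) → P ⊎ C
        step₁ b q (no _) (yes _) = ν (stepP b q)
        step₁ b q _      _       = inj₁ q

        -- At a glued point, a letter touching `i` but not `hd` follows the new piece; every other
        -- letter follows `ch`. The one letter touching both labels is `a`, which acts alike on both
        -- sides.
        step₂ : ∀ b y → Dec (Entry y) → Dec (Touches b i) → Dec (Touches b hd) → P ⊎ C
        step₂ b y (yes (r , _)) (yes _) (no _) = ν (stepP b (δ r))
        step₂ b y _             _       _      = inj₂ (step b y)

        step′ : Fin x → P ⊎ C → P ⊎ C
        step′ b (inj₁ q) = step₁ b q (exit? q) (touches? b i)
        step′ b (inj₂ y) = step₂ b y (entry? y) (touches? b i) (touches? b hd)

        step-unused : ∀ {b q} → Exit′ q → step′ b (inj₁ q) ≡ inj₁ q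
        step-unused {b} {q} ex with exit? q
        ... | yes _  = refl
        ... | no ¬ex = contradiction ex ¬ex

        step-idle : ∀ {b q} → ¬ Touches b i → step′ b (inj₁ q) ≡ inj₁ q
        step-idle {b} {q} b∌i with exit? q | touches? b i
        ... | yes _ | _       = refl
        ... | no _  | no _    = refl
        ... | no _  | yes b∋i = contradiction b∋i b∌i

        step-tail : ∀ {b y} → ¬ Entry y ⊎ ¬ Touches b i ⊎ Touches b hd → step′ b (inj₂ y) ≡ inj₂ (step b y)
        step-tail {b} {y} c with entry? y | touches? b i | touches? b hd
        ... | no _   | _       | _        = refl
        ... | yes _  | no _    | _        = refl
        ... | yes _  | yes _   | yes _    = refl
        ... | yes en | yes b∋i | no b∌hd with c
        ...   | inj₁ ¬en          = contradiction en ¬en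
        ...   | inj₂ (inj₁ b∌i)   = contradiction b∋i b∌i
        ...   | inj₂ (inj₂ b∋hd)  = contradiction b∋hd b∌hd

        step-cross : ∀ {b} r → Touches b i → ¬ Touches b hd → step′ b (inj₂ (κ (η r))) ≡ ν (stepP b (δ r))
        step-cross {b} r b∋i b∌hd with entry? (κ (η r)) | touches? b i | touches? b hd
        ... | no ¬en        | _       | _        = contradiction (r , refl) ¬en
        ... | yes _         | no b∌i  | _        = contradiction b∋i b∌i
        ... | yes _         | yes _   | yes b∋hd = contradiction b∋hd b∌hd
        ... | yes (r′ , eq) | yes _   | no _     = cong (ν ∘ stepP b) (δ-cong {r′} {r} (sym (κ-injective eq)))

        ν-step-exit : ∀ {b} → Touches b i → ∀ r → step′ b (ν (δ r)) ≡ ν (stepP b (δ r))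
        ν-step-exit {b} b∋i r = trans (cong (step′ b) (ν-exit r)) (cases (touches? b hd))
          where
          open ≡-Reasoning
          cases : Dec (Touches b hd) → step′ b (inj₂ (κ (η r))) ≡ ν (stepP b (δ r))
          cases (no b∌hd)  = step-cross r b∋i b∌hd
          cases (yes b∋hd) with refl ← a-unique b∋i b∋hd = begin
            step′ a (inj₂ (κ (η r))) ≡⟨ step-tail (inj₂ (inj₂ b∋hd)) ⟩
            inj₂ (step a (κ (η r)))  ≡⟨ cong inj₂ (trans (κ-step b∋hd (η r)) (cong κ (sym (iter-suc (stepP a) r one)))) ⟩
            inj₂ (κ (η (suc r)))     ≡⟨ sym (ν-exit (suc r)) ⟩
            ν (δ (suc r))            ≡⟨ cong ν (iter-suc (stepP a) r p₀) ⟩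
            ν (stepP a (δ r))        ∎

        step-piece : ∀ {b q} → ¬ Exit′ q → Touches b i → step′ b (inj₁ q) ≡ ν (stepP b q)
        step-piece {b} {q} ¬ex b∋i with exit? q | touches? b i
        ... | no _   | yes _  = refl
        ... | yes ex | _      = contradiction ex ¬ex
        ... | no _   | no b∌i = contradiction b∋i b∌i

        ν-step : ∀ {b} → Touches b i → ∀ q → step′ b (ν q) ≡ ν (stepP b q)
        ν-step {b} b∋i q = cases (exit? q)
          where
          cases : Dec (Exit′ q) → step′ b (ν q) ≡ ν (stepP b q)
          cases (yes (r , refl)) = ν-step-exit b∋i r
          cases (no ¬ex)         = trans (cong (step′ b) (ν-free ¬ex)) (step-piece ¬ex b∋i)

        -- A letter touching `i` either avoids `hd` and then fixes the entry orbit by `entry-fixed`,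
        -- or is `a` and rotates it. Either way its inverse maps the orbit to itself.
        entry-back : ∀ {b y} → Touches b i → ¬ Entry y → ¬ Entry (step b y)
        entry-back {b} {y} b∋i ¬en (r , eq) with touches? b hd
        ... | no b∌hd  = ¬en (r , trans (sym (unstep (periodic b) y))
                               (trans (cong (iter (step b) t′) eq) (iter-fixed (step b) t′ (entry-fixed free b∌hd r))))
        ... | yes b∋hd with refl ← a-unique b∋i b∋hd = ¬en (r + t′ , (begin
              y                                ≡⟨ sym (unstep (periodic a) y) ⟩
              iter (step a) t′ (step a y)      ≡⟨ cong (iter (step a) t′) eq ⟩
              iter (step a) t′ (κ (η r))       ≡⟨ sym (iter-hom κ (stepP a) (step a) (λ p → sym (κ-step b∋hd p)) t′ (η r)) ⟩
              κ (iter (stepP a) t′ (η r))      ≡⟨ cong κ (sym (iter-+ (stepP a) r t′ one)) ⟩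
              κ (η (r + t′))                   ∎))
          where open ≡-Reasoning

        ν-periodic : ∀ {b} → Touches b i → ∀ q → iter (step′ b) t (ν q) ≡ ν q
        ν-periodic {b} b∋i q = trans (sym (iter-hom ν (stepP b) (step′ b) (λ q → sym (ν-step b∋i q)) t q))
                                     (cong ν (stepP-periodic b q))

        tail-periodic : ∀ {b} → ¬ Touches b i ⊎ Touches b hd → ∀ y → iter (step′ b) t (inj₂ y) ≡ inj₂ y
        tail-periodic {b} c y = trans (sym (iter-hom inj₂ (step b) (step′ b) (λ y → sym (step-tail (inj₂ c))) t y))
                                      (cong inj₂ (periodic b y))

        step′-periodic : ∀ b → Periodic (step′ b)
        step′-periodic b (inj₁ q) = cases (exit? q) (touches? b i)
          where
          cases : Dec (Exit′ q) → Dec (Touches b i) → iter (step′ b) t (inj₁ q) ≡ inj₁ q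
          cases (yes ex) _         = iter-fixed (step′ b) t (step-unused ex)
          cases (no _)   (no b∌i)  = iter-fixed (step′ b) t (step-idle b∌i)
          cases (no ¬ex) (yes b∋i) = subst (λ z → iter (step′ b) t z ≡ z) (ν-free ¬ex) (ν-periodic b∋i q)
        step′-periodic b (inj₂ y) = cases (entry? y) (touches? b i) (touches? b hd)
          where
          cases : Dec (Entry y) → Dec (Touches b i) → Dec (Touches b hd) → iter (step′ b) t (inj₂ y) ≡ inj₂ y
          cases _ (no b∌i) _                        = tail-periodic (inj₁ b∌i) y
          cases _ (yes _)  (yes b∋hd)               = tail-periodic (inj₂ b∋hd) y
          cases (yes (r , refl)) (yes b∋i) (no _)   = subst (λ z → iter (step′ b) t z ≡ z) (ν-exit r) (ν-periodic b∋i (δ r))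
          cases (no ¬en) (yes b∋i) (no _)           = trans
            (sym (iter-hom-on (¬_ ∘ Entry) inj₂ (step b) (step′ b) (λ ¬en → entry-back b∋i ¬en)
                   (λ ¬en → sym (step-tail (inj₁ ¬en))) t ¬en))
            (cong inj₂ (periodic b y))

        ν-injective : ∀ {p q} → ν p ≡ ν q → p ≡ q
        ν-injective {p} {q} eq with exit? p | exit? q
        ... | no _           | no _            = inj₁-injective eq
        ... | yes (r , refl) | yes (r′ , refl) = δ-cong {r} {r′} (κ-injective (inj₂-injective eq))
        ν-injective {p} {q} () | yes _ | no _
        ν-injective {p} {q} () | no _  | yes _

        open DecMembership (Finite._≟_ (P-finite ⊎-finite FC)) using (_∈?_)

        -- If j is neither i nor hd, the j-orbits meeting the glued orbit lie in the list W.
        module Wedge {j} (j≢i : j ≢ i) (j≢hd : j ≢ hd) where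

          b₀ : Fin x
          b₀ = e j i

          Λ : List C
          Λ = proj₁ (small-orbit free j≢hd)

          Λ-short : length Λ ≤ B
          Λ-short = proj₁ (proj₂ (small-orbit free j≢hd))

          Λ-entry : ∀ r → κ (η r) ∈ Λ
          Λ-entry = proj₁ (proj₂ (proj₂ (small-orbit free j≢hd)))

          Λ-closed : ∀ {b y} → Touches b j → y ∈ Λ → step b y ∈ Λ
          Λ-closed = proj₂ (proj₂ (proj₂ (small-orbit free j≢hd)))

          W : List (P ⊎ C)
          W = List.map ν (grid a b₀ p₀) ++ List.map inj₂ Λ

          W-length : length W ≡ t * t + length Λ
          W-length = trans (Listₚ.length-++ (List.map ν (grid a b₀ p₀)))
            (cong₂ _+_ (trans (Listₚ.length-map ν (grid a b₀ p₀)) (length-grid a b₀ p₀)) (Listₚ.length-map inj₂ Λ))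

          W-short : length W ≤ t * t + B
          W-short = subst (_≤ t * t + B) (sym W-length) (ℕₚ.+-monoʳ-≤ (t * t) Λ-short)

          ∈-W₁ : ∀ {q} → q ∈ grid a b₀ p₀ → ν q ∈ W
          ∈-W₁ q∈ = ∈-++⁺ˡ (∈-map⁺ ν q∈)

          ∈-W₂ : ∀ {y} → y ∈ Λ → inj₂ y ∈ W
          ∈-W₂ y∈ = ∈-++⁺ʳ (List.map ν (grid a b₀ p₀)) (∈-map⁺ inj₂ y∈)

          ν-idle : ∀ {b} → Touches b j → ¬ Touches b i → ∀ q → step′ b (ν q) ≡ ν q ⊎ step′ b (ν q) ∈ W
          ν-idle {b} b∋j b∌i q with exit? q
          ... | no _        = inj₁ (step-idle b∌i)
          ... | yes (r , _) = inj₂ (subst (_∈ W) (sym (step-tail (inj₂ (inj₁ b∌i)))) (∈-W₂ (Λ-closed b∋j (Λ-entry r))))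

          W-closed : ∀ {b z} → Touches b j → z ∈ W → step′ b z ∈ W
          W-closed {b} {z} b∋j z∈ with ∈-++⁻ (List.map ν (grid a b₀ p₀)) z∈
          W-closed {b} {z} b∋j z∈ | inj₁ z∈₁ with ∈-map⁻ ν z∈₁
          ... | q , q∈ , refl with touches? b i
          ...   | yes b∋i with refl ← e-unique j≢i b∋j b∋i =
                    subst (_∈ W) (sym (ν-step b∋i q)) (∈-W₁ (grid-closed {a} q∈))
          ...   | no b∌i with ν-idle b∋j b∌i q
          ...     | inj₁ eq = subst (_∈ W) (sym eq) z∈
          ...     | inj₂ w∈ = w∈
          W-closed {b} {z} b∋j z∈ | inj₂ z∈₂ with ∈-map⁻ inj₂ z∈₂
          ... | y , y∈ , refl = cases (entry? y) (touches? b i) (touches? b hd)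
            where
            cases : Dec (Entry y) → Dec (Touches b i) → Dec (Touches b hd) → step′ b (inj₂ y) ∈ W
            cases (yes (r , refl)) (yes b∋i) (no b∌hd) with refl ← e-unique j≢i b∋j b∋i =
              subst (_∈ W) (sym (step-cross r b∋i b∌hd)) (∈-W₁ (grid-closed {a} (∈-grid a b₀ p₀ r 0)))
            cases (no ¬en) _ _         = subst (_∈ W) (sym (step-tail (inj₁ ¬en))) (∈-W₂ (Λ-closed b∋j y∈))
            cases _ (no b∌i) _         = subst (_∈ W) (sym (step-tail (inj₂ (inj₁ b∌i)))) (∈-W₂ (Λ-closed b∋j y∈))
            cases _ _        (yes b∋h) = subst (_∈ W) (sym (step-tail (inj₂ (inj₂ b∋h)))) (∈-W₂ (Λ-closed b∋j y∈))

          W-back : ∀ {b z} → Touches b j → step′ b z ∈ W → z ∈ W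
          W-back {b} {z} b∋j z∈ = subst (_∈ W) (unstep (step′-periodic b) z)
            (iter-preserves (_∈ W) (step′ b) (W-closed b∋j) t′ z∈)

          entry∈W : ∀ {y} → Entry y → inj₂ y ∈ W
          entry∈W (r , refl) = ∈-W₂ (Λ-entry r)

          -- The list `W` contains all glued points and is closed under steps backwards, so a cycle
          -- that reaches the exit lies in `W` from the start.
          orbit∉W : ∀ {q} → ν q ∉ W → ∀ r → ¬ Exit′ (iter (stepP b₀) r q)
          orbit∉W {q} ∉W zero    (s , refl) = ∉W (∈-W₁ (∈-grid a b₀ p₀ s 0))
          orbit∉W {q} ∉W (suc r) ex = orbit∉W (λ z∈ → ∉W (W-back (e-touchesˡ j i)
            (subst (_∈ W) (sym (ν-step (e-touchesʳ j i) q)) z∈))) r ex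

        short : ∀ {Λ : List (P ⊎ C)} → length Λ ≤ t * t + B → length Λ ≤ M
        short h = ℕₚ.≤-trans h B≤M

        cycle-short : ∀ b q → length (List.map ν (cycle b q)) ≤ M
        cycle-short b q = subst (_≤ M) (sym (trans (Listₚ.length-map ν (cycle b q)) (length-cycle b q)))
          (ℕₚ.≤-trans t≤t*t tt≤M)

        -- Away from the exit, a letter touching `j` moves the point only if it also touches `i`,
        -- that is, if it is `e j i`. The orbit is one cycle of at most `t` points.
        cycle-admissible : ∀ {j} → j ≢ i → ∀ {q} → (∀ r → ¬ Exit′ (iter (stepP (e j i)) r q)) →
                           ∀ {w w′} → Word j w → Word j w′ → act stepP one w ≡ act stepP one w′ →
                           act step′ (ν q) w ≡ act step′ (ν q) w′
        cycle-admissible {j} j≢i {q} ¬ex js js′ eq =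
          small-action (Finite._≟_ (P-finite ⊎-finite FC)) step′ step′-periodic (λ b → touches? b j)
            (List.map ν (cycle (e j i) q)) (cycle-short (e j i) q) closed js js′ eq (∈-map⁺ ν (∈-cycle (e j i) q 0))
          where
          closed : ∀ {b z} → Touches b j → z ∈ List.map ν (cycle (e j i) q) → step′ b z ∈ List.map ν (cycle (e j i) q)
          closed {b} b∋j z∈ with ∈-map⁻ ν z∈
          ... | z , z∈c , refl with touches? b i
          ...   | yes b∋i with refl ← e-unique j≢i b∋j b∋i = subst (_∈ _) (sym (ν-step b∋i z)) (∈-map⁺ ν (cycle-closed z∈c))
          ...   | no b∌i with cycle-∈ z∈c
          ...     | r , refl = subst (λ z → step′ b z ∈ _) (sym (ν-free (¬ex r)))
                      (subst (_∈ _) (sym (step-idle b∌i)) (subst (_∈ _) (ν-free (¬ex r)) z∈))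

        -- For `j = i` the orbit is that of the new piece, which is `P`. For `j = hd` it stays in
        -- `ch` if the point is glued, and otherwise is an `a`-cycle missing the exit. For any other
        -- `j` it lies in `W` or is a cycle missing the exit.
        admissible₁ : ∀ q → Admissible step′ (ν q)
        admissible₁ q j {w} {w′} js js′ eq with j Fin.≟ i
        ... | yes refl = trans (as-P js) (trans (cong ν (translate {w} {w′} eq q)) (sym (as-P js′)))
          where
          as-P : ∀ {w} → Word i w → act step′ (ν q) w ≡ ν (act stepP q w)
          as-P js = act-hom stepP step′ (λ _ → ⊤) ν _ (λ b∋i _ → ν-step b∋i _) js tt
        ... | no j≢i with exit? q
        ...   | no ¬ex with j Fin.≟ hd
        ...     | yes refl = subst (λ z → act step′ z w ≡ act step′ z w′) (ν-free ¬ex)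
                    (cycle-admissible j≢i (λ r ex → ¬ex (exit-back* r q (subst (λ b → Exit′ (iter (stepP b) r q))
                      (a-unique (e-touchesʳ hd i) (e-touchesˡ hd i)) ex))) js js′ eq)
        ...     | no j≢hd with ν q ∈? Wedge.W j≢i j≢hd
        ...       | yes z∈ = subst (λ z → act step′ z w ≡ act step′ z w′) (ν-free ¬ex)
                    (small-action (Finite._≟_ (P-finite ⊎-finite FC)) step′ step′-periodic (λ b → touches? b j)
                      W (short {W} W-short) W-closed js js′ eq z∈)
                    where open Wedge j≢i j≢hd
        ...       | no z∉  = subst (λ z → act step′ z w ≡ act step′ z w′) (ν-free ¬ex)
                    (cycle-admissible j≢i (orbit∉W z∉) js js′ eq)
                    where open Wedge j≢i j≢hd
        admissible₁ q j {w} {w′} js js′ eq | no j≢i | yes (r , refl) with j Fin.≟ hd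
        ...     | yes refl = trans (on-tail js) (trans (cong inj₂ (admissible (κ (η r)) j js js′ eq)) (sym (on-tail js′)))
          where
          on-tail : ∀ {w} → Word hd w → act step′ (inj₂ (κ (η r))) w ≡ inj₂ (act step (κ (η r)) w)
          on-tail js = act-hom step step′ (λ _ → ⊤) inj₂ _ (λ b∋hd _ → step-tail (inj₂ (inj₂ b∋hd))) js tt
        ...     | no j≢hd = small-action (Finite._≟_ (P-finite ⊎-finite FC)) step′ step′-periodic (λ b → touches? b j)
                      W (short {W} W-short) W-closed js js′ eq (entry∈W (r , refl))
          where open Wedge j≢i j≢hd

        -- Outside `W`, for `j = hd`, and for `j = i` by `entry-back`, the orbit never leaves the
        -- action of `ch`, which is admissible; inside `W` it is small.
        admissible₂ : ∀ y → ¬ Entry y → Admissible step′ (inj₂ y)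
        admissible₂ y ¬en j {w} {w′} js js′ eq = cases (j Fin.≟ i) (j Fin.≟ hd)
          where
          via : (Q : C → Set) → (∀ {b y} → Touches b j → Q y → Q (step b y)) →
                (∀ {b y} → Touches b j → Q y → step′ b (inj₂ y) ≡ inj₂ (step b y)) → Q y →
                act step′ (inj₂ y) w ≡ act step′ (inj₂ y) w′
          via Q pr hom q = trans (act-hom step step′ Q inj₂ pr hom js q)
            (trans (cong inj₂ (admissible y j js js′ eq)) (sym (act-hom step step′ Q inj₂ pr hom js′ q)))
          cases : Dec (j ≡ i) → Dec (j ≡ hd) → act step′ (inj₂ y) w ≡ act step′ (inj₂ y) w′
          cases (yes refl) _          = via (¬_ ∘ Entry) (λ b∋i ¬en → entry-back b∋i ¬en) (λ _ ¬en → step-tail (inj₁ ¬en)) ¬en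
          cases (no _)     (yes refl) = via (λ _ → ⊤) _ (λ b∋hd _ → step-tail (inj₂ (inj₂ b∋hd))) tt
          cases (no j≢i)   (no j≢hd)  with inj₂ y ∈? Wedge.W j≢i j≢hd
          ... | yes z∈ = small-action (Finite._≟_ (P-finite ⊎-finite FC)) step′ step′-periodic (λ b → touches? b j)
                           W (short {W} W-short) W-closed js js′ eq z∈
            where open Wedge j≢i j≢hd
          ... | no z∉  = via (λ y → inj₂ y ∉ W)
                           (λ {b} {y} b∋j y∉ z∈ → y∉ (W-back b∋j (subst (_∈ W) (sym (step-tail (inj₁ (y∉ ∘ entry∈W)))) z∈)))
                           (λ _ y∉ → step-tail (inj₁ (y∉ ∘ entry∈W))) z∉
            where open Wedge j≢i j≢hd

        admissible′ : ∀ z → Admissible step′ z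
        admissible′ (inj₁ q) with exit? q
        ... | yes ex = λ j {w} {w′} _ _ _ → trans (act-fixed step′ (λ _ → step-unused ex) w)
                                               (sym (act-fixed step′ (λ _ → step-unused ex) w′))
        ... | no ¬ex = subst (Admissible step′) (ν-free ¬ex) (admissible₁ q)
        admissible′ (inj₂ y) with entry? y
        ... | yes (r , refl) = subst (Admissible step′) (ν-exit r) (admissible₁ (δ r))
        ... | no ¬en         = admissible₂ y ¬en

        -- For `j = hd` only `a` can move the points of the grid, which misses the exit because an
        -- exit point in it would put one on the entry orbit. For any other `j`, an orbit that
        -- leaves the grid around the entry does so through a glued point and continues in `W`.
        small-orbit′ : ∀ {a′} → (∀ r → ¬ Exit′ (iter (stepP a′) r one)) → ∀ {j} → j ≢ i →
                       ∃ λ (Λ : List (P ⊎ C)) → length Λ ≤ t * t + (t * t + B) ×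
                       (∀ r → ν (iter (stepP a′) r one) ∈ Λ) × (∀ {b y} → Touches b j → y ∈ Λ → step′ b y ∈ Λ)
        small-orbit′ {a′} free′ {j} j≢i with j Fin.≟ hd
        ... | yes refl = List.map ν (grid a′ a one)
            , ℕₚ.≤-trans (ℕₚ.≤-reflexive (trans (Listₚ.length-map ν (grid a′ a one)) (length-grid a′ a one))) (ℕₚ.m≤m+n (t * t) _)
            , (λ r → ∈-map⁺ ν (∈-grid a′ a one r 0)) , closed
          where
          closed : ∀ {b z} → Touches b hd → z ∈ List.map ν (grid a′ a one) → step′ b z ∈ List.map ν (grid a′ a one)
          closed {b} b∋hd z∈ with ∈-map⁻ ν z∈
          ... | z , z∈g , refl with touches? b i
          ...   | yes b∋i with refl ← a-unique b∋i b∋hd = subst (_∈ _) (sym (ν-step b∋i z)) (∈-map⁺ ν (grid-closed {a′} z∈g))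
          ...   | no b∌i with grid-∈ z∈g
          ...     | r , q , refl = subst (λ z → step′ b z ∈ _) (sym (ν-free ¬ex))
                      (subst (_∈ _) (sym (step-idle b∌i)) (subst (_∈ _) (ν-free ¬ex) z∈))
            where
            ¬ex : ¬ Exit′ (iter (stepP a) q (iter (stepP a′) r one))
            ¬ex ex = free′ r (exit-back* q _ ex)
        ... | no j≢hd = V ++ W
            , subst (_≤ t * t + (t * t + B)) (sym (trans (Listₚ.length-++ V)
                (cong (_+ length W) (trans (Listₚ.length-map ν (grid a′ b₀ one)) (length-grid a′ b₀ one)))))
                (ℕₚ.+-monoʳ-≤ (t * t) W-short)
            , (λ r → ∈-++⁺ˡ (∈-map⁺ ν (∈-grid a′ b₀ one r 0))) , closed
          where
          open Wedge j≢i j≢hd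
          V = List.map ν (grid a′ b₀ one)
          closed : ∀ {b z} → Touches b j → z ∈ V ++ W → step′ b z ∈ V ++ W
          closed {b} b∋j z∈ with ∈-++⁻ V z∈
          ... | inj₂ z∈W = ∈-++⁺ʳ V (W-closed b∋j z∈W)
          ... | inj₁ z∈V with ∈-map⁻ ν z∈V
          ...   | z , z∈g , refl with touches? b i
          ...     | yes b∋i with refl ← e-unique j≢i b∋j b∋i = subst (_∈ _) (sym (ν-step b∋i z)) (∈-++⁺ˡ (∈-map⁺ ν (grid-closed {a′} z∈g)))
          ...     | no b∌i with ν-idle b∋j b∌i z
          ...       | inj₁ eq = subst (_∈ _) (sym eq) z∈
          ...       | inj₂ w∈ = ∈-++⁺ʳ V w∈

        attach : Chain (P-finite ⊎-finite FC) (t * t + (t * t + B))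
        attach = record
          { hd          = i
          ; step        = step′
          ; periodic    = step′-periodic
          ; κ           = ν
          ; κ-injective = ν-injective
          ; κ-step      = ν-step
          ; admissible  = admissible′
          ; Exit        = Exit′
          ; Exit?       = exit?
          ; entry-fixed = λ {a′} free′ {b} b∌i r → subst (λ z → step′ b z ≡ z) (sym (ν-free (free′ r))) (step-idle b∌i)
          ; small-orbit = small-orbit′
          }

-- Products of words along a chain

module Groups (ℓ x t′ M : ℕ) (S : Pieces x t′ M)
  (Touches : Fin x → Fin ℓ → Set) (touches? : ∀ a i → Dec (Touches a i))
  (e : Fin ℓ → Fin ℓ → Fin x) (e-touchesˡ : ∀ i j → Touches (e i j) i) (e-touchesʳ : ∀ i j → Touches (e i j) j)
  (e-unique : ∀ {a i j} → i ≢ j → Touches a i → Touches a j → a ≡ e i j)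
  where

  open Chains ℓ x t′ M S Touches touches? e e-touchesˡ e-touchesʳ e-unique public

  bound-suc : ∀ k {m} → bound (suc k) ≤ m → bound k ≤ m
  bound-suc k = ℕₚ.≤-trans (ℕₚ.≤-trans (ℕₚ.m≤n+m (bound k) (t * t)) (ℕₚ.m≤n+m _ (t * t)))

  bound-square : ∀ k {m} → bound k ≤ m → t * t ≤ m
  bound-square zero    = id
  bound-square (suc k) = bound-square k ∘ bound-suc k

  Carrier : ℕ → Set
  Carrier zero    = P
  Carrier (suc k) = P ⊎ Carrier k

  carrier-finite : ∀ k → Finite (Carrier k)
  carrier-finite zero    = P-finite
  carrier-finite (suc k) = P-finite ⊎-finite carrier-finite k

  -- The labels of the pieces of a chain, and the point at which each is left for the next.
  Code : ℕ → Set
  Code zero    = Fin ℓ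
  Code (suc k) = Fin ℓ × P × Code k

  code-finite : ∀ k → Finite (Code k)
  code-finite zero    = fin-finite ℓ
  code-finite (suc k) = fin-finite ℓ ×-finite P-finite ×-finite code-finite k

  module Glue k (le : bound (suc k) ≤ M) (ch : Chain (carrier-finite k) (bound k)) (i : Fin ℓ) where
    open Chain ch

    tt≤M : t * t ≤ M
    tt≤M = bound-square (suc k) le

    B≤M : t * t + bound k ≤ M
    B≤M = ℕₚ.≤-trans (ℕₚ.m≤n+m (t * t + bound k) (t * t)) le

    glue : P → Dec (i ≡ hd) → Dec (Free (e i hd)) → Chain (carrier-finite (suc k)) (bound (suc k))
    glue p (no i≢hd) (yes free) = Attach.On.attach tt≤M ch i i≢hd p free B≤M
    glue p (no _)    (no _)     = Attach.Off.attach tt≤M ch i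
    glue p (yes _)   _          = Attach.Off.attach tt≤M ch i

    glue-off : ∀ p d d′ → i ≡ hd → ∀ w y → act (Chain.step (glue p d d′)) (inj₂ y) w ≡ inj₂ (act step y w)
    glue-off p (no i≢hd) d′ i≡hd w       y = contradiction i≡hd i≢hd
    glue-off p (yes eq)  d′ i≡hd []      y = refl
    glue-off p (yes eq)  d′ i≡hd (b ∷ w) y = glue-off p (yes eq) d′ i≡hd w (step b y)

  -- Opaque, because unfolding the nested decisions makes conversion checking infeasible.
  abstract

    chain : ∀ k → bound k ≤ M → Code k → Chain (carrier-finite k) (bound k)
    chain zero    le i           = singleton le i
    chain (suc k) le (i , p , c) = Glue.glue k le ch i p (i Fin.≟ hd) (Free? (e i hd))
      where
      ch : Chain (carrier-finite k) (bound k)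
      ch = chain k (bound-suc k le) c
      open Chain ch

    chain-zero : ∀ le i → chain zero le i ≡ singleton le i
    chain-zero le i = refl

    chain-suc : ∀ k le i p c → let ch = chain k (bound-suc k le) c in
                chain (suc k) le (i , p , c) ≡
                Glue.glue k le ch i p (i Fin.≟ Chain.hd ch) (Chain.Free? ch (e i (Chain.hd ch)))
    chain-suc k le i p c = refl

  Seg : Set
  Seg = Σ (Fin ℓ) λ i → ∃ λ w → Word i w

  label : Seg → Fin ℓ
  label = proj₁

  word : Seg → List (Fin x)
  word = proj₁ ∘ proj₂

  word-ok : ∀ s → Word (label s) (word s)
  word-ok = proj₂ ∘ proj₂

  words : List Seg → List (Fin x)
  words []       = []
  words (s ∷ ss) = word s ++ words ss

  Reduced : List Seg → Set
  Reduced = Linked (λ s s′ → label s ≢ label s′)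

  Splits : Seg → Seg → Seg → Set
  Splits s₁ s₂ s₃ = ∃[ r ] ∃[ q ] act stepP one (word s₂) ≡
    act stepP one (replicate r (e (label s₁) (label s₂)) ++ replicate q (e (label s₂) (label s₃)))

  data Degenerate : List Seg → Set where
    here  : ∀ {s₁ s₂ s₃ ss} → Splits s₁ s₂ s₃ → Degenerate (s₁ ∷ s₂ ∷ s₃ ∷ ss)
    there : ∀ {s ss} → Degenerate ss → Degenerate (s ∷ ss)

  module _ {A B : Set} where

    Second First : A ⊎ B → Set
    Second z = ∃ λ y → z ≡ inj₂ y
    First  z = ∃ λ y → z ≡ inj₁ y

    -- All positions from the start to the end count. They lie beyond the first piece, where
    -- attaching another piece in front changes no step.
    Stays : (Fin x → A ⊎ B → A ⊎ B) → A ⊎ B → List (Fin x) → Set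
    Stays step z []      = Second z
    Stays step z (b ∷ w) = Second z × Stays step (step b z) w

    stays-end : ∀ step z w → Stays step z w → Second (act step z w)
    stays-end step z []      s       = s
    stays-end step z (b ∷ w) (_ , s) = stays-end step (step b z) w s

    disjoint : ∀ {z} → First z → Second z → ⊥
    disjoint (_ , refl) (_ , ())

  -- The invariant for adding pieces at the front: `stays` lets the run survive a gluing, while
  -- `exit-orbit` turns the failure of a gluing into a splitting of `word s`.
  record Walk {A : Set} {FC : Finite (P ⊎ A)} {B} (ch : Chain FC B) (s s′ : Seg) (w : List (Fin x)) : Set where
    open Chain ch
    field
      hd-label   : hd ≡ label s
      exit-orbit : ∀ {q} → Exit q → ∃[ r ] q ≡ iter (stepP (e (label s) (label s′))) r (act stepP one (word s))
      κ-first    : ∀ {q} → ¬ Exit q → First (κ q)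
      stays      : Stays step (act step (κ one) (word s)) w

  module Extend (tt≤M : t * t ≤ M) {C : Set} {FC : Finite C} {B} (ch : Chain FC B) (B≤M : t * t + B ≤ M) (s : Seg)
                (i≢hd : label s ≢ Chain.hd ch) (free : Chain.Free ch (e (label s) (Chain.hd ch)))
                {w′} (js′ : Word (Chain.hd ch) w′) where

    open Chain ch
    open Attach.On tt≤M ch (label s) i≢hd (act stepP one (word s)) free B≤M

    s′ : Seg
    s′ = hd , w′ , js′

    -- Within the new piece, `word s` leads from `one` to `p₀ = δ 0`, which is glued to the starting
    -- point `κ one` of `ch`.
    after : act step′ (ν one) (word s) ≡ inj₂ (κ one)
    after = trans (act-hom stepP step′ (λ _ → ⊤) ν _ (λ b∋i _ → ν-step b∋i _) (word-ok s) tt) (ν-exit 0)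

    stays-prefix : ∀ {w} → Word hd w → ∀ y v → Stays step′ (inj₂ (act step y w)) v → Stays step′ (inj₂ y) (w ++ v)
    stays-prefix []               y v st = st
    stays-prefix {b ∷ w} (j ∷ js) y v st = (y , refl) ,
      subst (λ z → Stays step′ z (w ++ v)) (sym (step-tail (inj₂ (inj₂ j)))) (stays-prefix js (step b y) v st)

    walk : ∀ v → Stays step′ (inj₂ (act step (κ one) w′)) v → Walk attach s s′ (w′ ++ v)
    walk v st = record
      { hd-label   = refl
      ; exit-orbit = id
      ; κ-first    = λ {q} ¬ex → q , ν-free ¬ex
      ; stays      = subst (λ z → Stays step′ z (w′ ++ v)) (sym after) (stays-prefix js′ (κ one) v st)
      }

  module Continue (tt≤M : t * t ≤ M) {A : Set} {FC : Finite (P ⊎ A)} {B} (ch : Chain FC B) (B≤M : t * t + B ≤ M) (s : Seg)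
                  (i≢hd : label s ≢ Chain.hd ch) (free : Chain.Free ch (e (label s) (Chain.hd ch)))
                  {w′} (js′ : Word (Chain.hd ch) w′) {s″ v} (wk : Walk ch (Chain.hd ch , w′ , js′) s″ v) where

    open Chain ch
    open Walk wk
    open Attach.On tt≤M ch (label s) i≢hd (act stepP one (word s)) free B≤M
    open Extend tt≤M ch B≤M s i≢hd free js′

    -- Entry points lie in the first summand, because the orbit is free of exit points; hence a
    -- point of the second summand is not affected by the gluing.
    second-tail : ∀ {y b} → Second y → step′ b (inj₂ y) ≡ inj₂ (step b y)
    second-tail sec = step-tail (inj₁ λ { (r , refl) → disjoint (κ-first (free r)) sec })

    stays-tail : ∀ y v → Stays step y v → Stays step′ (inj₂ y) v
    stays-tail y []      st         = y , refl
    stays-tail y (b ∷ v) (sec , st) = (y , refl) ,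
      subst (λ z → Stays step′ z v) (sym (second-tail sec)) (stays-tail (step b y) v st)

    act-tail : ∀ y v → Stays step y v → act step′ (inj₂ y) v ≡ inj₂ (act step y v)
    act-tail y []      st         = refl
    act-tail y (b ∷ v) (sec , st) = trans (cong (λ z → act step′ z v) (second-tail sec)) (act-tail (step b y) v st)

    walk′ : Walk attach s s′ (w′ ++ v)
    walk′ = walk v (stays-tail _ v stays)

    end : act step′ (ν one) (word s ++ (w′ ++ v)) ≡ inj₂ (act step (act step (κ one) w′) v)
    end = begin
      act step′ (ν one) (word s ++ (w′ ++ v))            ≡⟨ act-++ step′ (ν one) (word s) (w′ ++ v) ⟩
      act step′ (act step′ (ν one) (word s)) (w′ ++ v)   ≡⟨ cong (λ z → act step′ z (w′ ++ v)) after ⟩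
      act step′ (inj₂ (κ one)) (w′ ++ v)                 ≡⟨ act-++ step′ (inj₂ (κ one)) w′ v ⟩
      act step′ (act step′ (inj₂ (κ one)) w′) v          ≡⟨ cong (λ z → act step′ z v) (act-hom step step′ (λ _ → ⊤) inj₂ _ (λ j _ → step-tail (inj₂ (inj₂ j))) js′ tt) ⟩
      act step′ (inj₂ (act step (κ one) w′)) v           ≡⟨ act-tail _ v stays ⟩
      inj₂ (act step (act step (κ one) w′) v)            ∎
      where open ≡-Reasoning

    -- The run ends beyond the first piece of `ch`. The start is either a point of the new piece
    -- proper or a glued point, and the latter belongs to the first piece of `ch`.
    moves : act step′ (ν one) (word s ++ (w′ ++ v)) ≢ ν one
    moves eq = cases (exit? one)
      where
      cases : Dec (Exit′ one) → ⊥
      cases (no ¬ex)        = contradiction (trans (sym end) (trans eq (ν-free ¬ex))) λ ()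
      cases (yes (r , one≡)) = disjoint (κ-first (free r))
        (subst Second (inj₂-injective (trans (sym end) (trans eq (trans (cong ν one≡) (ν-exit r)))))
               (stays-end step _ v stays))

  module _ (tt≤M : t * t ≤ M) {A : Set} {FC : Finite (P ⊎ A)} {B} (B≤M : t * t + B ≤ M) (s s′ : Seg) where

    extended-walk : ∀ {s″ v} (ch : Chain FC B) → Walk ch s′ s″ v → ∀ i≢hd free →
                    Walk (Attach.On.attach tt≤M ch (label s) i≢hd (act stepP one (word s)) free B≤M) s s′ (word s′ ++ v)
    extended-walk ch wk i≢hd free with refl ← Walk.hd-label wk =
      Continue.walk′ tt≤M ch B≤M s i≢hd free (word-ok s′) wk

    extended-moves : ∀ {s″ v} (ch : Chain FC B) → Walk ch s′ s″ v → ∀ i≢hd free →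
                     let ch′ = Attach.On.attach tt≤M ch (label s) i≢hd (act stepP one (word s)) free B≤M in
                     act (Chain.step ch′) (Chain.κ ch′ one) (word s ++ (word s′ ++ v)) ≢ Chain.κ ch′ one
    extended-moves ch wk i≢hd free with refl ← Walk.hd-label wk =
      Continue.moves tt≤M ch B≤M s i≢hd free (word-ok s′) wk

  not-free : ∀ {C} {FC : Finite C} {B} (ch : Chain FC B) a → ¬ Chain.Free ch a → ∃[ r ] Chain.Exit ch (iter (stepP a) r one)
  not-free ch a ¬free with Finₚ.any? (λ r → Chain.Exit? ch (iter (stepP a) (toℕ r) one))
  ... | yes (r , ex) = toℕ r , ex
  ... | no ∄r        = contradiction (λ r ex → ∄r (residue r ,
          subst (Chain.Exit ch) (sym (iter-≡ₜ (stepP-periodic a) (toℕ-residue r) one)) ex)) ¬free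

  -- A blocked gluing means that the `a`-orbit of `one` meets the `b`-orbit of the value of
  -- `word s₂`. Going to a common point by `a` and back by `b` gives the splitting; the exponent
  -- `q * t′` stands for `-q`.
  splits : ∀ {A} {FC : Finite (P ⊎ A)} {B} {ch : Chain FC B} {s₁ s₂ s₃ v} → Walk ch s₂ s₃ v →
           ¬ Chain.Free ch (e (label s₁) (label s₂)) → Splits s₁ s₂ s₃
  splits {ch = ch} {s₁} {s₂} {s₃} wk ¬free with not-free ch _ ¬free
  ... | r , ex with Walk.exit-orbit wk ex
  ...   | q , eq = r , q * t′ , (begin
      p                                                         ≡⟨ sym (iter-* (stepP-periodic b) q p) ⟩
      iter (stepP b) (q * t) p                                  ≡⟨ cong (λ m → iter (stepP b) m p) (ℕₚ.*-suc q t′) ⟩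
      iter (stepP b) (q + q * t′) p                             ≡⟨ iter-+ (stepP b) q (q * t′) p ⟩
      iter (stepP b) (q * t′) (iter (stepP b) q p)              ≡⟨ cong (iter (stepP b) (q * t′)) (sym eq) ⟩
      iter (stepP b) (q * t′) (iter (stepP a) r one)            ≡⟨ cong (iter (stepP b) (q * t′)) (sym (act-replicate stepP r a one)) ⟩
      iter (stepP b) (q * t′) (act stepP one (replicate r a))   ≡⟨ sym (act-replicate stepP (q * t′) b _) ⟩
      act stepP (act stepP one (replicate r a)) (replicate (q * t′) b) ≡⟨ sym (act-++ stepP one (replicate r a) _) ⟩
      act stepP one (replicate r a ++ replicate (q * t′) b)     ∎)
    where
    open ≡-Reasoning
    a = e (label s₁) (label s₂)
    b = e (label s₂) (label s₃)
    p = act stepP one (word s₂)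

  module Build {k} (le : bound (suc k) ≤ M) (c : Code k) (s : Seg) where

    ch : Chain (carrier-finite k) (bound k)
    ch = chain k (bound-suc k le) c

    open Chain ch
    open Glue k le ch (label s) public

    p : P
    p = act stepP one (word s)

    code : Code (suc k)
    code = label s , p , c

    on : ∀ d d′ → label s ≢ hd → Free (e (label s) hd) → ∀ {Q : Chain (carrier-finite (suc k)) (bound (suc k)) → Set} →
         (∀ i≢hd free → Q (Attach.On.attach tt≤M ch (label s) i≢hd p free B≤M)) → Q (glue p d d′)
    on (yes eq) _        ne fr h = contradiction eq ne
    on (no _)   (no ¬fr) ne fr h = contradiction fr ¬fr
    on (no ne′)  (yes fr′) ne fr h = h ne′ fr′

    at-code : (Q : Chain (carrier-finite (suc k)) (bound (suc k)) → Set) → label s ≢ hd → Free (e (label s) hd) →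
              (∀ i≢hd free → Q (Attach.On.attach tt≤M ch (label s) i≢hd p free B≤M)) → Q (chain (suc k) le code)
    at-code Q ne fr h = subst Q (sym (chain-suc k le (label s) p c)) (on (label s Fin.≟ hd) (Free? (e (label s) hd)) ne fr {Q} h)

  Walked : ∀ s s′ ss → bound (suc (length ss)) ≤ M → Set
  Walked s s′ ss le = ∃ λ c → Walk (chain (suc (length ss)) le c) s s′ (words (s′ ∷ ss))

  extend : ∀ s s′ s″ ss le → label s ≢ label s′ → Walked s′ s″ ss (bound-suc (suc (length ss)) le) →
           Splits s s′ s″ ⊎ Walked s s′ (s″ ∷ ss) le
  extend s s′ s″ ss le ne (c , wk) = go (Free? (e (label s) (label s′)))
    where
    open Build {suc (length ss)} le c s
    open Chain ch
    go : Dec (Free (e (label s) (label s′))) → Splits s s′ s″ ⊎ Walked s s′ (s″ ∷ ss) le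
    go (no ¬free) = inj₁ (splits {s₁ = s} wk ¬free)
    go (yes free) = inj₂ (code ,
      at-code (λ ch → Walk ch s s′ (word s′ ++ words (s″ ∷ ss)))
        (λ eq → ne (trans eq (Walk.hd-label wk)))
        (subst (λ j → Free (e (label s) j)) (sym (Walk.hd-label wk)) free)
        (extended-walk tt≤M B≤M s s′ ch wk))

  -- The chain is built from the last word to the first, each new piece being left at the value of
  -- its word. If a gluing is blocked, the word at that place splits.
  build : ∀ s s′ ss (le : bound (suc (length ss)) ≤ M) → Reduced (s ∷ s′ ∷ ss) →
          Degenerate (s ∷ s′ ∷ ss) ⊎ Walked s s′ ss le
  build s s′ [] le (ne ∷ _) = inj₂ (code , at-code (λ ch → Walk ch s s′ (word s′ ++ []))
      (λ eq → ne (trans eq (cong Chain.hd eqc))) (subst (λ ch → Chain.Free ch (e (label s) (Chain.hd ch))) (sym eqc) (λ _ ())) two-pieces)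
    where
    open Build {zero} le (label s′) s
    eqc : ch ≡ singleton (bound-suc zero le) (label s′)
    eqc = chain-zero (bound-suc zero le) (label s′)
    two-pieces : ∀ i≢hd free → Walk (Attach.On.attach tt≤M ch (label s) i≢hd p free B≤M) s s′ (word s′ ++ [])
    two-pieces rewrite eqc = λ i≢hd free →
      Extend.walk tt≤M (singleton (bound-suc zero le) (label s′)) B≤M s i≢hd free (word-ok s′) [] (_ , refl)
  build s s′ (s″ ∷ ss) le (ne ∷ red) =
    [ inj₁ ∘ there , (λ wk → [ inj₁ ∘ here , inj₂ ]′ (extend s s′ s″ ss le ne wk)) ]′
      (build s′ s″ ss (bound-suc (suc (length ss)) le) red)

  Agree : ∀ k → bound k ≤ M → List (Fin x) → List (Fin x) → Set
  Agree k le w w′ = ∀ c y → act (Chain.step (chain k le c)) y w ≡ act (Chain.step (chain k le c)) y w′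

  -- Putting a piece with the label of the head in front forces the disjoint union, whose second
  -- summand is the shorter chain.
  agree-down : ∀ k le {w w′} → Agree (suc k) le w w′ → Agree k (bound-suc k le) w w′
  agree-down k le {w} {w′} agree c y = inj₂-injective
    (trans (sym (glue-off one d d′ refl w y)) (trans
      (subst (λ ch → act (Chain.step ch) (inj₂ y) w ≡ act (Chain.step ch) (inj₂ y) w′) (chain-suc k le hd one c) (agree (hd , one , c) (inj₂ y)))
      (glue-off one d d′ refl w′ y)))
    where
    open Glue k le (chain k (bound-suc k le) c) (Chain.hd (chain k (bound-suc k le) c))
    open Chain (chain k (bound-suc k le) c)
    d  = hd Fin.≟ hd
    d′ = Free? (e hd hd)

  agree-below : ∀ {k k′} → k ≤′ k′ → ∀ le le′ {w w′} → Agree k′ le′ w w′ → Agree k le w w′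
  agree-below ≤′-refl            le le′ {w} {w′} agree = subst (λ le → Agree _ le w w′) (ℕₚ.≤-irrelevant le′ le) agree
  agree-below (≤′-step {k′} k≤k′) le le′ {w} {w′} agree =
    agree-below k≤k′ le (bound-suc k′ le′) {w} {w′} (agree-down k′ le′ {w} {w′} agree)

  -- If the last remaining gluing were possible, the product of the words would move the starting
  -- point of the resulting chain, contrary to its trivial action.
  first-splits : ∀ s₁ s₂ s₃ ss (le : bound (suc (suc (length ss))) ≤ M) → label s₁ ≢ label s₂ →
                 Agree (suc (suc (length ss))) le (words (s₁ ∷ s₂ ∷ s₃ ∷ ss)) [] →
                 Walked s₂ s₃ ss (bound-suc (suc (length ss)) le) → Splits s₁ s₂ s₃
  first-splits s₁ s₂ s₃ ss le ne triv (c , wk) = go (Free? (e (label s₁) (label s₂)))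
    where
    open Build {suc (length ss)} le c s₁
    open Chain ch
    Moves : Chain (carrier-finite (suc (suc (length ss)))) (bound (suc (suc (length ss)))) → Set
    Moves ch = act (Chain.step ch) (Chain.κ ch one) (words (s₁ ∷ s₂ ∷ s₃ ∷ ss)) ≢ Chain.κ ch one
    go : Dec (Free (e (label s₁) (label s₂))) → Splits s₁ s₂ s₃
    go (no ¬free) = splits {s₁ = s₁} wk ¬free
    go (yes free) = ⊥-elim (at-code Moves (λ eq → ne (trans eq (Walk.hd-label wk)))
      (subst (λ j → Free (e (label s₁) j)) (sym (Walk.hd-label wk)) free)
      (extended-moves tt≤M B≤M s₁ s₂ ch wk) (triv code _))

  degenerate : ∀ s₁ s₂ s₃ ss (le : bound (suc (suc (length ss))) ≤ M) → Reduced (s₁ ∷ s₂ ∷ s₃ ∷ ss) →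
               Agree (suc (suc (length ss))) le (words (s₁ ∷ s₂ ∷ s₃ ∷ ss)) [] → Degenerate (s₁ ∷ s₂ ∷ s₃ ∷ ss)
  degenerate s₁ s₂ s₃ ss le (ne ∷ red) triv =
    [ there , (λ wk → here (first-splits s₁ s₂ s₃ ss le ne triv wk)) ]′ (build s₂ s₃ ss (bound-suc (suc (length ss)) le) red)

  -- The product of all chain actions

  module Group (L : ℕ) (le : bound L ≤ M) where

    abstract

      point-finite : Finite (Code L × Carrier L)
      point-finite = code-finite L ×-finite carrier-finite L

      -- There is a coordinate for each pair of a code and a point of its chain, so that `unit`
      -- lists every point of every chain and an element reached by a word lists their images.
      K : Set
      K = Vec (Carrier L) (Finite.size point-finite)

      K-finite : Finite K
      K-finite = vec-finite (carrier-finite L) _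

      code : Fin (Finite.size point-finite) → Code L
      code k = proj₁ (Finite.from point-finite k)

      stepC : Code L → Fin x → Carrier L → Carrier L
      stepC c = Chain.step (chain L le c)

      stepC-periodic : ∀ c a → Periodic (stepC c a)
      stepC-periodic c = Chain.periodic (chain L le c)

      coord : Fin (Finite.size point-finite) → K → Carrier L
      coord k g = lookup g k

      stepK : Fin x → K → K
      stepK a g = tabulate (λ k → stepC (code k) a (coord k g))

      unit : K
      unit = tabulate (λ k → proj₂ (Finite.from point-finite k))

      coord-step : ∀ k a g → coord k (stepK a g) ≡ stepC (code k) a (coord k g)
      coord-step k a g = Vecₚ.lookup∘tabulate _ k

      coord-act : ∀ k w g → coord k (act stepK g w) ≡ act (stepC (code k)) (coord k g) w
      coord-act k []      g = refl
      coord-act k (a ∷ w) g = trans (coord-act k w (stepK a g)) (cong (λ y → act (stepC (code k)) y w) (coord-step k a g))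

      stepK-periodic : ∀ a → Periodic (stepK a)
      stepK-periodic a g = vec-ext (λ k →
        trans (iter-hom (coord k) (stepK a) (stepC (code k) a) (coord-step k a) t g) (stepC-periodic (code k) a _))

      -- The elements of K that are permutations in each chain, as are those reachable from unit.
      Valid : K → Set
      Valid g = ∀ c y → ∃ λ k → code k ≡ c × coord k g ≡ y

      valid? : ∀ g → Dec (Valid g)
      valid? g = Finite.all? (code-finite L) (λ c → Finite.all? (carrier-finite L) (λ y → Finₚ.any? (λ k →
        Finite._≟_ (code-finite L) (code k) c ×-dec Finite._≟_ (carrier-finite L) (coord k g) y)))

      valid-unit : Valid unit
      valid-unit c y = Finite.to point-finite (c , y) , cong proj₁ (Finite.from-to point-finite (c , y)) ,
        trans (Vecₚ.lookup∘tabulate (λ k → proj₂ (Finite.from point-finite k)) (Finite.to point-finite (c , y))) (cong proj₂ (Finite.from-to point-finite (c , y)))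

      valid-step : ∀ {a g} → Valid g → Valid (stepK a g)
      valid-step {a} {g} v c y with v c (iter (stepC c a) t′ y)
      ... | k , refl , eq = k , refl ,
            trans (coord-step k a g) (trans (cong (stepC (code k) a) eq) (restep (stepC-periodic (code k) a) y))

      agree : ∀ {g w w′} → Valid g → act stepK g w ≡ act stepK g w′ → Agree L le w w′
      agree {g} {w} {w′} v eq c y with v c y
      ... | k , refl , refl = trans (sym (coord-act k w g)) (trans (cong (coord k) eq) (coord-act k w′ g))

      -- Agreement on all long chains descends to chains with a single piece, and the one labelled
      -- `i` acts by words touching `i` as `P` does.
      same-in-P : ∀ {i g w w′} → Valid g → Word i w → Word i w′ → act stepK g w ≡ act stepK g w′ →
                  act stepP one w ≡ act stepP one w′
      same-in-P {i} {g} {w} {w′} v js js′ eq = trans (sym (as-P js)) (trans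
        (subst (λ ch → act (Chain.step ch) one w ≡ act (Chain.step ch) one w′) (chain-zero le₀ i)
          (agree-below (ℕₚ.≤⇒≤′ (z≤n {L})) le₀ le {w} {w′} (agree {g} {w} {w′} v eq) i one)) (as-P js′))
        where
        le₀ : bound 0 ≤ M
        le₀ = bound-square L le
        as-P : ∀ {w} → Word i w → act (stepOn i) one w ≡ act stepP one w
        as-P js = act-hom stepP (stepOn i) (λ _ → ⊤) id _ (λ b∋i _ → stepOn-yes b∋i _) js tt

      same-in-K : ∀ {i w w′} → Word i w → Word i w′ → act stepP one w ≡ act stepP one w′ → ∀ g → act stepK g w ≡ act stepK g w′
      same-in-K {i} {w} {w′} js js′ eq g = vec-ext (λ k → trans (coord-act k w g)
        (trans (Chain.admissible (chain L le (code k)) (coord k g) i js js′ eq) (sym (coord-act k w′ g))))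

      degenerate-K : ∀ {g} s₁ s₂ s₃ ss → length ss + 2 ≤ L → Valid g → Reduced (s₁ ∷ s₂ ∷ s₃ ∷ ss) →
                     act stepK g (words (s₁ ∷ s₂ ∷ s₃ ∷ ss)) ≡ g → Degenerate (s₁ ∷ s₂ ∷ s₃ ∷ ss)
      degenerate-K {g} s₁ s₂ s₃ ss len v red eq = degenerate s₁ s₂ s₃ ss le′ red
        (agree-below k≤L le′ le {words (s₁ ∷ s₂ ∷ s₃ ∷ ss)} {[]} (agree {g} {words (s₁ ∷ s₂ ∷ s₃ ∷ ss)} {[]} v eq))
        where
        k≤L : suc (suc (length ss)) ≤′ L
        k≤L = ℕₚ.≤⇒≤′ (subst (_≤ L) (ℕₚ.+-comm (length ss) 2) len)
        below : ∀ {k k′} → k ≤′ k′ → bound k′ ≤ M → bound k ≤ M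
        below ≤′-refl      = id
        below (≤′-step {k′} p) = below p ∘ bound-suc k′
        le′ : bound (suc (suc (length ss))) ≤ M
        le′ = below k≤L le

-- Reachability, canonical representatives and letters

module Reachability {A : Set} (FA : Finite A) (R : A → A → Set) (R? : ∀ x y → Dec (R x y)) where

  -- Paths with intermediate vertices in the list, as in Warshall's algorithm.
  Via : List A → A → A → Set
  Via []       x y = R x y ⊎ x ≡ y
  Via (k ∷ ks) x y = Via ks x y ⊎ (Via ks x k × Via ks k y)

  via? : ∀ ks x y → Dec (Via ks x y)
  via? []       x y = R? x y ⊎-dec Finite._≟_ FA x y
  via? (k ∷ ks) x y = via? ks x y ⊎-dec (via? ks x k ×-dec via? ks k y)

  via⇒star : ∀ ks {x y} → Via ks x y → Star R x y
  via⇒star []       (inj₁ r)       = r ◅ ε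
  via⇒star []       (inj₂ refl)    = ε
  via⇒star (k ∷ ks) (inj₁ v)       = via⇒star ks v
  via⇒star (k ∷ ks) (inj₂ (v , w)) = via⇒star ks v ◅◅ via⇒star ks w

  via-one : ∀ ks {x y} → R x y ⊎ x ≡ y → Via ks x y
  via-one []       r = r
  via-one (k ∷ ks) r = inj₁ (via-one ks r)

  via-trans : ∀ {ks k x y} → k ∈ ks → Via ks x k → Via ks k y → Via ks x y
  via-trans {k ∷ ks} (here refl) v w =
    inj₂ ([ id , proj₁ ]′ v , [ id , proj₂ ]′ w)
  via-trans {_ ∷ ks} (there k∈) (inj₁ v)        (inj₁ w)        = inj₁ (via-trans k∈ v w)
  via-trans {_ ∷ ks} (there k∈) (inj₁ v)        (inj₂ (w , w′)) = inj₂ (via-trans k∈ v w , w′)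
  via-trans {_ ∷ ks} (there k∈) (inj₂ (v , v′)) (inj₁ w)        = inj₂ (v , via-trans k∈ v′ w)
  via-trans {_ ∷ ks} (there k∈) (inj₂ (v , _))  (inj₂ (_ , w′)) = inj₂ (v , w′)

  everything : List A
  everything = List.map (Finite.from FA) (allFin (Finite.size FA))

  ∈-everything : ∀ x → x ∈ everything
  ∈-everything x = subst (_∈ everything) (Finite.from-to FA x) (∈-map⁺ (Finite.from FA) (∈-allFin (Finite.to FA x)))

  star⇒via : ∀ {x y} → Star R x y → Via everything x y
  star⇒via ε        = via-one everything (inj₂ refl)
  star⇒via (r ◅ rs) = via-trans (∈-everything _) (via-one everything (inj₁ r)) (star⇒via rs)

  star? : ∀ x y → Dec (Star R x y)
  star? x y = map′ (via⇒star everything) star⇒via (via? everything x y)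

first : ∀ {n} → (Fin n → Bool) → Maybe (Fin n)
first {zero}  p = nothing
first {suc n} p = if p zero then just zero else Maybe.map suc (first (p ∘ suc))

first-cong : ∀ {n} {p q : Fin n → Bool} → (∀ i → p i ≡ q i) → first p ≡ first q
first-cong {zero}  h = refl
first-cong {suc n} h = cong₂ (λ b m → if b then just zero else Maybe.map suc m) (h zero) (first-cong (h ∘ suc))

first-sound : ∀ {n} (p : Fin n → Bool) {i} → first p ≡ just i → p i ≡ true
first-sound {suc n} p eq with p zero in p0
first-sound {suc n} p refl | true = p0
first-sound {suc n} p eq   | false with first (p ∘ suc) in eq′
first-sound {suc n} p refl | false | just i = first-sound (p ∘ suc) eq′

first-complete : ∀ {n} (p : Fin n → Bool) {i} → p i ≡ true → ∃ λ j → first p ≡ just j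
first-complete {suc n} p {i} pi with p zero in p0
... | true = zero , refl
first-complete {suc n} p {zero}  pi | false with () ← trans (sym p0) pi
first-complete {suc n} p {suc i} pi | false with first-complete (p ∘ suc) pi
... | j , eq rewrite eq = suc j , refl

module Canonical {A : Set} (FA : Finite A) (_≈_ : A → A → Set) (_≈?_ : ∀ x y → Dec (x ≈ y))
                 (≈-refl : ∀ {x} → x ≈ x) (≈-sym : ∀ {x y} → x ≈ y → y ≈ x) (≈-trans : ∀ {x y z} → x ≈ y → y ≈ z → x ≈ z) where

  open Finite FA

  test : A → Fin size → Bool
  test x k = does (x ≈? from k)

  test-cong : ∀ {x y} → x ≈ y → ∀ k → test x k ≡ test y k
  test-cong {x} {y} x≈y k with x ≈? from k | y ≈? from k
  ... | yes _ | yes _ = refl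
  ... | no _  | no _  = refl
  ... | yes p | no ¬q = contradiction (≈-trans (≈-sym x≈y) p) ¬q
  ... | no ¬p | yes q = contradiction (≈-trans x≈y q) ¬p

  -- The default `x` is never returned, since `x` passes its own test.
  canon : A → A
  canon x = Maybe.maybe from x (first (test x))

  private
    found : ∀ x → ∃ λ j → first (test x) ≡ just j
    found x = first-complete (test x) {to x} (dec-true (x ≈? from (to x)) (subst (x ≈_) (sym (from-to x)) ≈-refl))

  canon-cong : ∀ {x y} → x ≈ y → canon x ≡ canon y
  canon-cong {x} {y} x≈y with found x | found y
  ... | j , eq | j′ , eq′ rewrite eq | eq′ = cong from (just-injective (trans (sym eq) (trans (first-cong (test-cong x≈y)) eq′)))

  canon-≈ : ∀ x → x ≈ canon x
  canon-≈ x with found x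
  ... | j , eq = subst (x ≈_) (sym (cong (Maybe.maybe from x) eq)) (sound (x ≈? from j) (first-sound (test x) eq))
    where
    sound : ∀ {P : Set} (d : Dec P) → does d ≡ true → P
    sound (yes p) _ = p

  canon-canon : ∀ x → canon (canon x) ≡ canon x
  canon-canon x = sym (canon-cong (canon-≈ x))

module Letters (ℓ : ℕ) where

  x : ℕ
  x = ℓ * ℓ

  abstract

    -- Sorting the two labels makes `e` symmetric. Numbers that code a pair in decreasing order
    -- remain as letters touching no label.
    pairing : (i j : Fin ℓ) → Dec (toℕ i ≤ toℕ j) → Fin x
    pairing i j (yes _) = Fin.combine i j
    pairing i j (no _)  = Fin.combine {ℓ} {ℓ} j i

    e : Fin ℓ → Fin ℓ → Fin x
    e i j = pairing i j (toℕ i ℕ.≤? toℕ j)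

    code-pair : ∀ {i j k l : Fin ℓ} d d′ → pairing i j d ≡ pairing k l d′ → (i ≡ k × j ≡ l) ⊎ (i ≡ l × j ≡ k)
    code-pair {i} {j} {k} {l} (yes _) (yes _) eq = inj₁ (Finₚ.combine-injective i j k l eq)
    code-pair {i} {j} {k} {l} (no _)  (no _)  eq = inj₁ (swap (Finₚ.combine-injective j i l k eq))
    code-pair {i} {j} {k} {l} (yes _) (no _)  eq = inj₂ (Finₚ.combine-injective i j l k eq)
    code-pair {i} {j} {k} {l} (no _)  (yes _) eq = inj₂ (swap (Finₚ.combine-injective j i k l eq))

    e-pair : ∀ {i j k l} → e i j ≡ e k l → (i ≡ k × j ≡ l) ⊎ (i ≡ l × j ≡ k)
    e-pair {i} {j} {k} {l} = code-pair {i} {j} {k} {l} (toℕ i ℕ.≤? toℕ j) (toℕ k ℕ.≤? toℕ l)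

    code-sym : ∀ i j d d′ → pairing i j d ≡ pairing j i d′
    code-sym i j (yes p) (yes q) with refl ← Finₚ.toℕ-injective (ℕₚ.≤-antisym p q) = refl
    code-sym i j (yes _) (no _)  = refl
    code-sym i j (no _)  (yes _) = refl
    code-sym i j (no ¬p) (no ¬q) = contradiction (ℕₚ.≰⇒≥ ¬p) ¬q

    e-sym : ∀ i j → e i j ≡ e j i
    e-sym i j = code-sym i j (toℕ i ℕ.≤? toℕ j) (toℕ j ℕ.≤? toℕ i)

  e-injective : ∀ {i j k} → e i j ≡ e i k → j ≡ k
  e-injective {i} {j} {k} eq with e-pair {i} {j} {i} {k} eq
  ... | inj₁ (_ , q)    = q
  ... | inj₂ (refl , q) = q

  Touches : Fin x → Fin ℓ → Set
  Touches a i = ∃ λ j → a ≡ e i j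

  touches? : ∀ a i → Dec (Touches a i)
  touches? a i = Finₚ.any? (λ j → a Fin.≟ e i j)

  e-unique : ∀ {a i j} → i ≢ j → Touches a i → Touches a j → a ≡ e i j
  e-unique {a} {i} {j} i≢j (k , refl) (l , eq) with e-pair {i} {k} {j} {l} eq
  ... | inj₁ (i≡j , _)  = contradiction i≡j i≢j
  ... | inj₂ (_ , refl) = refl

last : {A : Set} → A → List A → A
last x []       = x
last x (y ∷ ys) = last y ys

-- Incidence between copies and vertices

module Incidence {Copy V : Set} (In : Copy → V → Set) where

  Shares : V → V → Set
  Shares v v′ = ∃ λ κ → In κ v × In κ v′

  data Ear : List V → Set where
    here  : ∀ {k v₁ v₂ v₃ vs} → In k v₁ → In k v₂ → In k v₃ → Ear (v₁ ∷ v₂ ∷ v₃ ∷ vs)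
    there : ∀ {v vs} → Ear vs → Ear (v ∷ vs)

  data Trail : Copy → List V → Copy → Set where
    stop : ∀ {k} → Trail k [] k
    pass : ∀ {k k₁ k′ v vs} → In k v → In k₁ v → Trail k₁ vs k′ → Trail k (v ∷ vs) k′

  trail : ∀ {k₀ k v vs} → In k₀ v → Linked Shares (v ∷ vs) → In k (last v vs) → Trail k₀ (v ∷ vs) k
  trail p [-]                  q = pass p q stop
  trail p ((_ , p′ , q′) ∷ sh) q = pass p p′ (trail q′ sh q)

  -- The ear is not centred at either end of the list, so where a cycle is cut open restricts where
  -- its ear can be.
  Acyclic : ℕ → Set
  Acyclic L = ∀ {k v₁ v₂ v₃ vs} → In k v₁ → Linked Shares (v₁ ∷ v₂ ∷ v₃ ∷ vs) → In k (last v₃ vs) →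
              Linked _≢_ (v₁ ∷ v₂ ∷ v₃ ∷ vs) → length vs + 2 ≤ L → Ear (v₁ ∷ v₂ ∷ v₃ ∷ vs)

  -- Three copies around `s`: besides `s`, the copies `k` and `k*` share `s′`, `k*` and `κ` share
  -- `y`, `κ` and `k` share `y₁`. Here `y` and `y₁` may coincide, but `s′` differs from both.
  Fans : Set
  Fans = ∀ {k k* κ s s′ y y₁} → s ≢ s′ → s ≢ y → s ≢ y₁ → s′ ≢ y → s′ ≢ y₁ →
         In k s → In k s′ → In k* s → In k* s′ → In k* y → In κ s → In κ y → In κ y₁ → In k y₁ → k ≡ k*

-- Copies and their common vertices

module Copies (ℓ t′ : ℕ) (Edge : Fin (suc t′) → Fin ℓ → Fin ℓ → Set) (edge? : ∀ s i j → Dec (Edge s i j))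
              (edge-sym : ∀ {s i j} → Edge s i j → Edge s j i) (L : ℕ) where

  open Letters ℓ public

  private
    -- The first summand is for the orbits in chains of up to `suc L` pieces, the second for the
    -- actions on `Flags`, which has `t * 2` elements.
    M′ : ℕ
    M′ = Modular.bound t′ L + suc t′ * 2

  abstract
    S : Pieces x t′ (suc M′)
    S = pieces x t′ M′

  open Groups ℓ x t′ (suc M′) S Touches touches? e (λ i j → j , refl) (λ i j → i , e-sym i j) e-unique public
  open Group L (ℕₚ.≤-trans (ℕₚ.m≤m+n (bound L) (t * 2)) (ℕₚ.n≤1+n M′)) public

  -- A copy of the type graph s, placed at an element of K.
  Copy : Set
  Copy = K × Fin t

  elt : Copy → K
  elt = proj₁

  type : Copy → Fin t
  type = proj₂

  copy-finite : Finite Copy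
  copy-finite = K-finite ×-finite fin-finite t

  _≟ᶜ_ : DecidableEquality Copy
  _≟ᶜ_ = Finite._≟_ copy-finite

  -- The difference `s′ - s` modulo `t`, with `t` added to stay among the natural numbers.
  diff : Fin t → Fin t → ℕ
  diff s s′ = toℕ s′ + (t ∸ toℕ s)

  next-diff : ∀ s s′ → iter next (diff s s′) s ≡ s′
  next-diff s s′ = toℕ-≡ₜ (toℕ-iter-next (diff s s′) s
    ⟫ ≡ₜ-reflexive (trans (ℕₚ.+-comm (toℕ s) (diff s s′)) (trans (ℕₚ.+-assoc (toℕ s′) (t ∸ toℕ s) (toℕ s))
        (cong (toℕ s′ +_) (ℕₚ.m∸n+n≡m (ℕₚ.<⇒≤ (Finₚ.toℕ<n s))))))
    ⟫ +t (toℕ s′))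

  diff-unique : ∀ {s s′} r → iter next r s ≡ s′ → r ≡ₜ diff s s′
  diff-unique {s} {s′} r eq = next-faithful r (diff s s′) s (trans eq (sym (next-diff s s′)))

  -- Types advance in step with the exponent, so the types of two linked copies determine the
  -- exponent modulo `t`.
  shift : Fin ℓ → Fin ℓ → ℕ → Copy → Copy
  shift i j r (g , s) = iter (stepK (e i j)) r g , iter next r s

  shift-cong : ∀ {i j r q} → r ≡ₜ q → ∀ k → shift i j r k ≡ shift i j q k
  shift-cong {i} {j} eq (g , s) = cong₂ _,_ (iter-≡ₜ (stepK-periodic (e i j)) eq g) (iter-≡ₜ next-periodic eq s)

  shift-+ : ∀ i j r q k → shift i j (r + q) k ≡ shift i j q (shift i j r k)
  shift-+ i j r q (g , s) = cong₂ _,_ (iter-+ (stepK (e i j)) r q g) (iter-+ next r q s)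

  -- The two copies share exactly the edge with labels i and j.
  record Link (i j : Fin ℓ) (k k′ : Copy) : Set where
    constructor link
    field
      edgeˡ : Edge (type k) i j
      edgeʳ : Edge (type k′) i j
      moved : k′ ≡ shift i j (diff (type k) (type k′)) k

  link? : ∀ i j k k′ → Dec (Link i j k k′)
  link? i j k k′ = map′ (λ (p , q , eq) → link p q eq) (λ (link p q eq) → p , q , eq)
    (edge? (type k) i j ×-dec edge? (type k′) i j ×-dec (k′ ≟ᶜ shift i j (diff (type k) (type k′)) k))

  link-shift : ∀ {i j k} r → Edge (type k) i j → Edge (type (shift i j r k)) i j → Link i j k (shift i j r k)
  link-shift {i} {j} {k} r p q = link p q (shift-cong (diff-unique r refl) k)

  link-sym : ∀ {i j k k′} → Link i j k k′ → Link i j k′ k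
  link-sym {i} {j} {g , s} {k′} (link p q eq) = link q p (sym (begin
    shift i j (diff s′ s) k′                      ≡⟨ cong (shift i j (diff s′ s)) eq ⟩
    shift i j (diff s′ s) (shift i j (diff s s′) (g , s)) ≡⟨ sym (shift-+ i j (diff s s′) (diff s′ s) (g , s)) ⟩
    shift i j (diff s s′ + diff s′ s) (g , s)     ≡⟨ shift-cong back (g , s) ⟩
    (g , s)                                       ∎))
    where
    open ≡-Reasoning
    s′ = type k′
    back : diff s s′ + diff s′ s ≡ₜ 0
    back = next-faithful (diff s s′ + diff s′ s) 0 s (trans (iter-+ next (diff s s′) (diff s′ s) s)
             (trans (cong (iter next (diff s′ s)) (next-diff s s′)) (next-diff s′ s)))

  link-swap : ∀ {i j k k′} → Link i j k k′ → Link j i k k′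
  link-swap {i} {j} {k} {k′} (link p q eq) = link (edge-sym p) (edge-sym q)
    (trans eq (cong (λ a → iter (stepK a) (diff (type k) (type k′)) (elt k) , iter next (diff (type k) (type k′)) (type k)) (e-sym i j)))

  Meet : Fin ℓ → Copy → Copy → Set
  Meet i = Star (λ k k′ → ∃ λ j → Link i j k k′)

  abstract
    meet? : ∀ i k k′ → Dec (Meet i k k′)
    meet? i = Reachability.star? copy-finite _ (λ k k′ → Finₚ.any? (λ j → link? i j k k′))

  meet-sym : ∀ {i k k′} → Meet i k k′ → Meet i k′ k
  meet-sym = Star.reverse (λ (j , l) → j , link-sym l)

  valid-iter : ∀ a r {g} → Valid g → Valid (iter (stepK a) r g)
  valid-iter a r = iter-preserves Valid (stepK a) valid-step r

  link-valid : ∀ {i j k k′} → Link i j k k′ → Valid (elt k) → Valid (elt k′)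
  link-valid {i} {j} {k} {k′} (link _ _ eq) v =
    subst (Valid ∘ elt) (sym eq) (valid-iter (e i j) (diff (type k) (type k′)) v)

  meet-valid : ∀ {i k k′} → Meet i k k′ → Valid (elt k) → Valid (elt k′)
  meet-valid ε            v = v
  meet-valid ((_ , l) ◅ m) v = meet-valid m (link-valid l v)

  trace : ∀ {i k k′} → Meet i k k′ → List (Fin x)
  trace ε = []
  trace {i} {k} (_◅_ {j = k₁} (j , _) m) = replicate (diff (type k) (type k₁)) (e i j) ++ trace m

  replicate-word : ∀ {i j} r → Word i (replicate r (e i j))
  replicate-word r = Allₚ.replicate⁺ r (_ , refl)

  trace-word : ∀ {i k k′} (m : Meet i k k′) → Word i (trace m)
  trace-word ε = []
  trace-word {i} {k} (_◅_ {j = k₁} _ m) = Allₚ.++⁺ (replicate-word (diff (type k) (type k₁))) (trace-word m)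

  trace-elt : ∀ {i k k′} (m : Meet i k k′) → act stepK (elt k) (trace m) ≡ elt k′
  trace-elt ε = refl
  trace-elt {i} {k} (_◅_ {j = k₁} (j , link _ _ eq) m) = trans (act-++ stepK (elt k) (replicate r (e i j)) (trace m))
    (trans (cong (λ g → act stepK g (trace m)) (trans (act-replicate stepK r (e i j) (elt k)) (sym (cong elt eq)))) (trace-elt m))
    where r = diff (type k) (type k₁)

  Flags : Set
  Flags = Fin t × Bool

  module _ {f : Fin x → Flags → Flags} (per : ∀ a → Periodic (f a)) where

    flags-agree : ∀ {i w w′} → Word i w → Word i w′ → act stepP one w ≡ act stepP one w′ → ∀ y → act f y w ≡ act f y w′
    flags-agree {i} js js′ eq y = small-action (≡-dec Fin._≟_ Bool._≟_) f per (λ a → touches? a i)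
      everything short (λ {a} {y} _ _ → ∈-everything (f a y)) js js′ eq (∈-everything y)
      where
      everything : List Flags
      everything = cartesianProduct (allFin t) (true ∷ false ∷ [])
      ∈-everything : ∀ y → y ∈ everything
      ∈-everything (s , true)  = ∈-cartesianProduct⁺ (∈-allFin s) (here refl)
      ∈-everything (s , false) = ∈-cartesianProduct⁺ (∈-allFin s) (there (here refl))
      short : length everything ≤ suc M′
      short = ℕₚ.≤-trans (ℕₚ.≤-reflexive (trans (length-cartesianProductWith _,_ (allFin t) (true ∷ false ∷ []))
                (cong (_* 2) (Listₚ.length-tabulate {n = t} id)))) (ℕₚ.≤-trans (ℕₚ.m≤n+m (t * 2) (bound L)) (ℕₚ.n≤1+n M′))

  -- The action under which a walk of copies changes its flag when a letter a leads into or out of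
  -- the type s*; links never do so if a is not an edge of s*.
  flip : Fin t → Flags → Flags
  flip s* (s , c) = s , (if does (s Fin.≟ s*) then not c else c)

  advance : Flags → Flags
  advance (s , c) = next s , c

  flagged : Fin x → Fin t → Fin x → Flags → Flags
  flagged a s* b y = if does (b Fin.≟ a) then flip s* (advance (flip s* y)) else advance y

  flip-flip : ∀ s* y → flip s* (flip s* y) ≡ y
  flip-flip s* (s , c) with does (s Fin.≟ s*)
  ... | true  = cong (s ,_) (Boolₚ.not-involutive c)
  ... | false = refl

  iter-advance : ∀ r s c → iter advance r (s , c) ≡ (iter next r s , c)
  iter-advance zero    s c = refl
  iter-advance (suc r) s c = iter-advance r (next s) c

  iter-conjugate : ∀ s* r y → iter (λ y → flip s* (advance (flip s* y))) r y ≡ flip s* (iter advance r (flip s* y))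
  iter-conjugate s* zero    y = sym (flip-flip s* y)
  iter-conjugate s* (suc r) y = trans (iter-conjugate s* r _)
    (cong (flip s* ∘ iter advance r) (flip-flip s* (advance (flip s* y))))

  flagged-same : ∀ a s* r s c → iter (flagged a s* a) r (s , c) ≡ flip s* (iter next r s , proj₂ (flip s* (s , c)))
  flagged-same a s* r s c rewrite dec-true (a Fin.≟ a) refl =
    trans (iter-conjugate s* r (s , c)) (cong (flip s*) (iter-advance r s _))

  flagged-other : ∀ {a b} → b ≢ a → ∀ s* r s c → iter (flagged a s* b) r (s , c) ≡ (iter next r s , c)
  flagged-other {a} {b} b≢a s* r s c rewrite dec-false (b Fin.≟ a) b≢a = iter-advance r s c

  flagged-periodic : ∀ a s* b → Periodic (flagged a s* b)
  flagged-periodic a s* b (s , c) with b Fin.≟ a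
  ... | no _  = trans (iter-advance t s c) (cong (_, c) (next-periodic s))
  ... | yes _ = trans (iter-conjugate s* t (s , c)) (trans (cong (flip s*)
                  (trans (iter-advance t s c′) (cong (_, c′) (next-periodic s)))) (flip-flip s* (s , c)))
    where c′ = proj₂ (flip s* (s , c))

  flip-other : ∀ {s s*} → s ≢ s* → ∀ c → flip s* (s , c) ≡ (s , c)
  flip-other {s} {s*} s≢ c rewrite dec-false (s Fin.≟ s*) s≢ = refl

  flip-self : ∀ s c → flip s (s , c) ≡ (s , not c)
  flip-self s c rewrite dec-true (s Fin.≟ s) refl = refl

  -- A link along the pair `i j` neither starts nor ends in type `s*`, where this pair is no edge;
  -- merely passing through `s*` leaves no mark, and links along other pairs leave the flag alone.
  trace-flags : ∀ {i j s*} → ¬ Edge s* i j → ∀ {k k′} (m : Meet i k k′) →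
                act (flagged (e i j) s*) (type k , false) (trace m) ≡ (type k′ , false)
  trace-flags ¬edge ε = refl
  trace-flags {i} {j} {s*} ¬edge {k} (_◅_ {j = k₁} (j′ , link p q _) m) =
    trans (act-++ f (type k , false) (replicate r (e i j′)) (trace m))
      (trans (cong (λ y → act f y (trace m)) (trans (act-replicate f r (e i j′) (type k , false)) (jump (e i j′ Fin.≟ e i j))))
        (trace-flags ¬edge m))
    where
    f = flagged (e i j) s*
    r = diff (type k) (type k₁)
    jump : Dec (e i j′ ≡ e i j) → iter (f (e i j′)) r (type k , false) ≡ (type k₁ , false)
    jump (no a≢) = trans (flagged-other a≢ s* r (type k) false) (cong (_, false) (next-diff (type k) (type k₁)))
    jump (yes eq) with refl ← e-injective {i} {j′} {j} eq = trans (flagged-same (e i j) s* r (type k) false) (trans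
      (cong₂ (λ s y → flip s* (s , proj₂ y)) (next-diff (type k) (type k₁)) (flip-other {type k} {s*} (λ { refl → ¬edge p }) false))
      (flip-other {type k₁} {s*} (λ { refl → ¬edge q }) false))

  data Near (i j : Fin ℓ) (k : Copy) : Copy → Set where
    same   : Near i j k k
    linked : ∀ {k′} → Link i j k k′ → Near i j k k′

  near-swap : ∀ {i j k k′} → Near i j k k′ → Near j i k k′
  near-swap same       = same
  near-swap (linked l) = linked (link-swap l)

  near-sym : ∀ {i j k k′} → Near i j k k′ → Near i j k′ k
  near-sym same       = same
  near-sym (linked l) = linked (link-sym l)

  near-meet : ∀ {i j k k′} → Near i j k k′ → Meet i k k′
  near-meet same       = ε
  near-meet (linked l) = (_ , l) ◅ ε

  near-edge : ∀ {i j k k′} → Near i j k k′ → Edge (type k) i j → Edge (type k′) i j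
  near-edge same                  a = a
  near-edge (linked (link _ b _)) a = b

  near-distinct : ∀ {i j k k′} → Near i j k k′ → k ≢ k′ → Edge (type k) i j
  near-distinct same                  k≢k = contradiction refl k≢k
  near-distinct (linked (link a _ _)) _   = a

  -- Let `s*` be the type at one end of the shift. If the type changes and the pair is no edge of
  -- `s*`, exactly one of the two flips takes effect and the flag is raised.
  near-shift : ∀ {i j} r k → (∀ s* → ¬ Edge s* i j →
                 proj₂ (flip s* (iter next r (type k) , proj₂ (flip s* (type k , false)))) ≡ false) →
               Near i j k (shift i j r k)
  near-shift {i} {j} r k unflagged with iter next r (type k) Fin.≟ type k
  ... | yes eq = subst (Near i j k) (shift-cong {i} {j} {0} {r} (≡ₜ-sym (next-faithful r 0 (type k) eq)) k) same
  ... | no ne  = linked (link-shift r (holds (type k) (edge? _ _ _) left) (holds _ (edge? _ _ _) right))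
    where
    s = type k
    s′ = iter next r s
    holds : ∀ s → Dec (Edge s i j) → (¬ Edge s i j → ⊥) → Edge s i j
    holds s (yes p) _ = p
    holds s (no ¬p) h = ⊥-elim (h ¬p)
    left : ¬ Edge s i j → ⊥
    left ¬p = contradiction (trans (sym (cong proj₂ (trans (cong (λ y → flip s (s′ , proj₂ y)) (flip-self s false))
                (flip-other ne true)))) (unflagged s ¬p)) λ ()
    right : ¬ Edge s′ i j → ⊥
    right ¬p = contradiction (trans (sym (cong proj₂ (trans (cong (λ y → flip s′ (s′ , proj₂ y)) (flip-other (ne ∘ sym) false))
                 (flip-self s′ false)))) (unflagged s′ ¬p)) λ ()

  pair-word : ∀ {i h l} r q → Word i (replicate r (e i h) ++ replicate q (e i l))
  pair-word r q = Allₚ.++⁺ (replicate-word r) (replicate-word q)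

  act-pair : ∀ {Y : Set} (f : Fin x → Y → Y) y r a q b →
             act f y (replicate r a ++ replicate q b) ≡ iter (f b) q (iter (f a) r y)
  act-pair f y r a q b = trans (act-++ f y (replicate r a) (replicate q b))
    (trans (cong (λ y → act f y (replicate q b)) (act-replicate f r a y)) (act-replicate f q b _))

  module _ {i k k′} (m : Meet i k k′) {h l r q}
           (eq : act stepP one (trace m) ≡ act stepP one (replicate r (e i h) ++ replicate q (e i l))) where

    private
      middle-elt : iter (stepK (e i l)) q (iter (stepK (e i h)) r (elt k)) ≡ elt k′
      middle-elt = trans (sym (act-pair stepK (elt k) r (e i h) q (e i l)))
        (trans (sym (same-in-K (trace-word m) (pair-word r q) eq (elt k))) (trace-elt m))

      flags : ∀ j s* → ¬ Edge s* i j →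
              iter (flagged (e i j) s* (e i l)) q (iter (flagged (e i j) s* (e i h)) r (type k , false)) ≡ (type k′ , false)
      flags j s* ¬edge = trans (sym (act-pair f (type k , false) r (e i h) q (e i l)))
        (trans (sym (flags-agree (flagged-periodic (e i j) s*) (trace-word m) (pair-word r q) eq (type k , false)))
               (trace-flags ¬edge m))
        where f = flagged (e i j) s*

      plain-periodic : ∀ (a : Fin x) → Periodic {Flags} advance
      plain-periodic a (s , c) = trans (iter-advance t s c) (cong (_, c) (next-periodic s))

      trace-plain : ∀ {k k′} (m : Meet i k k′) → act (λ _ → advance) (type k , false) (trace m) ≡ (type k′ , false)
      trace-plain ε = refl
      trace-plain {k} (_◅_ {j = k₁} (j , _) m) = trans (act-++ (λ _ → advance) (type k , false) (replicate d (e i j)) (trace m))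
        (trans (cong (λ y → act (λ _ → advance) y (trace m)) (trans (act-replicate (λ _ → advance) d (e i j) (type k , false))
          (trans (iter-advance d (type k) false) (cong (_, false) (next-diff (type k) (type k₁)))))) (trace-plain m))
        where d = diff (type k) (type k₁)

      middle-type : iter next q (iter next r (type k)) ≡ type k′
      middle-type = cong proj₁ (trans (sym (trans (act-pair (λ _ → advance) (type k , false) r (e i h) q (e i l))
          (trans (cong (iter advance q) (iter-advance r (type k) false)) (iter-advance q _ false))))
        (trans (sym (flags-agree plain-periodic (trace-word m) (pair-word r q) eq (type k , false))) (trace-plain m)))

      arrives : shift i l q (shift i h r k) ≡ k′
      arrives = cong₂ _,_ middle-elt middle-type

    near-same : h ≡ l → Near i h k k′
    near-same refl = subst (Near i h k) (trans (shift-+ i h r q k) arrives) (near-shift (r + q) k (λ s* ¬edge →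
      trans (sym (cong proj₂ (trans (sym (iter-+ (f s*) r q (type k , false))) (flagged-same (e i h) s* (r + q) (type k) false))))
            (cong proj₂ (flags h s* ¬edge))))
      where
      f : Fin t → Flags → Flags
      f s* = flagged (e i h) s* (e i h)

    -- The copy `k″` is reached after the first power. If the two letters differ, each power can be
    -- tested by flags for its own letter, on which the other has no effect; hence each is a link or
    -- trivial. Equal letters combine to one power.
    between : ∃ λ k″ → Near i h k k″ × Near i l k″ k′
    between with h Fin.≟ l
    ... | yes h≡l = k′ , near-same h≡l , same
    ... | no h≢l  = shift i h r k
        , near-shift r k (λ s* ¬edge → trans (sym (cong proj₂ (trans (cong (iter (flagged (e i h) s* (e i l)) q) (flagged-same (e i h) s* r (type k) false))
            (flagged-other (λ eq → h≢l (sym (e-injective {i} {l} {h} eq))) s* q _ _)))) (cong proj₂ (flags h s* ¬edge)))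
        , subst (Near i l (shift i h r k)) arrives (near-shift q (shift i h r k) (λ s* ¬edge →
            trans (sym (cong proj₂ (trans (cong (iter (flagged (e i l) s* (e i l)) q) (flagged-other (λ eq → h≢l (e-injective {i} {h} {l} eq)) s* r (type k) false))
              (flagged-same (e i l) s* q (iter next r (type k)) false)))) (cong proj₂ (flags l s* ¬edge))))

  V : Set
  V = Copy × Fin ℓ

  lab : V → Fin ℓ
  lab = proj₂

  V-finite : Finite V
  V-finite = copy-finite ×-finite fin-finite ℓ

  _≈_ : V → V → Set
  (k , i) ≈ (k′ , i′) = i ≡ i′ × Meet i k k′

  abstract

    _≈?_ : ∀ v v′ → Dec (v ≈ v′)
    (k , i) ≈? (k′ , i′) = (i Fin.≟ i′) ×-dec meet? i k k′

    ≈-refl : ∀ {v} → v ≈ v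
    ≈-refl = refl , ε

    ≈-sym : ∀ {v v′} → v ≈ v′ → v′ ≈ v
    ≈-sym (refl , m) = refl , meet-sym m

    ≈-trans : ∀ {v v′ v″} → v ≈ v′ → v′ ≈ v″ → v ≈ v″
    ≈-trans (refl , m) (refl , m′) = refl , m ◅◅ m′

  module Canon = Canonical V-finite _≈_ _≈?_ ≈-refl ≈-sym ≈-trans

  abstract

    canon : V → V
    canon = Canon.canon

    canon-cong : ∀ {v v′} → v ≈ v′ → canon v ≡ canon v′
    canon-cong = Canon.canon-cong

    canon-≈ : ∀ v → v ≈ canon v
    canon-≈ = Canon.canon-≈

    canon-canon : ∀ v → canon (canon v) ≡ canon v
    canon-canon = Canon.canon-canon

  -- Only the canonical representatives of the classes of ≈ serve as vertices; the other elements
  -- of V lie in no copy and will be isolated.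
  record In (k : Copy) (v : V) : Set where
    constructor incident
    field
      canonical : canon v ≡ v
      valid     : Valid (elt k)
      meeting   : Meet (lab v) (proj₁ v) k

  in? : ∀ k v → Dec (In k v)
  in? k v = map′ (λ (c , p , m) → incident c p m) (λ (incident c p m) → c , p , m)
    (Finite._≟_ V-finite (canon v) v ×-dec valid? (elt k) ×-dec meet? (lab v) (proj₁ v) k)

  vertex : Copy → Fin ℓ → V
  vertex k i = canon (k , i)

  lab-vertex : ∀ k i → lab (vertex k i) ≡ i
  lab-vertex k i = sym (proj₁ (canon-≈ (k , i)))

  in-vertex : ∀ {k} i → Valid (elt k) → In k (vertex k i)
  in-vertex {k} i v = incident (canon-canon (k , i)) v (proj₂ (≈-sym (canon-≈ (k , i))))

  in-unique : ∀ {k v} → In k v → v ≡ vertex k (lab v)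
  in-unique {k} {v} (incident c _ m) = trans (sym c) (canon-cong (refl , m))

  in-lab : ∀ {k v v′} → In k v → In k v′ → lab v ≡ lab v′ → v ≡ v′
  in-lab {k} p q eq = trans (in-unique p) (trans (cong (vertex k) eq) (sym (in-unique q)))

  in-meet : ∀ {k k′ v} → In k v → Meet (lab v) k k′ → In k′ v
  in-meet (incident c v m) m′ = incident c (meet-valid m′ v) (m ◅◅ m′)

  meets : ∀ {k k′ v} → In k v → In k′ v → Meet (lab v) k k′
  meets (incident _ _ m) (incident _ _ m′) = meet-sym m ◅◅ m′

  near-in : ∀ {i j k k′ v} → Near i j k k′ → lab v ≡ i → In k v → In k′ v
  near-in n refl p = in-meet p (near-meet n)

  open Incidence In public

  segs : ∀ {k vs k′} → Trail k vs k′ → List Seg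
  segs stop                    = []
  segs (pass {v = v} p q τ) = (lab v , trace (meets p q) , trace-word (meets p q)) ∷ segs τ

  segs-elt : ∀ {k vs k′} (τ : Trail k vs k′) → act stepK (elt k) (words (segs τ)) ≡ elt k′
  segs-elt stop         = refl
  segs-elt {k} (pass p q τ) = trans (act-++ stepK (elt k) (trace (meets p q)) (words (segs τ)))
    (trans (cong (λ g → act stepK g (words (segs τ))) (trace-elt (meets p q))) (segs-elt τ))

  length-segs : ∀ {k vs k′} (τ : Trail k vs k′) → length (segs τ) ≡ length vs
  length-segs stop         = refl
  length-segs (pass p q τ) = cong suc (length-segs τ)

  segs-reduced : ∀ {k vs k′} (τ : Trail k vs k′) → Linked _≢_ vs → Reduced (segs τ)
  segs-reduced stop                              _          = []
  segs-reduced (pass p q stop)                   _          = [-]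
  segs-reduced (pass p q τ@(pass p′ q′ _)) (ne ∷ nes) = (λ eq → ne (in-lab q p′ eq)) ∷ segs-reduced τ nes

  pair-eq : ∀ {h i l r q} {m : P} → m ≡ act stepP one (replicate r (e h i) ++ replicate q (e i l)) →
            m ≡ act stepP one (replicate r (e i h) ++ replicate q (e i l))
  pair-eq {h} {i} {l} {r} {q} {m} = subst (λ a → m ≡ act stepP one (replicate r a ++ replicate q (e i l))) (e-sym h i)

  -- The passage at `v₂` factors through the copy `k″` given by `between`. Its link on one side runs
  -- along the labels of `v₁` and `v₂`, on the other along those of `v₂` and `v₃`, so `k″` contains
  -- all three.
  ear-of : ∀ {k vs k′} (τ : Trail k vs k′) → Degenerate (segs τ) → Ear vs
  ear-of (pass p₁ q₁ (pass p₂ q₂ (pass p₃ q₃ τ))) (here (r , q , eq))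
    with between (meets p₂ q₂) {r = r} {q} (pair-eq {r = r} {q} eq)
  ... | k″ , n₁ , n₂ = here {k = k″} (near-in (near-swap n₁) refl q₁) (near-in n₁ refl p₂)
                         (near-in (near-swap (near-sym n₂)) refl p₃)
  ear-of (pass p q τ) (there deg) = there (ear-of τ deg)

  closed-ear : ∀ {k v₁ v₂ v₃ vs} → Trail k (v₁ ∷ v₂ ∷ v₃ ∷ vs) k → length vs + 2 ≤ L →
               Linked _≢_ (v₁ ∷ v₂ ∷ v₃ ∷ vs) → Ear (v₁ ∷ v₂ ∷ v₃ ∷ vs)
  closed-ear τ@(pass p₁ q₁ (pass p₂ q₂ (pass p₃ q₃ τ′))) len nes = ear-of τ
    (degenerate-K _ _ _ (segs τ′) (subst (λ m → m + 2 ≤ L) (sym (length-segs τ′)) len) (In.valid p₁) (segs-reduced τ nes) (segs-elt τ))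

  -- The closed trail `v`, `v′`, `v` must be degenerate in its middle word. Both outer labels agree,
  -- so this word amounts to a power of a single letter; the last passage is trivial and only
  -- supplies a third word.
  two-common : 2 ≤ L → ∀ {k k′ v v′} → v ≢ v′ → In k v → In k v′ → In k′ v → In k′ v′ → Near (lab v) (lab v′) k k′
  two-common 2≤L {k} {k′} {v} {v′} ne p p′ q q′ =
    near-swap (near-sym (from (degenerate-K _ _ _ [] 2≤L (In.valid p) (segs-reduced τ (ne ∷ (ne ∘ sym) ∷ [-])) (segs-elt τ))))
    where
    τ : Trail k (v ∷ v′ ∷ v ∷ []) k
    τ = pass p q (pass q′ p′ (pass p p stop))
    from : Degenerate (segs τ) → Near (lab v′) (lab v) k′ k
    from (here (r , s , eq)) = near-same (meets q′ p′) {r = r} {s} (pair-eq {r = r} {s} eq) refl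
    from (there (there (there ())))

  near-exponent : ∀ {i j k k′} → Near i j k k′ → ∃ λ r → k′ ≡ shift i j r k
  near-exponent same = 0 , refl
  near-exponent {k = k} {k′} (linked (link _ _ eq)) = diff (type k) (type k′) , eq

  -- Going once around i through three edges, the exponent of an edge that occurs once must vanish.
  fan : ∀ {i h l m k k* κ} → Valid (elt k) → h ≢ l → h ≢ m → Near i h k k* → Near i l k* κ → Near i m κ k → k ≡ k*
  fan {i} {h} {l} {m} {k} {k*} {κ} valid h≢l h≢m n₁ n₂ n₃ with near-exponent n₁ | near-exponent n₂ | near-exponent n₃
  ... | r , refl | q , refl | p , eq = shift-cong {i} {h} {0} {r} (≡ₜ-sym (next-faithful r 0 (type k) counted)) k
    where
    w : List (Fin x)
    w = replicate r (e i h) ++ (replicate q (e i l) ++ replicate p (e i m))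
    w-word : Word i w
    w-word = Allₚ.++⁺ (replicate-word r) (pair-word q p)
    act-w : ∀ {Y : Set} (f : Fin x → Y → Y) y → act f y w ≡ iter (f (e i m)) p (iter (f (e i l)) q (iter (f (e i h)) r y))
    act-w f y = trans (act-++ f y (replicate r (e i h)) _) (trans (act-pair f _ q (e i l) p (e i m))
      (cong (λ y → iter (f (e i m)) p (iter (f (e i l)) q y)) (act-replicate f r (e i h) y)))
    counter : Fin x → Flags → Flags
    counter b y = if does (b Fin.≟ e i h) then advance y else y
    counter-periodic : ∀ b → Periodic (counter b)
    counter-periodic b (s , c) with b Fin.≟ e i h
    ... | no _  = iter-fixed id t refl
    ... | yes _ = trans (iter-advance t s c) (cong (_, c) (next-periodic s))
    idle : ∀ {j} → h ≢ j → ∀ r y → iter (counter (e i j)) r y ≡ y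
    idle {j} h≢j r y rewrite dec-false (e i j Fin.≟ e i h) (λ eq → h≢j (sym (e-injective {i} {j} {h} eq))) = iter-fixed id r refl
    runs : ∀ r s → iter (counter (e i h)) r (s , false) ≡ (iter next r s , false)
    runs r s rewrite dec-true (e i h Fin.≟ e i h) refl = iter-advance r s false
    counted : iter next r (type k) ≡ type k
    counted = cong proj₁ (trans (sym (trans (act-w counter (type k , false)) (trans (idle h≢m p _) (trans (idle h≢l q _) (runs r (type k))))))
      (flags-agree counter-periodic w-word [] (same-in-P valid w-word [] (trans (act-w stepK (elt k)) (sym (cong elt eq)))) (type k , false)))

  acyclic : Acyclic L
  acyclic p sh q ne len = closed-ear (trail p sh q) len ne

  neq-lab : ∀ {k v v′} → In k v → In k v′ → v ≢ v′ → lab v ≢ lab v′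
  neq-lab p p′ ne eq = ne (in-lab p p′ eq)

  fans : 2 ≤ L → Fans
  fans 2≤L {k} {k*} {κ} {s} {s′} {y} {y₁} s≢s′ s≢y s≢y₁ s′≢y s′≢y₁ ks ks′ k*s k*s′ k*y κs κy κy₁ ky₁ =
    fan {lab s} {lab s′} {lab y} {lab y₁} (In.valid ks) (neq-lab k*s′ k*y s′≢y) (neq-lab ks′ ky₁ s′≢y₁)
      (two-common 2≤L s≢s′ ks ks′ k*s k*s′) (two-common 2≤L s≢y k*s k*y κs κy) (two-common 2≤L s≢y₁ κs κy₁ ks ky₁)

-- Paths through a tree-like system of copies

record SimplePath {A : Set} (R : A → A → Set) (Q : A → Set) (x : A) (xs : List A) : Set where
  constructor simple
  field
    within   : All Q (x ∷ xs)
    linked   : Linked R (x ∷ xs)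
    distinct : Unique (x ∷ xs)

tail-path : ∀ {A : Set} {R : A → A → Set} {Q x y ys} → SimplePath R Q x (y ∷ ys) → SimplePath R (λ z → Q z × x ≢ z) y ys
tail-path (simple (_ ∷ qs) (_ ∷ rs) (ne ∷ u)) = simple (All.zip (qs , ne)) rs u

cons-path : ∀ {A : Set} {R : A → A → Set} {Q : A → Set} {x y ys} → Q x → R x y → SimplePath R (λ z → Q z × x ≢ z) y ys → SimplePath R Q x (y ∷ ys)
cons-path q r (simple qs rs u) = simple (q ∷ All.map proj₁ qs) (r ∷ rs) (All.map proj₂ qs ∷ u)

weaken-path : ∀ {A : Set} {R : A → A → Set} {Q Q′ : A → Set} {x xs} → (∀ {z} → Q z → Q′ z) → SimplePath R Q x xs → SimplePath R Q′ x xs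
weaken-path f (simple qs rs u) = simple (All.map f qs) rs u

-- A walk from x to y is shortened to a simple path by cutting at the last visit to x.
module _ {m : ℕ} {R : Fin m → Fin m → Set} where

  cut-at : ∀ {x y ys} (z : Fin m) → SimplePath R (λ _ → ⊤) x ys → last x ys ≡ y →
           (∃ λ zs → SimplePath R (λ _ → ⊤) z zs × last z zs ≡ y) ⊎ All (z ≢_) (x ∷ ys)
  cut-at {x} {y} {ys} z π l with z Fin.≟ x
  ... | yes refl = inj₁ (ys , π , l)
  cut-at {x} {y} {[]}      z π l | no z≢x = inj₂ (z≢x ∷ [])
  cut-at {x} {y} {x₁ ∷ ys} z π l | no z≢x with cut-at z (weaken-path (λ _ → tt) (tail-path π)) l
  ... | inj₁ r  = inj₁ r
  ... | inj₂ ne = inj₂ (z≢x ∷ ne)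

  simple-path : ∀ {x y} → Star R x y → ∃ λ xs → SimplePath R (λ _ → ⊤) x xs × last x xs ≡ y
  simple-path ε = [] , simple (tt ∷ []) [-] ([] ∷ []) , refl
  simple-path {x} (_◅_ {j = x₁} r rs) with simple-path rs
  ... | xs , π@(simple qs ls u) , l with cut-at x π l
  ...   | inj₁ shorter = shorter
  ...   | inj₂ ne      = x₁ ∷ xs , simple (tt ∷ qs) (r ∷ ls) (ne ∷ u) , l

unique-length : ∀ {m} {xs : List (Fin m)} → Unique xs → length xs ≤ m
unique-length {xs = xs} u = Finₚ.injective⇒≤ {f = List.lookup xs} (λ {i} {j} → lookup-injective u i j)
  where
  lookup-≢ : ∀ {m} {y : Fin m} {ys} → All (y ≢_) ys → ∀ i → y ≢ List.lookup ys i
  lookup-≢ (ne ∷ _)  zero    = ne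
  lookup-≢ (_ ∷ nes) (suc i) = lookup-≢ nes i
  lookup-injective : ∀ {m} {xs : List (Fin m)} → Unique xs → ∀ i j → List.lookup xs i ≡ List.lookup xs j → i ≡ j
  lookup-injective (_ ∷ _)  zero    zero    eq = refl
  lookup-injective (ne ∷ _) zero    (suc j) eq = contradiction eq (lookup-≢ ne j)
  lookup-injective (ne ∷ _) (suc i) zero    eq = contradiction (sym eq) (lookup-≢ ne i)
  lookup-injective (_ ∷ u)  (suc i) (suc j) eq = cong suc (lookup-injective u i j eq)

map-path : ∀ {A B : Set} {R : A → A → Set} {R′ : B → B → Set} {Q : A → Set} {Q′ : B → Set} (f : A → B) →
           (∀ {x y} → f x ≡ f y → x ≡ y) → (∀ {x y} → R x y → R′ (f x) (f y)) → (∀ x → Q′ (f x)) →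
           ∀ {x xs} → SimplePath R Q x xs → SimplePath R′ Q′ (f x) (List.map f xs)
map-path {R = R} {R′ = R′} f inj rel q {x} {xs} (simple _ ls u) = simple (Allₚ.map⁺ {xs = x ∷ xs} (All.universal q _)) (links ls) (uniq u)
  where
  links : ∀ {xs} → Linked R xs → Linked R′ (List.map f xs)
  links []       = []
  links [-]      = [-]
  links (r ∷ rs) = rel r ∷ links rs
  uniq : ∀ {xs} → Unique xs → Unique (List.map f xs)
  uniq []       = []
  uniq (ne ∷ u) = Allₚ.map⁺ (All.map (λ ne eq → ne (inj eq)) ne) ∷ uniq u

last-map : ∀ {A B : Set} (f : A → B) x xs → last (f x) (List.map f xs) ≡ f (last x xs)
last-map f x []       = refl
last-map f x (y ∷ ys) = last-map f y ys

module Separation {Copy V : Set} (In : Copy → V → Set) (in? : ∀ k v → Dec (In k v)) (_≟ᶜ_ : DecidableEquality Copy)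
                  (L : ℕ) (2≤L : 2 ≤ L) (acyclic : Incidence.Acyclic In L) (fans : Incidence.Fans In) where

  open Incidence In

  Path : (V → Set) → V → List V → Set
  Path = SimplePath Shares

  -- The middle vertex of the ear is skipped; its two neighbours share the copy of the ear.
  shorten : ∀ {Q y ys} → Ear (y ∷ ys) → Path Q y ys → ∃ λ ys′ → Path Q y ys′ × length ys′ < length ys × last y ys′ ≡ last y ys
  shorten {ys = y₁ ∷ y₂ ∷ ys} (here {k = κ} p₁ p₂ p₃) (simple (q ∷ _ ∷ qs) (_ ∷ _ ∷ sh) ((_ ∷ ne) ∷ _ ∷ u)) =
    y₂ ∷ ys , simple (q ∷ qs) ((κ , p₁ , p₃) ∷ sh) (ne ∷ u) , ℕₚ.≤-refl , refl
  shorten {ys = y₁ ∷ ys} (there ear) π@(simple (q ∷ _) (r ∷ _) _) with shorten ear (tail-path π)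
  ... | ys′ , π′ , len , eq = y₁ ∷ ys′ , cons-path q r π′ , s≤s len , eq

  -- The cycles that the path forms with `s` and with `s′` both have ears. An ear within the path
  -- shortens it. Otherwise some copies contain `s`, `y`, `y₁` and `s′`, `y`, `y₁`, and the triangle
  -- `s`, `s′`, `y₁` lies in a copy `k₂`. Then `k₂` replaces `k*` for the path from `y₁`, unless
  -- `k₂ = k`, when `fans` gives `k ≡ k*`.
  separated : ∀ n {k k* s s′ y ys} → length ys ≤ n → length ys + 2 ≤ L → k ≢ k* → s ≢ s′ →
              In k s → In k s′ → In k* s → In k* s′ → Path (λ z → s ≢ z × s′ ≢ z) y ys →
              In k* y → In k (last y ys) → ⊥
  separated n {k} {k*} {s} {s′} {y} {[]} _ _ k≢ s≢ p p′ p* p*′ (simple ((sy , s′y) ∷ []) _ _) py pl =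
    -- The copy `k` itself serves as the third copy of the fan, and `y` as `y₁`.
    k≢ (fans s≢ sy sy s′y s′y p p′ p* p*′ py p pl pl pl)
  separated (suc n) {k} {k*} {s} {s′} {y} {y₁ ∷ ys} (s≤s len) lenL k≢ s≢ p p′ p* p*′ π@(simple ((sy , s′y) ∷ (sy₁ , s′y₁) ∷ _) sh u) py pl =
    cases (acyclic p ((k* , p* , py) ∷ sh) pl (sy ∷ AllPairs⇒Linked u) lenL′)
          (acyclic p′ ((k* , p*′ , py) ∷ sh) pl (s′y ∷ AllPairs⇒Linked u) lenL′)
    where
    lenL′ : length ys + 2 ≤ L
    lenL′ = ℕₚ.≤-trans (ℕₚ.n≤1+n _) lenL
    interior : Ear (y ∷ y₁ ∷ ys) → ⊥
    interior ear with shorten ear π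
    ... | ys′ , π′ , s≤s shorter , eq = separated n (ℕₚ.≤-trans shorter len) (ℕₚ.≤-trans (ℕₚ.+-monoˡ-≤ 2 (ℕₚ.≤-trans shorter (ℕₚ.n≤1+n _))) lenL)
            k≢ s≢ p p′ p* p*′ π′ py (subst (In k) (sym eq) pl)
    drop-first : SimplePath Shares (λ z → s ≢ z × s′ ≢ z) y₁ ys
    drop-first = weaken-path proj₁ (tail-path π)
    cases : Ear (s ∷ y ∷ y₁ ∷ ys) → Ear (s′ ∷ y ∷ y₁ ∷ ys) → ⊥
    cases (there ear) _           = interior ear
    cases _           (there ear) = interior ear
    cases (here {k = κ} κs κy κy₁) (here {k = κ′} κ′s′ κ′y κ′y₁)
      with acyclic {vs = []} κs ((k* , p* , p*′) ∷ (κ′ , κ′s′ , κ′y₁) ∷ [-]) κy₁ (s≢ ∷ s′y₁ ∷ [-]) 2≤L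
    ... | here {k = k₂} k₂s k₂s′ k₂y₁ with k ≟ᶜ k₂
    ...   | no k≢k₂  = separated n len lenL′ k≢k₂ s≢ p p′ k₂s k₂s′ drop-first k₂y₁ pl
    ...   | yes refl = k≢ (fans s≢ sy sy₁ s′y s′y₁ p p′ p* p*′ py κs κy κy₁ k₂y₁)
    cases (here κs κy κy₁) (here κ′s′ κ′y κ′y₁) | there (there (there ()))

  -- The cycle is cut open at `s′`. An ear centred at `s` gives the copy; one centred at `y` allows
  -- `y` to be dropped from the path, and one further on shortens the path.
  bypass : ∀ n {Q : V → Set} {k κ₀ κ₁ s s′ y ys} → length ys ≤ n → length ys + 2 ≤ L → s ≢ s′ → In k s → In k s′ →
           Path (λ z → Q z × s ≢ z) y ys → In κ₀ s → In κ₀ y → In κ₁ (last y ys) → In κ₁ s′ →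
           ∃ λ k* → ∃ λ z → Q z × In k* s × In k* s′ × In k* z
  bypass n {Q} {k} {κ₀} {κ₁} {s} {s′} {y} {ys} len lenL s≢ p p′ π@(simple ((q , sy) ∷ qs) sh u) κ₀s κ₀y κ₁l κ₁s′ =
    cases n len (acyclic {vs = ys} κ₁s′ ((k , p′ , p) ∷ (κ₀ , κ₀s , κ₀y) ∷ sh) κ₁l ((s≢ ∘ sym) ∷ sy ∷ AllPairs⇒Linked u) lenL)
    where
    cases : ∀ n → length ys ≤ n → Ear (s′ ∷ s ∷ y ∷ ys) → ∃ λ k* → ∃ λ z → Q z × In k* s × In k* s′ × In k* z
    cases _ _ (here {k = k*} a b c) = k* , y , q , b , a , c
    cases n len (there ear) = more n len ear π lenL κ₁l
      where
      more : ∀ n {ys} → length ys ≤ n → Ear (s ∷ y ∷ ys) → Path (λ z → Q z × s ≢ z) y ys → length ys + 2 ≤ L → In κ₁ (last y ys) →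
             ∃ λ k* → ∃ λ z → Q z × In k* s × In k* s′ × In k* z
      more (suc n) (s≤s len) (here {k = κ} a b c) π lenL κ₁l =
        bypass n len (ℕₚ.≤-trans (ℕₚ.n≤1+n _) lenL) s≢ p p′ (weaken-path proj₁ (tail-path π)) a c κ₁l κ₁s′
      more n len (there ear) π lenL κ₁l with shorten ear π
      more (suc n) {y₁ ∷ ys} (s≤s len) (there ear) π lenL κ₁l | ys′ , π′ , s≤s shorter , eq =
        bypass n (ℕₚ.≤-trans shorter len) (ℕₚ.≤-trans (ℕₚ.+-monoˡ-≤ 2 (ℕₚ.≤-trans shorter (ℕₚ.n≤1+n _))) lenL) s≢ p p′ π′ κ₀s κ₀y
          (subst (In κ₁) (sym eq) κ₁l) κ₁s′

  first-hit : ∀ {Q k y ys} → Path Q y ys → ¬ In k y → In k (last y ys) →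
              ∃ λ ys′ → ∃ λ s′ → Path (λ z → Q z × ¬ In k z) y ys′ × Q s′ × In k s′ × Shares (last y ys′) s′ × length ys′ ≤ length ys
  first-hit {ys = []} π ¬p pl = contradiction pl ¬p
  first-hit {k = k} {y} {y₁ ∷ ys} π@(simple (q ∷ q₁ ∷ _) (r ∷ _) _) ¬p pl with in? k y₁
  ... | yes p₁ = [] , y₁ , simple ((q , ¬p) ∷ []) [-] ([] ∷ []) , q₁ , p₁ , r , z≤n
  ... | no ¬p₁ with first-hit (tail-path π) ¬p₁ pl
  ...   | ys′ , s′ , π′ , (qs′ , _) , ps′ , sh , len = y₁ ∷ ys′ , s′ ,
            cons-path (q , ¬p) r (weaken-path (λ ((q , ne) , ¬p) → (q , ¬p) , ne) π′) , qs′ , ps′ , sh , s≤s len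

-- Blocks lie in one copy

member-∈ : ∀ {n} (S : Subset n) i → member S i Subset.∈ S
member-∈ (inside  ∷ S) zero    = here
member-∈ (inside  ∷ S) (suc i) = there (member-∈ S i)
member-∈ (outside ∷ S) i       = there (member-∈ S i)

member-injective : ∀ {n} (S : Subset n) {i j} → member S i ≡ member S j → i ≡ j
member-injective (inside  ∷ S) {zero}  {zero}  eq = refl
member-injective (inside  ∷ S) {suc i} {suc j} eq = cong suc (member-injective S (Finₚ.suc-injective eq))
member-injective (outside ∷ S)                 eq = member-injective S (Finₚ.suc-injective eq)

position : ∀ {n} {S : Subset n} {x} → x Subset.∈ S → ∃ λ i → member S i ≡ x
position {S = inside  ∷ S} here       = zero , refl
position {S = inside  ∷ S} (there x∈) = let (i , eq) = position x∈ in suc i , cong suc eq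
position {S = outside ∷ S} (there x∈) = let (i , eq) = position x∈ in i , cong suc eq

other-than : ∀ {n} (s : Fin n) {a b} → a ≢ b → a ≢ s ⊎ b ≢ s
other-than s {a} {b} a≢b with a Fin.≟ s
... | no a≢s   = inj₁ a≢s
... | yes refl = inj₂ (a≢b ∘ sym)

third : ∀ {n} {A : Fin n → Set} (s s′ : Fin n) {a b c} → a ≢ b → a ≢ c → b ≢ c → A a → A b → A c →
        ∃ λ u → A u × u ≢ s × u ≢ s′
third s s′ {a} {b} {c} a≢b a≢c b≢c α β γ with a Fin.≟ s | a Fin.≟ s′
... | no p     | no q     = a , α , p , q
... | yes refl | _        = [ (λ q → b , β , a≢b ∘ sym , q) , (λ q → c , γ , a≢c ∘ sym , q) ]′ (other-than s′ b≢c)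
... | no _     | yes refl = [ (λ q → b , β , q , a≢b ∘ sym) , (λ q → c , γ , q , a≢c ∘ sym) ]′ (other-than s b≢c)

module Blocks {Copy V : Set} (In : Copy → V → Set) (in? : ∀ k v → Dec (In k v)) (_≟ᶜ_ : DecidableEquality Copy)
              (L : ℕ) (2≤L : 2 ≤ L) (acyclic : Incidence.Acyclic In L) (fans : Incidence.Fans In)
              (Adj : V → V → Set) (adj-shares : ∀ {v v′} → Adj v v′ → Incidence.Shares In v v′)
              (common-adj : ∀ {k k′ v v′} → k ≢ k′ → v ≢ v′ → In k v → In k v′ → In k′ v → In k′ v′ → Adj v v′)
              {c : ℕ} (C : Graph c) (ψ : Fin c → V) (ψ-injective : ∀ {x y} → ψ x ≡ ψ y → x ≡ y)
              (ψ-adj : ∀ {x y} → Graph._~_ C x y → Adj (ψ x) (ψ y)) (ψ-adj⁻ : ∀ {x y} → Adj (ψ x) (ψ y) → Graph._~_ C x y)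
              (connected : Connected C) (no-cut : ∀ v → ¬ CutVertex C v)
              (no-edge-cut : ∀ u v → ¬ AdjacentTwoVertexCut C u v) (c+2≤L : c + 2 ≤ L) where

  open Graph C
  open Separation In in? _≟ᶜ_ L 2≤L acyclic fans
  open Incidence In

  Off : Subset c → V → Set
  Off X v = ∃ λ w → v ≡ ψ w × w Subset.∉ X

  -- That `X` is no cut gives reachability only up to double negation, which suffices for deriving
  -- contradictions. The length bound holds because a simple path repeats no vertex of `C`.
  path-avoiding : ∀ X {x y} → x Subset.∉ X → y Subset.∉ X → ¬ VertexCut C X →
                  ¬ ¬ (∃ λ ys → Path (Off X) (ψ x) ys × last (ψ x) ys ≡ ψ y × length ys + 2 ≤ L)
  path-avoiding X x∉ y∉ ¬cut ¬path with position (Subsetₚ.x∉p⇒x∈∁p x∉) | position (Subsetₚ.x∉p⇒x∈∁p y∉)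
  ... | i , refl | j , refl = ¬cut (i , j , λ star → ¬path (build star))
    where
    f : Fin ∣ ∁ X ∣ → V
    f = ψ ∘ member (∁ X)
    build : Reachable (C [ ∁ X ]) i j → ∃ λ ys → Path (Off X) (f i) ys × last (f i) ys ≡ f j × length ys + 2 ≤ L
    build star with simple-path star
    ... | xs , π , l = List.map f xs
        , map-path f (member-injective (∁ X) ∘ ψ-injective) (λ r → adj-shares (ψ-adj r))
            (λ z → member (∁ X) z , refl , Subsetₚ.x∈∁p⇒x∉p (member-∈ (∁ X) z)) π
        , trans (last-map f i xs) (cong f l)
        , ℕₚ.≤-trans (ℕₚ.+-monoˡ-≤ 2 (begin
            length (List.map f xs) ≡⟨ Listₚ.length-map f xs ⟩
            length xs              ≤⟨ ℕₚ.n≤1+n _ ⟩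
            length (i ∷ xs)        ≤⟨ unique-length (SimplePath.distinct π) ⟩
            ∣ ∁ X ∣                ≤⟨ Subsetₚ.∣p∣≤n (∁ X) ⟩
            c                      ∎)) c+2≤L
      where open ℕₚ.≤-Reasoning

  exit : ∀ {k a z} → Reachable C a z → In k (ψ a) → ¬ In k (ψ z) → ∃ λ s → ∃ λ d → s ~ d × In k (ψ s) × ¬ In k (ψ d)
  exit ε p ¬p = contradiction p ¬p
  exit {k} {a} (_◅_ {j = b} r rs) p ¬p with in? k (ψ b)
  ... | yes q = exit rs q ¬p
  ... | no ¬q = a , b , r , p , ¬q

  record Detour (k : Copy) : Set where
    field
      {k*}       : Copy
      {s s′ x}   : Fin c
      s≢s′       : s ≢ s′
      k∋s        : In k (ψ s)
      k∋s′       : In k (ψ s′)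
      k*∋s       : In k* (ψ s)
      k*∋s′      : In k* (ψ s′)
      k*∋x       : In k* (ψ x)
      k∌x        : ¬ In k (ψ x)

    k≢k* : k ≢ k*
    k≢k* eq = k∌x (subst (λ κ → In κ (ψ x)) (sym eq) k*∋x)

  -- Some edge of `C` leads from `s` in `k` to `d` outside. As `s` is no cut vertex, a path from `d`
  -- avoiding `s` returns to `k`; let `s′` be where it first does so. The cycle through `s` and `s′`
  -- then yields `k*` by `bypass`, with `x` on the part outside `k`.
  detour : ∀ {k a b z} → a ≢ b → In k (ψ a) → In k (ψ b) → ¬ In k (ψ z) → ¬ ¬ Detour k
  detour {k} {a} {b} {z} a≢b p q ¬r ¬detour with exit (proj₂ connected a z) p ¬r
  ... | s , d , s~d , ks , ¬kd with [ (λ ne → a , ne , p) , (λ ne → b , ne , q) ]′ (other-than s a≢b)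
  ...   | u , u≢s , ku = path-avoiding ⁅ s ⁆ {d} {u} (off λ { refl → ¬kd ks }) (off u≢s) (no-cut s) (λ (ys , π , l , len) → go ys π l len)
    where
    off : ∀ {x} → x ≢ s → x Subset.∉ ⁅ s ⁆
    off ne x∈ = ne (Subsetₚ.x∈⁅y⁆⇒x≡y s x∈)
    ψs≢ : ∀ {v} → Off ⁅ s ⁆ v → ψ s ≢ v
    ψs≢ (w , refl , w∉) eq with refl ← ψ-injective eq = w∉ (Subsetₚ.x∈⁅x⁆ s)
    go : ∀ ys → Path (Off ⁅ s ⁆) (ψ d) ys → last (ψ d) ys ≡ ψ u → length ys + 2 ≤ L → ⊥
    go ys π l len with first-hit π ¬kd (subst (In k) (sym l) ku) | adj-shares (ψ-adj s~d)
    ... | ys′ , s″ , π′ , (s′ , refl , s′∉) , ks′ , (κ₁ , κ₁l , κ₁s′) , shorter | κ₀ , κ₀s , κ₀d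
      with bypass (length ys′) ℕₚ.≤-refl (ℕₚ.≤-trans (ℕₚ.+-monoˡ-≤ 2 shorter) len) (ψs≢ (s′ , refl , s′∉)) ks ks′
             (weaken-path (λ q → q , ψs≢ (proj₁ q)) π′) κ₀s κ₀d κ₁l κ₁s′
    ... | k* , _ , ((x , refl , _) , ¬kx) , k*s , k*s′ , k*x = ¬detour (record
          { s≢s′ = λ { refl → s′∉ (Subsetₚ.x∈⁅x⁆ s) } ; k∋s = ks ; k∋s′ = ks′ ; k*∋s = k*s ; k*∋s′ = k*s′ ; k*∋x = k*x ; k∌x = ¬kx })

  -- The common vertices `s` and `s′` of two distinct copies are adjacent. Since they are no cut, a
  -- path avoiding them would join `x` in `k*` to `u` in `k`, against `separated`.
  no-third : ∀ {k} (δ : Detour k) → let open Detour δ in ∀ {u} → In k (ψ u) → u ≢ s → u ≢ s′ → ⊥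
  no-third {k} δ {u} ku u≢s u≢s′ =
    path-avoiding X (off (λ { refl → k∌x k∋s }) (λ { refl → k∌x k∋s′ })) (off u≢s u≢s′)
      (λ cut → no-edge-cut s s′ (ψ-adj⁻ (common-adj k≢k* ψs≢ψs′ k∋s k∋s′ k*∋s k*∋s′) , cut))
      (λ (ys , π , l , len) → separated (length ys) ℕₚ.≤-refl len k≢k* ψs≢ψs′ k∋s k∋s′ k*∋s k*∋s′
        (weaken-path (λ q → avoid q (inj₁ (Subsetₚ.x∈⁅x⁆ s)) , avoid q (inj₂ (Subsetₚ.x∈⁅x⁆ s′))) π)
        k*∋x (subst (In k) (sym l) ku))
    where
    open Detour δ
    X = ⁅ s ⁆ ∪ ⁅ s′ ⁆
    ψs≢ψs′ : ψ s ≢ ψ s′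
    ψs≢ψs′ = s≢s′ ∘ ψ-injective
    off : ∀ {x} → x ≢ s → x ≢ s′ → x Subset.∉ X
    off ne ne′ x∈ = [ ne ∘ Subsetₚ.x∈⁅y⁆⇒x≡y s , ne′ ∘ Subsetₚ.x∈⁅y⁆⇒x≡y s′ ]′ (Subsetₚ.x∈p∪q⁻ ⁅ s ⁆ ⁅ s′ ⁆ x∈)
    avoid : ∀ {v w} → Off X v → w Subset.∈ ⁅ s ⁆ ⊎ w Subset.∈ ⁅ s′ ⁆ → ψ w ≢ v
    avoid (w′ , refl , w′∉) w∈ eq with refl ← ψ-injective eq = w′∉ (Subsetₚ.x∈p∪q⁺ w∈)

  outside-of : ∀ k → ¬ (∀ x → In k (ψ x)) → ∃ λ z → ¬ In k (ψ z)
  outside-of k ¬all = Finₚ.¬∀⟶∃¬ c _ (λ x → in? k (ψ x)) ¬all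

  -- A detour from a copy containing an edge of `C` leads to a copy `k*` with three vertices of `C`,
  -- namely `s`, `s′`, `x`. If `k*` missed a vertex as well, one of these three would be a third
  -- vertex for a detour from `k*`.
  in-one-copy : ∀ {a b} → a ~ b → ¬ (∀ k → ¬ (∀ x → In k (ψ x)))
  in-one-copy {a} {b} a~b none with adj-shares (ψ-adj a~b)
  ... | k₀ , p , q = detour (λ eq → ~-irrefl eq a~b) p q (proj₂ (outside-of k₀ (none k₀))) λ δ →
        let open Detour δ in
        detour s≢s′ k*∋s k*∋s′ (proj₂ (outside-of k* (none k*))) λ δ′ →
        let (u , ku , u≢s , u≢s′) = third {A = λ u → In k* (ψ u)} (Detour.s δ′) (Detour.s′ δ′)
              s≢s′ (λ { refl → k∌x k∋s }) (λ { refl → k∌x k∋s′ }) k*∋s k*∋s′ k*∋x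
        in no-third δ′ ku u≢s u≢s′

-- The host

record Embedding {m n} (C : Graph m) (G : Graph n) : Set where
  open Graph C renaming (_~_ to _~ᶜ_)
  open Graph G renaming (_~_ to _~ᴳ_)
  field
    f         : Fin m → Fin n
    injective : ∀ {x y} → f x ≡ f y → x ≡ y
    adjacent⁺ : ∀ {x y} → x ~ᶜ y → f x ~ᴳ f y
    adjacent⁻ : ∀ {x y} → f x ~ᴳ f y → x ~ᶜ y

contains⇒embedding : ∀ {m n} {C : Graph m} {G : Graph n} → ContainsInduced C G → Embedding C G
contains⇒embedding (S , iso) = record
  { f         = λ x → member S (to x)
  ; injective = λ eq → trans (sym (strictlyInverseʳ _)) (trans (cong from (member-injective S eq)) (strictlyInverseʳ _))
  ; adjacent⁺ = λ {x} {y} → Equivalence.to (_≅_.adjacent iso x y)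
  ; adjacent⁻ = λ {x} {y} → Equivalence.from (_≅_.adjacent iso x y)
  }
  where open Inverse (_≅_.vertices iso)

embedding⇒contains : ∀ {m n} {C : Graph m} {G : Graph n} → Embedding C G → ContainsInduced C G
embedding⇒contains {m} {n} {C} {G} ι = S , record
  { vertices = mk↔ₛ′ to from
      (λ i → member-injective S (trans (member-to (from i)) (proj₂ (preimage (member-∈ S i)))))
      (λ x → injective (trans (proj₂ (preimage (member-∈ S (to x)))) (member-to x)))
  ; adjacent = λ x y → mk⇔ (λ a → subst₂ _~_ (sym (member-to x)) (sym (member-to y)) (adjacent⁺ a))
                           (λ a → adjacent⁻ (subst₂ _~_ (member-to x) (member-to y) a))
  }
  where
  open Embedding ι
  open Graph G
  hit? : ∀ y → Dec (∃ λ x → f x ≡ y)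
  hit? y = Finₚ.any? (λ x → f x Fin.≟ y)
  S : Subset n
  S = Vec.tabulate (does ∘ hit?)
  f∈S : ∀ x → f x Subset.∈ S
  f∈S x = Vecₚ.lookup⇒[]= (f x) S (trans (Vecₚ.lookup∘tabulate (does ∘ hit?) (f x)) (dec-true (hit? (f x)) (x , refl)))
  preimage : ∀ {y} → y Subset.∈ S → ∃ λ x → f x ≡ y
  preimage {y} y∈ = found (hit? y) (trans (sym (Vecₚ.lookup∘tabulate (does ∘ hit?) y)) (Vecₚ.[]=⇒lookup y∈))
    where
    found : ∀ {P : Set} (d : Dec P) → does d ≡ inside → P
    found (yes p) _ = p
  to : Fin m → Fin ∣ S ∣
  to x = proj₁ (position (f∈S x))
  member-to : ∀ x → member S (to x) ≡ f x
  member-to x = proj₂ (position (f∈S x))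
  from : Fin ∣ S ∣ → Fin m
  from i = proj₁ (preimage (member-∈ S i))

induced-embedding : ∀ {n} (G : Graph n) (S : Subset n) → Embedding (G [ S ]) G
induced-embedding G S = record { f = member S ; injective = member-injective S ; adjacent⁺ = id ; adjacent⁻ = id }

_∘ᴱ_ : ∀ {l m n} {B : Graph l} {C : Graph m} {G : Graph n} → Embedding C G → Embedding B C → Embedding B G
ι ∘ᴱ κ = record
  { f         = I.f ∘ J.f
  ; injective = J.injective ∘ I.injective
  ; adjacent⁺ = I.adjacent⁺ ∘ J.adjacent⁺
  ; adjacent⁻ = J.adjacent⁻ ∘ I.adjacent⁻
  }
  where module I = Embedding ι
        module J = Embedding κ

module Host (ℓ t′ : ℕ) (Edge : Fin (suc t′) → Fin ℓ → Fin ℓ → Set) (edge? : ∀ s i j → Dec (Edge s i j))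
            (edge-sym : ∀ {s i j} → Edge s i j → Edge s j i) (edge-irrefl : ∀ {s i} → ¬ Edge s i i)
            (L : ℕ) (2≤L : 2 ≤ L) where

  open Copies ℓ t′ Edge edge? edge-sym L public

  Adj : V → V → Set
  Adj v v′ = ∃ λ k → In k v × In k v′ × Edge (type k) (lab v) (lab v′)

  adj? : ∀ v v′ → Dec (Adj v v′)
  adj? v v′ = Finite.any? copy-finite (λ k → in? k v ×-dec in? k v′ ×-dec edge? (type k) (lab v) (lab v′))

  adj-sym : ∀ {v v′} → Adj v v′ → Adj v′ v
  adj-sym (k , p , q , a) = k , q , p , edge-sym a

  adj-irrefl : ∀ {v} → ¬ Adj v v
  adj-irrefl (_ , _ , _ , a) = edge-irrefl a

  -- Copies are induced: two copies with two common vertices are equal or linked along that pair,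
  -- and a link demands an edge in both types.
  adj-in : ∀ {k v v′} → In k v → In k v′ → Adj v v′ → Edge (type k) (lab v) (lab v′)
  adj-in {k} {v} {v′} p q adj@(k′ , p′ , q′ , a) = near-edge (two-common 2≤L {k′} {k} {v} {v′} v≢v′ p′ q′ p q) a
    where
    v≢v′ : v ≢ v′
    v≢v′ eq = adj-irrefl {v′} (subst (λ v → Adj v v′) eq adj)

  common-adj : ∀ {k k′ v v′} → k ≢ k′ → v ≢ v′ → In k v → In k v′ → In k′ v → In k′ v′ → Adj v v′
  common-adj {k} {k′} {v} {v′} k≢k′ v≢v′ p q p′ q′ =
    k , p , q , near-distinct (two-common 2≤L {k} {k′} {v} {v′} v≢v′ p q p′ q′) k≢k′

  N : ℕ
  N = Finite.size V-finite

  index : V → Fin N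
  index = Finite.to V-finite

  place : Fin N → V
  place = Finite.from V-finite

  place-index : ∀ v → place (index v) ≡ v
  place-index = Finite.from-to V-finite

  index-injective : ∀ {v v′} → index v ≡ index v′ → v ≡ v′
  index-injective = Finite.to-injective V-finite

  -- The enumeration of V may repeat elements; only one number for each of them is used.
  Proper : Fin N → Set
  Proper x = index (place x) ≡ x

  proper-index : ∀ v → Proper (index v)
  proper-index v = cong index (place-index v)

  G : Graph N
  G = record
    { _~_      = λ x y → Proper x × Proper y × Adj (place x) (place y)
    ; ~-sym    = λ (p , q , a) → q , p , adj-sym a
    ; ~-irrefl = λ { refl (_ , _ , a) → adj-irrefl a }
    ; _~?_     = λ x y → (index (place x) Fin.≟ x) ×-dec (index (place y) Fin.≟ y) ×-dec adj? (place x) (place y)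
    }

  index-adj : ∀ {v v′} → Adj v v′ → Graph._~_ G (index v) (index v′)
  index-adj {v} {v′} a = proper-index v , proper-index v′ , subst₂ Adj (sym (place-index v)) (sym (place-index v′)) a

  index-adj⁻ : ∀ {v v′} → Graph._~_ G (index v) (index v′) → Adj v v′
  index-adj⁻ {v} {v′} (_ , _ , a) = subst₂ Adj (place-index v) (place-index v′) a

  typeGraph : Fin (suc t′) → Graph ℓ
  typeGraph s = record { _~_ = Edge s ; ~-sym = edge-sym ; ~-irrefl = λ { refl → edge-irrefl } ; _~?_ = edge? s }

  module _ {c} (C : Graph c) (connected : Connected C) (no-cut : ∀ v → ¬ CutVertex C v)
           (no-edge-cut : ∀ u v → ¬ AdjacentTwoVertexCut C u v) (c+2≤L : c + 2 ≤ L) where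

    open Graph C

    in-type-graph : ∀ {a b} → a ~ b → Embedding C G → ¬ (∀ s → ¬ Embedding C (typeGraph s))
    in-type-graph {a} {b} a~b ι none = Blocks.in-one-copy In in? _≟ᶜ_ L 2≤L acyclic (fans 2≤L) Adj
      (λ (k , p , q , _) → k , p , q) common-adj C ψ ψ-injective (λ a → proj₂ (proj₂ (adjacent⁺ a)))
      ψ-adj⁻ connected no-cut no-edge-cut c+2≤L a~b
      (λ k all → none (type k) (record
        { f         = lab ∘ ψ
        ; injective = λ {x} {y} eq → ψ-injective (in-lab (all x) (all y) eq)
        ; adjacent⁺ = λ {x} {y} r → adj-in (all x) (all y) (proj₂ (proj₂ (adjacent⁺ r)))
        ; adjacent⁻ = λ {x} {y} e → ψ-adj⁻ (k , all x , all y , e)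
        }))
      where
      open Embedding ι
      ψ : Fin c → V
      ψ x = place (f x)
      neighbour : ∀ x → ∃ λ y → x ~ y
      neighbour x with proj₂ connected x a
      ... | ε      = b , a~b
      ... | r ◅ rs = _ , r
      -- Being connected with an edge, `C` has no isolated vertex, and in the host only proper
      -- numbers have neighbours.
      proper : ∀ x → Proper (f x)
      proper x = proj₁ (adjacent⁺ (proj₂ (neighbour x)))
      ψ-injective : ∀ {x y} → ψ x ≡ ψ y → x ≡ y
      ψ-injective {x} {y} eq = injective (trans (sym (proper x)) (trans (cong index eq) (proper y)))
      ψ-adj⁻ : ∀ {x y} → Adj (ψ x) (ψ y) → x ~ y
      ψ-adj⁻ {x} {y} a = adjacent⁻ (proper x , proper y , a)

    edgeless-embedding : Fin ℓ → (∀ a b → ¬ a ~ b) → Embedding C (typeGraph zero)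
    edgeless-embedding i none = record
      { f         = λ _ → i
      ; injective = λ {x} {y} _ → trivial (proj₂ connected x y)
      ; adjacent⁺ = λ r → contradiction r (none _ _)
      ; adjacent⁻ = λ e → contradiction e edge-irrefl
      }
      where
      trivial : ∀ {x y} → Reachable C x y → x ≡ y
      trivial ε       = refl
      trivial (r ◅ _) = contradiction r (none _ _)

    host-free : Fin ℓ → (∀ s → ¬ Embedding C (typeGraph s)) → ¬ Embedding C G
    host-free i none ι with Finₚ.any? (λ a → Finₚ.any? (λ b → a ~? b))
    ... | yes (a , b , a~b) = in-type-graph a~b ι none
    ... | no ∄              = none zero (edgeless-embedding i (λ a b r → ∄ (a , b , r)))

  -- Following the letter of the common edge by the difference of the types leads to a linked copy
  -- of type `s`.
  retype : ∀ {k v v′ s} → In k v → In k v′ → Edge (type k) (lab v) (lab v′) → Edge s (lab v) (lab v′) →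
           ∃ λ g → In (g , s) v × In (g , s) v′
  retype {k} {v} {v′} {s} p q a b = iter (stepK (e (lab v) (lab v′))) d (elt k) , near-in near refl p , near-in (near-swap near) refl q
    where
    d = diff (type k) s
    k′ : Copy
    k′ = iter (stepK (e (lab v) (lab v′))) d (elt k) , s
    near : Near (lab v) (lab v′) k k′
    near = linked (link a b (cong (iter (stepK (e (lab v) (lab v′))) d (elt k) ,_) (sym (next-diff (type k) s))))

-- Types that place the added edge at a given pair, and the deletion host

transpose-first : ∀ {n} (i j : Fin n) → transpose i j i ≡ j
transpose-first i j rewrite dec-true (i Fin.≟ i) refl = refl

transpose-other : ∀ {n} {i j k : Fin n} → k ≢ i → k ≢ j → transpose i j k ≡ k
transpose-other {i = i} {j} {k} k≢i k≢j rewrite dec-false (k Fin.≟ i) k≢i | dec-false (k Fin.≟ j) k≢j = refl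

module Construction {n : ℕ} (H : Graph n) (u₀ v₀ : Fin n) (e₀ : NonEdge H u₀ v₀) where

  F : Graph n
  F = addEdge H u₀ v₀ (proj₁ e₀)

  open Graph H renaming (_~_ to _~ᴴ_; ~-irrefl to irreflᴴ)
  open Graph F renaming (_~_ to _~ꟳ_; ~-sym to symꟳ; ~-irrefl to irreflꟳ; _~?_ to _~?ꟳ_)

  -- A permutation of Fin n that sends p to u₀ and q to v₀, and its inverse.
  toward from : Fin n → Fin n → Fin n → Fin n
  toward p q x = transpose (transpose p u₀ q) v₀ (transpose p u₀ x)
  from   p q y = transpose u₀ p (transpose v₀ (transpose p u₀ q) y)

  toward-from : ∀ p q y → toward p q (from p q y) ≡ y
  toward-from p q y = trans (cong (transpose q′ v₀) (transpose-inverse p u₀ {transpose v₀ q′ y})) (transpose-inverse q′ v₀ {y})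
    where q′ = transpose p u₀ q

  from-toward : ∀ p q x → from p q (toward p q x) ≡ x
  from-toward p q x = trans (cong (transpose u₀ p) (transpose-inverse v₀ q′ {transpose p u₀ x})) (transpose-inverse u₀ p {x})
    where q′ = transpose p u₀ q

  toward-first : ∀ {p q} → p ≢ q → toward p q p ≡ u₀
  toward-first {p} {q} p≢q = trans (cong (transpose q′ v₀) (transpose-first p u₀)) (transpose-other u₀≢q′ (proj₁ e₀))
    where
    q′ = transpose p u₀ q
    u₀≢q′ : u₀ ≢ q′
    u₀≢q′ eq = p≢q (begin
      p                   ≡⟨ sym (transpose-first u₀ p) ⟩
      transpose u₀ p u₀   ≡⟨ cong (transpose u₀ p) eq ⟩
      transpose u₀ p q′   ≡⟨ transpose-inverse u₀ p {q} ⟩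
      q                   ∎)
      where open ≡-Reasoning

  toward-second : ∀ p q → toward p q q ≡ v₀
  toward-second p q = transpose-first (transpose p u₀ q) v₀

  -- Type zero is F itself; the others are the images of F with the edge e₀ moved to a given pair.
  Type : Set
  Type = Fin (suc (n * n))

  relabel unlabel : Type → Fin n → Fin n
  relabel zero    x = x
  relabel (suc c) x = let (p , q) = Fin.remQuot {n} n c in toward p q x
  unlabel zero    y = y
  unlabel (suc c) y = let (p , q) = Fin.remQuot {n} n c in from p q y

  relabel-unlabel : ∀ s y → relabel s (unlabel s y) ≡ y
  relabel-unlabel zero    y = refl
  relabel-unlabel (suc c) y = let (p , q) = Fin.remQuot {n} n c in toward-from p q y

  unlabel-relabel : ∀ s x → unlabel s (relabel s x) ≡ x
  unlabel-relabel zero    x = refl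
  unlabel-relabel (suc c) x = let (p , q) = Fin.remQuot {n} n c in from-toward p q x

  typeOf : Fin n → Fin n → Type
  typeOf p q = suc (Fin.combine p q)

  relabel-typeOf : ∀ p q x → relabel (typeOf p q) x ≡ toward p q x
  relabel-typeOf p q x = cong (λ (p , q) → toward p q x) (Finₚ.remQuot-combine p q)

  Edge : Type → Fin n → Fin n → Set
  Edge s i j = relabel s i ~ꟳ relabel s j

  edge-unlabel : ∀ s {x y} → x ~ꟳ y → Edge s (unlabel s x) (unlabel s y)
  edge-unlabel s {x} {y} = subst₂ _~ꟳ_ (sym (relabel-unlabel s x)) (sym (relabel-unlabel s y))

  edge-unlabel⁻ : ∀ s {x y} → Edge s (unlabel s x) (unlabel s y) → x ~ꟳ y
  edge-unlabel⁻ s {x} {y} = subst₂ _~ꟳ_ (relabel-unlabel s x) (relabel-unlabel s y)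

  -- The value `n + 2` of `L` meets the requirement `c + 2 ≤ L`, as an induced subgraph of `H` has
  -- at most `n` vertices.
  open Host n (n * n) Edge (λ s i j → relabel s i ~?ꟳ relabel s j) symꟳ (irreflꟳ refl) (n + 2) (ℕₚ.m≤n+m 2 n)

  type-embedding : ∀ s → Embedding (typeGraph s) F
  type-embedding s = record
    { f         = relabel s
    ; injective = λ {x} {y} eq → trans (sym (unlabel-relabel s x)) (trans (cong (unlabel s) eq) (unlabel-relabel s y))
    ; adjacent⁺ = id
    ; adjacent⁻ = id
    }

  free : (S : Subset n) → Connected (H [ S ]) → (∀ v → ¬ CutVertex (H [ S ]) v) →
         (∀ u v → ¬ AdjacentTwoVertexCut (H [ S ]) u v) → ((H [ S ]) -Free) F → (H -Free) G
  free S connected no-cut no-edge-cut C-free inG =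
    host-free (H [ S ]) connected no-cut no-edge-cut (ℕₚ.+-monoˡ-≤ 2 (Subsetₚ.∣p∣≤n S)) u₀
      (λ s ι → C-free (embedding⇒contains (type-embedding s ∘ᴱ ι)))
      (contains⇒embedding inG ∘ᴱ induced-embedding H S)

  hasEdge : ∃[ x ] ∃[ y ] Graph._~_ G x y
  hasEdge = index (vertex k u₀) , index (vertex k v₀) , index-adj (k , in-vertex u₀ valid-unit , in-vertex v₀ valid-unit ,
    subst₂ _~ꟳ_ (sym (lab-vertex k u₀)) (sym (lab-vertex k v₀)) (inj₂ (inj₁ (refl , refl))))
    where
    k : Copy
    k = unit , zero

  -- The type `s` places `e₀` at the labels of the edge, and `retype` finds a copy of this type
  -- containing the edge. That copy of `F` minus the edge is an induced copy of `H`.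
  module Deletion {x y : Fin N} (xy : Graph._~_ G x y) where

    v v′ : V
    v  = place x
    v′ = place y

    p q : Fin n
    p = lab v
    q = lab v′

    s : Type
    s = typeOf p q

    p≢q : p ≢ q
    p≢q eq = let (_ , _ , κ , _ , _ , a) = xy in irreflꟳ (cong (relabel (type κ)) eq) a

    relabel-p : relabel s p ≡ u₀
    relabel-p = trans (relabel-typeOf p q p) (toward-first p≢q)

    relabel-q : relabel s q ≡ v₀
    relabel-q = trans (relabel-typeOf p q q) (toward-second p q)

    unlabel-u₀ : unlabel s u₀ ≡ p
    unlabel-u₀ = trans (cong (unlabel s) (sym relabel-p)) (unlabel-relabel s p)

    unlabel-v₀ : unlabel s v₀ ≡ q
    unlabel-v₀ = trans (cong (unlabel s) (sym relabel-q)) (unlabel-relabel s q)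

    retyped : ∃ λ g → In (g , s) v × In (g , s) v′
    retyped = let (_ , _ , _ , a , b , ab) = xy in retype a b ab (inj₂ (inj₁ (relabel-p , relabel-q)))

    k : Copy
    k = proj₁ retyped , s

    in-k : ∀ i → In k (vertex k i)
    in-k i = in-vertex i (In.valid (proj₁ (proj₂ retyped)))

    f : Fin n → Fin N
    f z = index (vertex k (unlabel s z))

    f-injective : ∀ {z w} → f z ≡ f w → z ≡ w
    f-injective {z} {w} eq = trans (sym (relabel-unlabel s z)) (trans (cong (relabel s) (trans (sym (lab-vertex k _))
      (trans (cong lab (index-injective eq)) (lab-vertex k _)))) (relabel-unlabel s w))

    f-u₀ : f u₀ ≡ x
    f-u₀ = trans (cong index (trans (cong (vertex k) unlabel-u₀) (sym (in-unique (proj₁ (proj₂ retyped)))))) (proj₁ xy)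

    f-v₀ : f v₀ ≡ y
    f-v₀ = trans (cong index (trans (cong (vertex k) unlabel-v₀) (sym (in-unique (proj₂ (proj₂ retyped)))))) (proj₁ (proj₂ xy))

    f-adj : ∀ {z w} → z ~ꟳ w → Graph._~_ G (f z) (f w)
    f-adj {z} {w} a = index-adj (k , in-k _ , in-k _ , subst₂ (Edge s) (sym (lab-vertex k _)) (sym (lab-vertex k _)) (edge-unlabel s a))

    f-adj⁻ : ∀ {z w} → Graph._~_ G (f z) (f w) → z ~ꟳ w
    f-adj⁻ {z} {w} a = edge-unlabel⁻ s (subst₂ (Edge s) (lab-vertex k _) (lab-vertex k _) (adj-in (in-k _) (in-k _) (index-adj⁻ a)))

    same-pair : ∀ {z w} → SamePair u₀ v₀ z w → SamePair x y (f z) (f w)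
    same-pair (inj₁ (refl , refl)) = inj₁ (f-u₀ , f-v₀)
    same-pair (inj₂ (refl , refl)) = inj₂ (f-v₀ , f-u₀)

    same-pair⁻ : ∀ {z w} → SamePair x y (f z) (f w) → SamePair u₀ v₀ z w
    same-pair⁻ (inj₁ (a , b)) = inj₁ (f-injective (trans a (sym f-u₀)) , f-injective (trans b (sym f-v₀)))
    same-pair⁻ (inj₂ (a , b)) = inj₂ (f-injective (trans a (sym f-v₀)) , f-injective (trans b (sym f-u₀)))

    nonedge : ∀ {z w} → z ~ᴴ w → ¬ SamePair u₀ v₀ z w
    nonedge a (inj₁ (refl , refl)) = proj₂ e₀ a
    nonedge a (inj₂ (refl , refl)) = proj₂ e₀ (Graph.~-sym H a)

    embedding : Embedding H (deleteEdge G x y)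
    embedding = record
      { f         = f
      ; injective = f-injective
      ; adjacent⁺ = λ a → f-adj (inj₁ a) , nonedge a ∘ same-pair⁻
      ; adjacent⁻ = λ (a , ¬same) → [ id , (λ same → contradiction (same-pair same) ¬same) ]′ (f-adj⁻ a)
      }

  host : (S : Subset n) → Connected (H [ S ]) → (∀ v → ¬ CutVertex (H [ S ]) v) →
         (∀ u v → ¬ AdjacentTwoVertexCut (H [ S ]) u v) → ((H [ S ]) -Free) F → HasDeletionHost H
  host S connected no-cut no-edge-cut C-free = N , G , record
    { hasEdge   = hasEdge
    ; free      = free S connected no-cut no-edge-cut C-free
    ; deletions = λ x y xy → embedding⇒contains (Deletion.embedding xy)
    }

theorem4p4 : {n : ℕ} (H : Graph n) (S : Subset n) →
    Connected (H [ S ]) →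
    (∀ v → ¬ CutVertex (H [ S ]) v) →
    (∀ u v → ¬ AdjacentTwoVertexCut (H [ S ]) u v) →
    (u₀ v₀ : Fin n) (e₀ : NonEdge H u₀ v₀) →
    ((H [ S ]) -Free) (addEdge H u₀ v₀ (proj₁ e₀)) →
    HasDeletionHost H
theorem4p4 H S connected no-cut no-edge-cut u₀ v₀ e₀ C-free = host S connected no-cut no-edge-cut C-free
  where open Construction H u₀ v₀ e₀ using (host)
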